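{- For any positive integers $s,t,k$ with $s<t\le k$, there is an integer $v^*$ (depending only on $t$ and $k+t-s$) such that an AOA$(s,t,k,v)$ exists for every integer $v\ge v^*$.
   Context: An orthogonal array OA$(t,k,v)$ is a $v^t\times k$ array with entries from a set $X$ of size $v$ such that the restriction to any $t$ columns contains every $t$-tuple of $X^t$ exactly once. An AOA$(s,t,k,v)$ is a $v^t\times (k+1)$ array $A$ such that: (1) the first $k$ columns form an OA$(t,k,v)$ on a set $X$ with $|X|=v$; (2) the last column has symbols from a set $Y$ with $|Y|=v^{t-s}$; (3) any $s$ of the first $k$ columns together with the last column contain every $(s+1)$-tuple of $X^s\times Y$ exactly once. -}

module Defs where

open import Data.Nat using (ℕ; _^_; _∸_)
open import Data.Fin using (Fin)
open import Data.Product using (∃!; _×_)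
open import Relation.Binary.PropositionalEquality using (_≡_)
open import Function.Definitions using (Injective)

Array : ℕ → ℕ → ℕ → Set
Array N k v = Fin N → Fin k → Fin v

IsOA : (t k v : ℕ) → Array (v ^ t) k v → Set
IsOA t k v A =
  (c : Fin t → Fin k) → Injective _≡_ _≡_ c →
  (x : Fin t → Fin v) →
  ∃! _≡_ (λ r → (i : Fin t) → A r (c i) ≡ x i)

-- AOA(s,t,k,v): a v^t × (k+1) array, given as its first k columns A
-- (symbols from X = Fin v) and its last column L (symbols from
-- Y = Fin (v^(t-s))), such that (1) A is an OA(t,k,v), and (3) any s
-- (distinct) of the first k columns together with the last column contain
-- every (s+1)-tuple of X^s × Y exactly once.
record AOA (s t k v : ℕ) : Set where
  field
    A     : Array (v ^ t) k v
    L     : Fin (v ^ t) → Fin (v ^ (t ∸ s))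
    isOA  : IsOA t k v A
    isAug : (c : Fin s → Fin k) → Injective _≡_ _≡_ c →
            (x : Fin s → Fin v) → (y : Fin (v ^ (t ∸ s))) →
            ∃! _≡_ (λ r → ((i : Fin s) → A r (c i) ≡ x i) × L r ≡ y)

{-# OPTIONS --safe #-}
module Submission where

-- Merging t - s columns of an OA(t, k + t - s, n) gives an AOA(s, t, k, n), so one needs an
-- OA(t, k, n) for every large n.  Write n = m a + Σ w_c and take m a ordinary symbols and, for
-- each label c, w_c symbols labelled c.  Let M be a group of order a with commuting
-- endomorphisms as evaluation points, enough of them with injective differences.  By Hermite
-- interpolation, t constraints of the form "D(z_i) = x" or "one more zero at ζ_c" determine a
-- polynomial D = γ z^t + … over M, and D has at most t zeros among the ζ_c.  So it suffices to
-- put over each D an array with m ordinary symbols in which the label c occurs at most e_c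
-- times per row, where e_c is the multiplicity of the zero ζ_c: a typed array, with Σ e_c ≤ t.
--
-- A typed array is first made λ-fold, with weights w_c = 1: solving a triangular system gives
-- non-negative multiplicities as soon as the number of ordinary symbols is large.  The λ words
-- over each tuple are then separated by giving every symbol a further coordinate, in r points,
-- and using cosets of a code over ℤ/λ whose position can be prescribed independently on all
-- t-sets of columns.  This makes m and all weights multiples of r.  To obtain weights without a
-- common factor, take pairwise coprime r_0, …, r_t and labels of t + 1 kinds, those of kind j
-- having weight ∏_{i ≠ j} r_i.  A type involves at most t labels, hence misses a kind j; then r_j
-- divides all weights that matter, and the other factors r_i are supplied by the polynomial
-- construction, in which only the labels of kind i are treated as zeros.
--
-- Finally the weights generate ℤ, so the labels can be chosen with n - Σ w_c = m b and
-- b ≡ 1 modulo (k + t)!.  A large b has a factor a which is a power q^E or free of small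
-- factors; in both cases there is a suitable M of order a, and b / a is absorbed into m.

open import Defs
open import Data.Nat as ℕ using (ℕ; zero; suc; pred; _≤_; _<_; _⊓_; _!; z≤n; s≤s; NonZero)
import Data.Nat.Properties as ℕ
open import Data.Nat.Coprimality using (Coprime; coprime-divisor)
open import Data.Nat.Divisibility using (_∣_; divides; _∣?_; ∣⇒≤; ∣-refl; ∣-trans; ∣1⇒≡1; 0∣⇒≡0; m%n≡0⇒n∣m; m∣m*n; n∣m*n; m≤n⇒m!∣n!; ∣m+n∣m⇒∣n)
open import Data.Nat.DivMod using (_/_; _%_; _mod_; m%n<n; m<n⇒m%n≡m; m%n%n≡m%n; %-distribˡ-+; n%n≡0; m≡m%n+[m/n]*n)
open import Data.Nat.Solver using (module +-*-Solver)
open import Data.Bool using (Bool; true; false; if_then_else_; _∧_)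
open import Data.Fin as Fin using (Fin; zero; suc; toℕ; fromℕ; fromℕ<; inject₁; inject≤; punchOut; cast; splitAt; join; _↑ˡ_; _↑ʳ_; combine; remQuot; funToFin; finToFun)
import Data.Fin.Properties as Fin
open import Data.Fin.Properties using (toℕ-injective; toℕ<n; toℕ-fromℕ<; any?)
open import Data.Fin.Induction using (>-weakInduction)
open import Data.Maybe as Maybe using (Maybe; just; nothing; _>>=_)
open import Data.List as List using (List; []; _∷_; length; _++_)
open import Data.List.Properties using (length-++)
open import Data.List.Relation.Unary.All using (All; []; _∷_)
open import Data.Vec using (Vec; []; _∷_; lookup; tabulate; map; zipWith; replicate; sum; _[_]≔_)
open import Data.Vec.Properties using (tabulate∘lookup; tabulate-cong; lookup∘tabulate; lookup-map; lookup-zipWith; lookup-replicate; lookup∘update; lookup∘update′; zipWith-assoc; zipWith-comm; zipWith-identityˡ; zipWith-identityʳ; zipWith-inverseˡ; zipWith-inverseʳ; map-∘; map-cong; ∷-injectiveʳ)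
open import Data.Product using (Σ; ∃; ∃!; _×_; _,_; proj₁; proj₂)
open import Data.Sum as Sum using (_⊎_; inj₁; inj₂; [_,_]′)
import Data.Sum.Properties as Sum
open import Data.Unit using (⊤; tt)
open import Data.Empty using (⊥; ⊥-elim)
open import Algebra.Structures using (IsAbelianGroup)
open import Algebra.Bundles using (AbelianGroup)
import Algebra.Properties.AbelianGroup as AbelianGroupProperties
import Algebra.Properties.CommutativeMonoid.Mult as Mult
open import Axiom.UniquenessOfIdentityProofs using (module Decidable⇒UIP)
open import Function using (_∘_; id)
open import Function.Definitions using (Injective)
open import Relation.Binary using (tri<; tri≈; tri>)
open import Relation.Binary.PropositionalEquality
open import Relation.Nullary using (¬_; Dec; yes; no; contradiction; does)
open import Relation.Nullary.Decidable using (_→-dec_)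

private
  variable
    n m k l d strength points : ℕ
    A B : Set

-- A symbol labelled c has no coordinate in M; it only records that D vanishes at ζ_c. So a label
-- adds w_c, and not w_c a, to n, which frees n from being a multiple of a. Fixing the leading
-- coefficient γ ≠ 0 makes the count right, a^t polynomials for t constraints, and limits the zeros
-- to t. In the resulting array every label has capacity t, so no tuple is excluded and the labels
-- can be forgotten; yet each array placed over a D has total capacity at most t, however many
-- labels there are. The obstacle is that the arrays over different D must share the number of
-- ordinary symbols and the weight of every label. Types that miss different kinds therefore have to
-- be served by arrays of one common size. Folding turns existence into a linear system for the
-- multiplicities of words, with positivity coming from the abundance of ordinary symbols. The
-- number of a word among those over the same tuple depends on the t-set in an uncontrolled way,
-- which is why the separating code must have its class prescribed on all t-sets independently.

injective⇒surjective : (f : Fin n → Fin n) → (∀ {x y} → f x ≡ f y → x ≡ y) →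
                       ∀ y → ∃ λ x → f x ≡ y
injective⇒surjective {suc n} f inj y with any? (λ x → f x Fin.≟ y)
... | yes hit = hit
... | no miss = ⊥-elim (ℕ.1+n≰n (Fin.injective⇒≤ {f = g} g-injective))
  where
  g : Fin (suc n) → Fin n
  g x = punchOut {i = y} {j = f x} (λ y≡fx → miss (x , sym y≡fx))
  g-injective : ∀ {a b} → g a ≡ g b → a ≡ b
  g-injective {a} {b} eq = inj (Fin.punchOut-injective (λ e → miss (a , sym e)) (λ e → miss (b , sym e)) eq)

-- Groups with evaluation points

record FiniteAbelianGroup : Set₁ where
  infixl 6 _+_
  infix 8 -_
  field
    Carrier        : Set
    _+_            : Carrier → Carrier → Carrier
    0#             : Carrier
    -_             : Carrier → Carrier
    isAbelianGroup : IsAbelianGroup _≡_ _+_ 0# -_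
    order          : ℕ
    index          : Carrier → Fin order
    element        : Fin order → Carrier
    index-element  : ∀ i → index (element i) ≡ i
    element-index  : ∀ x → element (index x) ≡ x

  abelianGroup : AbelianGroup _ _
  abelianGroup = record { isAbelianGroup = isAbelianGroup }

  open IsAbelianGroup isAbelianGroup public
    using (assoc; comm; identityˡ; identityʳ; inverseˡ; inverseʳ)
  open AbelianGroupProperties abelianGroup public
    using (∙-cancelˡ; ∙-cancelʳ; ⁻¹-∙-comm; ⁻¹-involutive; ε⁻¹≈ε; inverseʳ-unique; xyx⁻¹≈y)
  open Mult (AbelianGroup.commutativeMonoid abelianGroup) public
    using () renaming (_×_ to _·_; ×-homo-+ to ·-homo-+; ×-distrib-+ to ·-distrib-+; ×-assocˡ to ·-assocˡ)

  index-injective : ∀ {x y} → index x ≡ index y → x ≡ y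
  index-injective {x} {y} eq =
    trans (sym (element-index x)) (trans (cong element eq) (element-index y))

  infix 4 _≟_
  _≟_ : ∀ (x y : Carrier) → Dec (x ≡ y)
  x ≟ y with index x Fin.≟ index y
  ... | yes eq = yes (index-injective eq)
  ... | no neq = no (neq ∘ cong index)

  infixl 6 _-_
  _-_ : Carrier → Carrier → Carrier
  x - y = x + - y

  x-y+y≡x : ∀ x y → (x - y) + y ≡ x
  x-y+y≡x x y = trans (assoc x (- y) y) (trans (cong (x +_) (inverseˡ y)) (identityʳ x))

  x+y-y≡x : ∀ x y → (x + y) - y ≡ x
  x+y-y≡x x y = trans (assoc x y (- y)) (trans (cong (x +_) (inverseʳ y)) (identityʳ x))

  x-y≡0⇒x≡y : ∀ {x y} → x - y ≡ 0# → x ≡ y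
  x-y≡0⇒x≡y {x} {y} eq = trans (sym (x-y+y≡x x y)) (trans (cong (_+ y) eq) (identityˡ y))

  interchange : ∀ a b c d → (a + b) + (c + d) ≡ (a + c) + (b + d)
  interchange a b c d = begin
    (a + b) + (c + d) ≡⟨ assoc a b (c + d) ⟩
    a + (b + (c + d)) ≡⟨ cong (a +_) (sym (assoc b c d)) ⟩
    a + ((b + c) + d) ≡⟨ cong (λ s → a + (s + d)) (comm b c) ⟩
    a + ((c + b) + d) ≡⟨ cong (a +_) (assoc c b d) ⟩
    a + (c + (b + d)) ≡⟨ sym (assoc a c (b + d)) ⟩
    (a + c) + (b + d) ∎
    where open ≡-Reasoning

  injective⇒surjective′ : (f : Carrier → Carrier) → (∀ {x y} → f x ≡ f y → x ≡ y) →
                          ∀ y → ∃ λ x → f x ≡ y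
  injective⇒surjective′ f inj y =
    let i , eq = injective⇒surjective (index ∘ f ∘ element)
                   (λ {a} {b} e → trans (sym (index-element a))
                     (trans (cong index (inj (index-injective e))) (index-element b))) (index y)
    in element i , index-injective eq

  nonzero : 1 < order → ∃ λ x → x ≢ 0#
  nonzero 1<n with element (fromℕ< (ℕ.<-trans ℕ.z<s 1<n)) ≟ 0#
  ... | no neq = _ , neq
  ... | yes eq = element (fromℕ< 1<n) , λ eq′ →
    case-01 (trans (sym (Fin.toℕ-fromℕ< (ℕ.<-trans ℕ.z<s 1<n)))
             (trans (cong toℕ (trans (sym (index-element _))
               (trans (cong index (trans eq (sym eq′))) (index-element _))))
               (Fin.toℕ-fromℕ< 1<n)))
    where case-01 : 0 ≡ 1 → ⊥
          case-01 ()

-- Cyclic groups.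

module _ (p : ℕ) where
  private
    q : ℕ
    q = suc p

    infixl 6 _⊕_
    _⊕_ : Fin q → Fin q → Fin q
    i ⊕ j = (toℕ i ℕ.+ toℕ j) mod q

    ⊖_ : Fin q → Fin q
    ⊖ i = (q ℕ.∸ toℕ i) mod q

    toℕ-mod : ∀ a → toℕ (a mod q) ≡ a % q
    toℕ-mod a = toℕ-fromℕ< (m%n<n a q)

    toℕ% : ∀ i → toℕ {q} i % q ≡ toℕ i
    toℕ% i = m<n⇒m%n≡m (toℕ<n i)

    %-+ˡ : ∀ a b → (a % q ℕ.+ b) % q ≡ (a ℕ.+ b) % q
    %-+ˡ a b = trans (%-distribˡ-+ (a % q) b q)
      (trans (cong (λ s → (s ℕ.+ b % q) % q) (m%n%n≡m%n a q)) (sym (%-distribˡ-+ a b q)))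

    ⊕-comm : ∀ i j → i ⊕ j ≡ j ⊕ i
    ⊕-comm i j = cong (_mod q) (ℕ.+-comm (toℕ i) (toℕ j))

    toℕ-⊕ : ∀ i j → toℕ (i ⊕ j) ≡ (toℕ i ℕ.+ toℕ j) % q
    toℕ-⊕ i j = toℕ-mod (toℕ i ℕ.+ toℕ j)

    ⊕-assoc : ∀ i j l → (i ⊕ j) ⊕ l ≡ i ⊕ (j ⊕ l)
    ⊕-assoc i j l = toℕ-injective (begin
      toℕ ((i ⊕ j) ⊕ l)                       ≡⟨ toℕ-⊕ (i ⊕ j) l ⟩
      (toℕ (i ⊕ j) ℕ.+ toℕ l) % q             ≡⟨ cong (λ s → (s ℕ.+ toℕ l) % q) (toℕ-⊕ i j) ⟩
      ((toℕ i ℕ.+ toℕ j) % q ℕ.+ toℕ l) % q   ≡⟨ %-+ˡ (toℕ i ℕ.+ toℕ j) (toℕ l) ⟩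
      (toℕ i ℕ.+ toℕ j ℕ.+ toℕ l) % q         ≡⟨ cong (_% q) (ℕ.+-assoc (toℕ i) (toℕ j) (toℕ l)) ⟩
      (toℕ i ℕ.+ (toℕ j ℕ.+ toℕ l)) % q       ≡⟨ cong (_% q) (ℕ.+-comm (toℕ i) _) ⟩
      (toℕ j ℕ.+ toℕ l ℕ.+ toℕ i) % q         ≡⟨ sym (%-+ˡ (toℕ j ℕ.+ toℕ l) (toℕ i)) ⟩
      ((toℕ j ℕ.+ toℕ l) % q ℕ.+ toℕ i) % q   ≡⟨ cong (λ s → (s ℕ.+ toℕ i) % q) (sym (toℕ-⊕ j l)) ⟩
      (toℕ (j ⊕ l) ℕ.+ toℕ i) % q             ≡⟨ sym (toℕ-⊕ (j ⊕ l) i) ⟩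
      toℕ ((j ⊕ l) ⊕ i)                       ≡⟨ cong toℕ (⊕-comm (j ⊕ l) i) ⟩
      toℕ (i ⊕ (j ⊕ l))                       ∎)
      where open ≡-Reasoning

    ⊕-identityˡ : ∀ i → zero ⊕ i ≡ i
    ⊕-identityˡ i = toℕ-injective (trans (toℕ-⊕ zero i) (toℕ% i))

    ⊖-inverseˡ : ∀ i → (⊖ i) ⊕ i ≡ zero
    ⊖-inverseˡ i = toℕ-injective (begin
      toℕ ((⊖ i) ⊕ i)                         ≡⟨ toℕ-⊕ (⊖ i) i ⟩
      (toℕ (⊖ i) ℕ.+ toℕ i) % q               ≡⟨ cong (λ s → (s ℕ.+ toℕ i) % q) (toℕ-mod (q ℕ.∸ toℕ i)) ⟩
      ((q ℕ.∸ toℕ i) % q ℕ.+ toℕ i) % q       ≡⟨ %-+ˡ (q ℕ.∸ toℕ i) (toℕ i) ⟩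
      (q ℕ.∸ toℕ i ℕ.+ toℕ i) % q             ≡⟨ cong (_% q) (ℕ.m∸n+n≡m (ℕ.<⇒≤ (toℕ<n i))) ⟩
      q % q                                   ≡⟨ n%n≡0 q ⟩
      0                                       ∎)
      where open ≡-Reasoning

  ℤ/ : FiniteAbelianGroup
  ℤ/ = record
    { Carrier = Fin q ; _+_ = _⊕_ ; 0# = zero ; -_ = ⊖_
    ; isAbelianGroup = record
      { isGroup = record
        { isMonoid = record
          { isSemigroup = record
            { isMagma = record { isEquivalence = isEquivalence ; ∙-cong = cong₂ _⊕_ }
            ; assoc = ⊕-assoc }
          ; identity = ⊕-identityˡ , λ i → trans (⊕-comm i zero) (⊕-identityˡ i) }
        ; inverse = ⊖-inverseˡ , λ i → trans (⊕-comm i (⊖ i)) (⊖-inverseˡ i)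
        ; ⁻¹-cong = cong ⊖_ }
      ; comm = ⊕-comm }
    ; order = q ; index = id ; element = id
    ; index-element = λ _ → refl ; element-index = λ _ → refl }

  private module Z = FiniteAbelianGroup ℤ/

  toℕ-· : ∀ d x → toℕ (d Z.· x) ≡ (d ℕ.* toℕ x) % q
  toℕ-· zero x = refl
  toℕ-· (suc d) x = begin
    toℕ (x ⊕ (d Z.· x))                  ≡⟨ toℕ-⊕ x (d Z.· x) ⟩
    (toℕ x ℕ.+ toℕ (d Z.· x)) % q        ≡⟨ cong (λ s → (toℕ x ℕ.+ s) % q) (toℕ-· d x) ⟩
    (toℕ x ℕ.+ (d ℕ.* toℕ x) % q) % q    ≡⟨ cong (_% q) (ℕ.+-comm (toℕ x) _) ⟩
    ((d ℕ.* toℕ x) % q ℕ.+ toℕ x) % q    ≡⟨ %-+ˡ (d ℕ.* toℕ x) (toℕ x) ⟩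
    (d ℕ.* toℕ x ℕ.+ toℕ x) % q          ≡⟨ cong (_% q) (ℕ.+-comm (d ℕ.* toℕ x) _) ⟩
    (toℕ x ℕ.+ d ℕ.* toℕ x) % q          ∎
    where open ≡-Reasoning

  ·-coprime : ∀ {d} → Coprime q d → ∀ x → d Z.· x ≡ zero → x ≡ zero
  ·-coprime {d} cop x eq = toℕ-injective (small (toℕ x) (toℕ<n x) (coprime-divisor cop
    (m%n≡0⇒n∣m (d ℕ.* toℕ x) q (trans (sym (toℕ-· d x)) (cong toℕ eq)))))
    where
    small : ∀ a → a < q → q ∣ a → a ≡ 0
    small zero    _   _   = refl
    small (suc a) a<q q∣a = ⊥-elim (ℕ.<⇒≱ a<q (∣⇒≤ q∣a))

-- A finite abelian group with commuting endomorphisms z i whose pairwise differences are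
-- injective: this is all that is needed to interpolate by polynomials with coefficients in
-- the group, evaluated at the endomorphisms.
record PointedModule (K : ℕ) : Set₁ where
  field
    group : FiniteAbelianGroup
  open FiniteAbelianGroup group public
  field
    z              : Fin K → Carrier → Carrier
    z-+            : ∀ i x y → z i (x + y) ≡ z i x + z i y
    z-comm         : ∀ i j x → z i (z j x) ≡ z j (z i x)
    z-diff         : ∀ {i j} → i ≢ j → ∀ {x} → z i x ≡ z j x → x ≡ 0#

  z-0 : ∀ i → z i 0# ≡ 0#
  z-0 i = ∙-cancelˡ (z i 0#) _ _
    (trans (sym (z-+ i 0# 0#)) (trans (cong (z i) (identityˡ 0#)) (sym (identityʳ (z i 0#)))))

  z-neg : ∀ i x → z i (- x) ≡ - z i x
  z-neg i x = inverseʳ-unique (z i x) (z i (- x))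
    (trans (sym (z-+ i x (- x))) (trans (cong (z i) (inverseʳ x)) (z-0 i)))

  -- This plays the role of the scalar z_i - z_j, the value at the point i of the linear factor with
  -- root j. By `z-diff` and finiteness it is bijective for i ≠ j, so it can be divided by although
  -- the endomorphisms need not form a field.
  δ : Fin K → Fin K → Carrier → Carrier
  δ i j x = z i x - z j x

  δ-+ : ∀ i j x y → δ i j (x + y) ≡ δ i j x + δ i j y
  δ-+ i j x y = trans (cong₂ (λ a b → a + - b) (z-+ i x y) (z-+ j x y))
    (trans (cong ((z i x + z i y) +_) (sym (⁻¹-∙-comm (z j x) (z j y))))
      (interchange (z i x) (z i y) (- z j x) (- z j y)))

  z-δ : ∀ l i j x → z l (δ i j x) ≡ δ i j (z l x)
  z-δ l i j x = trans (z-+ l (z i x) (- z j x))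
    (cong₂ _+_ (z-comm l i x) (trans (z-neg l (z j x)) (cong -_ (z-comm l j x))))

  δ-neg : ∀ i j x → δ i j (- x) ≡ - δ i j x
  δ-neg i j x = trans (cong₂ _+_ (z-neg i x) (cong -_ (z-neg j x))) (⁻¹-∙-comm (z i x) (- z j x))

  δ-comm : ∀ i j l m x → δ i j (δ l m x) ≡ δ l m (δ i j x)
  δ-comm i j l m x = trans (cong₂ _-_ (z-δ i l m x) (z-δ j l m x))
    (sym (trans (δ-+ l m (z i x) (- z j x)) (cong (δ l m (z i x) +_) (δ-neg l m (z j x)))))

  δ-0 : ∀ i j → δ i j 0# ≡ 0#
  δ-0 i j = trans (cong₂ _-_ (z-0 i) (z-0 j)) (inverseʳ 0#)

  δ≡0⇒≡0 : ∀ {i j} → i ≢ j → ∀ {x} → δ i j x ≡ 0# → x ≡ 0#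
  δ≡0⇒≡0 i≢j eq = z-diff i≢j (x-y≡0⇒x≡y eq)

  δ-injective : ∀ {i j} → i ≢ j → ∀ {x y} → δ i j x ≡ δ i j y → x ≡ y
  δ-injective {i} {j} i≢j {x} {y} eq = x-y≡0⇒x≡y (δ≡0⇒≡0 i≢j
    (trans (δ-+ i j x (- y)) (trans (cong₂ _+_ eq (δ-neg i j y)) (inverseʳ (δ i j y)))))

  δ-surjective : ∀ {i j} → i ≢ j → ∀ y → ∃ λ x → δ i j x ≡ y
  δ-surjective {i} {j} i≢j = injective⇒surjective′ (δ i j) (δ-injective i≢j)

-- The points are the multiplications by 0, ..., K - 1. A difference of two of them is, up to sign,
-- multiplication by some d with 0 < d < K.
cyclic : ∀ p K → (∀ d → 0 < d → d < K → Coprime (suc p) d) → PointedModule K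
cyclic p K cop = record
  { group = ℤ/ p
  ; z = λ i x → toℕ i · x
  ; z-+ = λ i x y → ·-distrib-+ x y (toℕ i)
  ; z-comm = λ i j x → trans (·-assocˡ x (toℕ i) (toℕ j))
      (trans (cong (_· x) (ℕ.*-comm (toℕ i) (toℕ j))) (sym (·-assocˡ x (toℕ j) (toℕ i))))
  ; z-diff = λ {i} {j} i≢j {x} eq → diff i j i≢j x eq }
  where
  open FiniteAbelianGroup (ℤ/ p)
  diff< : ∀ i j x → i < j → j < K → i · x ≡ j · x → x ≡ 0#
  diff< i j x i<j j<K eq = ·-coprime p
    (cop (j ℕ.∸ i) (ℕ.m<n⇒0<n∸m i<j) (ℕ.≤-<-trans (ℕ.m∸n≤m j i) j<K)) x
    (∙-cancelʳ (i · x) ((j ℕ.∸ i) · x) 0# (trans (sym (·-homo-+ x (j ℕ.∸ i) i))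
      (trans (cong (_· x) (ℕ.m∸n+n≡m (ℕ.<⇒≤ i<j))) (trans (sym eq) (sym (identityˡ (i · x)))))))
  diff : ∀ (i j : Fin K) → i ≢ j → ∀ x → toℕ i · x ≡ toℕ j · x → x ≡ 0#
  diff i j i≢j x eq with ℕ.<-cmp (toℕ i) (toℕ j)
  ... | tri< i<j _ _ = diff< (toℕ i) (toℕ j) x i<j (toℕ<n j) eq
  ... | tri≈ _ i≡j _ = ⊥-elim (i≢j (toℕ-injective i≡j))
  ... | tri> _ _ j<i = diff< (toℕ j) (toℕ i) x j<i (toℕ<n i) (sym eq)

-- Powers of a group and the tower of modules.

lookup-ext : {A : Set} {xs ys : Vec A n} → (∀ i → lookup xs i ≡ lookup ys i) → xs ≡ ys
lookup-ext {xs = xs} {ys} eq =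
  trans (sym (tabulate∘lookup xs)) (trans (tabulate-cong eq) (tabulate∘lookup ys))

module _ (G : FiniteAbelianGroup) where
  open FiniteAbelianGroup G

  vecIndex : ∀ {n} → Vec Carrier n → Fin (order ℕ.^ n)
  vecIndex []       = zero
  vecIndex (x ∷ xs) = combine (index x) (vecIndex xs)

  vecElement : ∀ {n} → Fin (order ℕ.^ n) → Vec Carrier n
  vecElement {zero}  _ = []
  vecElement {suc n} i = let a , b = remQuot {order} (order ℕ.^ n) i in element a ∷ vecElement b

  vecIndex-vecElement : ∀ {n} (i : Fin (order ℕ.^ n)) → vecIndex {n} (vecElement i) ≡ i
  vecIndex-vecElement {zero}  zero = refl
  vecIndex-vecElement {suc n} i = trans
    (cong₂ combine (index-element _) (vecIndex-vecElement {n} _)) (Fin.combine-remQuot {order} (order ℕ.^ n) i)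

  vecElement-vecIndex : ∀ {n} (xs : Vec Carrier n) → vecElement (vecIndex xs) ≡ xs
  vecElement-vecIndex []       = refl
  vecElement-vecIndex {suc n} (x ∷ xs) = cong₂ _∷_
    (trans (cong (element ∘ proj₁) split) (element-index x))
    (trans (cong (vecElement {n} ∘ proj₂) split) (vecElement-vecIndex xs))
    where split = Fin.remQuot-combine {order} {order ℕ.^ n} (index x) (vecIndex xs)

  power : ℕ → FiniteAbelianGroup
  power n = record
    { Carrier = Vec Carrier n
    ; _+_ = zipWith _+_ ; 0# = replicate n 0# ; -_ = map (λ x → - x)
    ; isAbelianGroup = record
      { isGroup = record
        { isMonoid = record
          { isSemigroup = record
            { isMagma = record { isEquivalence = isEquivalence ; ∙-cong = cong₂ (zipWith _+_) }
            ; assoc = zipWith-assoc assoc }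
          ; identity = zipWith-identityˡ identityˡ , zipWith-identityʳ identityʳ }
        ; inverse = zipWith-inverseˡ inverseˡ , zipWith-inverseʳ inverseʳ
        ; ⁻¹-cong = cong (map (λ x → - x)) }
      ; comm = zipWith-comm comm }
    ; order = order ℕ.^ n
    ; index = vecIndex ; element = vecElement
    ; index-element = vecIndex-vecElement {n} ; element-index = vecElement-vecIndex }

cyclicPred : Fin (suc n) → Fin (suc n)
cyclicPred zero    = fromℕ _
cyclicPred (suc i) = inject₁ i

-- One orbit is the whole cycle: descend from i to 0, wrap to the last index, and descend from
-- there.
cyclicPred-closed : (P : Fin (suc n) → Set) → (∀ i → P i → P (cyclicPred i)) →
                    ∀ i → P i → ∀ j → P j
cyclicPred-closed {n} P closed i Pi =
  >-weakInduction P (closed zero (down (toℕ i) i refl Pi)) (λ j → closed (suc j))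
  where
  down : ∀ a (i : Fin (suc n)) → toℕ i ≡ a → P i → P zero
  down zero    zero    _  p = p
  down (suc a) (suc i) eq p =
    down a (inject₁ i) (trans (Fin.toℕ-inject₁ i) (ℕ.suc-injective eq)) (closed (suc i) p)

-- Adjoins to K ≥ 1 points on M the endomorphism T of M^K given by
-- (T x)_j = z_j x_j + x_{j-1} (indices mod K).  Every T - z_i is injective: if T x = z_i x then
-- x_{i-1} = 0, and x_j = 0 forces x_{j-1} = 0.
adjoinPoint : ∀ {K} → PointedModule (suc K) → PointedModule (suc (suc K))
adjoinPoint {K} M = record
  { group = power group (suc K)
  ; z = z′
  ; z-+ = z′-+
  ; z-comm = z′-comm
  ; z-diff = λ {i} {j} → z′-diff i j }
  where
  open PointedModule M
  module V = FiniteAbelianGroup (power group (suc K))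

  T : V.Carrier → V.Carrier
  T xs = tabulate (λ j → z j (lookup xs j) + lookup xs (cyclicPred j))

  lookup-T : ∀ xs j → lookup (T xs) j ≡ z j (lookup xs j) + lookup xs (cyclicPred j)
  lookup-T xs = lookup∘tabulate _

  z′ : Fin (suc (suc K)) → V.Carrier → V.Carrier
  z′ zero    = T
  z′ (suc i) = map (z i)

  z′-+ : ∀ i xs ys → z′ i (xs V.+ ys) ≡ z′ i xs V.+ z′ i ys
  z′-+ zero xs ys = lookup-ext λ j → begin
    lookup (T (xs V.+ ys)) j
      ≡⟨ lookup-T (xs V.+ ys) j ⟩
    z j (lookup (xs V.+ ys) j) + lookup (xs V.+ ys) (cyclicPred j)
      ≡⟨ cong₂ _+_ (cong (z j) (lookup-zipWith _+_ j xs ys)) (lookup-zipWith _+_ (cyclicPred j) xs ys) ⟩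
    z j (lookup xs j + lookup ys j) + (lookup xs (cyclicPred j) + lookup ys (cyclicPred j))
      ≡⟨ cong (_+ (lookup xs (cyclicPred j) + lookup ys (cyclicPred j))) (z-+ j (lookup xs j) (lookup ys j)) ⟩
    (z j (lookup xs j) + z j (lookup ys j)) + (lookup xs (cyclicPred j) + lookup ys (cyclicPred j))
      ≡⟨ interchange (z j (lookup xs j)) (z j (lookup ys j)) (lookup xs (cyclicPred j)) (lookup ys (cyclicPred j)) ⟩
    (z j (lookup xs j) + lookup xs (cyclicPred j)) + (z j (lookup ys j) + lookup ys (cyclicPred j))
      ≡⟨ sym (cong₂ _+_ (lookup-T xs j) (lookup-T ys j)) ⟩
    lookup (T xs) j + lookup (T ys) j
      ≡⟨ sym (lookup-zipWith _+_ j (T xs) (T ys)) ⟩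
    lookup (T xs V.+ T ys) j ∎
    where open ≡-Reasoning
  z′-+ (suc i) xs ys = lookup-ext λ j → begin
    lookup (map (z i) (xs V.+ ys)) j         ≡⟨ lookup-map j (z i) (xs V.+ ys) ⟩
    z i (lookup (xs V.+ ys) j)               ≡⟨ cong (z i) (lookup-zipWith _+_ j xs ys) ⟩
    z i (lookup xs j + lookup ys j)          ≡⟨ z-+ i (lookup xs j) (lookup ys j) ⟩
    z i (lookup xs j) + z i (lookup ys j)    ≡⟨ sym (cong₂ _+_ (lookup-map j (z i) xs) (lookup-map j (z i) ys)) ⟩
    lookup (map (z i) xs) j + lookup (map (z i) ys) j ≡⟨ sym (lookup-zipWith _+_ j (map (z i) xs) (map (z i) ys)) ⟩
    lookup (map (z i) xs V.+ map (z i) ys) j ∎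
    where open ≡-Reasoning

  T-z : ∀ i xs → T (map (z i) xs) ≡ map (z i) (T xs)
  T-z i xs = lookup-ext λ j → begin
    lookup (T (map (z i) xs)) j
      ≡⟨ lookup-T (map (z i) xs) j ⟩
    z j (lookup (map (z i) xs) j) + lookup (map (z i) xs) (cyclicPred j)
      ≡⟨ cong₂ _+_ (cong (z j) (lookup-map j (z i) xs)) (lookup-map (cyclicPred j) (z i) xs) ⟩
    z j (z i (lookup xs j)) + z i (lookup xs (cyclicPred j))
      ≡⟨ cong (_+ z i (lookup xs (cyclicPred j))) (z-comm j i (lookup xs j)) ⟩
    z i (z j (lookup xs j)) + z i (lookup xs (cyclicPred j))
      ≡⟨ sym (z-+ i (z j (lookup xs j)) (lookup xs (cyclicPred j))) ⟩
    z i (z j (lookup xs j) + lookup xs (cyclicPred j))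
      ≡⟨ cong (z i) (sym (lookup-T xs j)) ⟩
    z i (lookup (T xs) j)
      ≡⟨ sym (lookup-map j (z i) (T xs)) ⟩
    lookup (map (z i) (T xs)) j ∎
    where open ≡-Reasoning

  z′-comm : ∀ i j xs → z′ i (z′ j xs) ≡ z′ j (z′ i xs)
  z′-comm zero    zero    xs = refl
  z′-comm zero    (suc j) xs = T-z j xs
  z′-comm (suc i) zero    xs = sym (T-z i xs)
  z′-comm (suc i) (suc j) xs = trans (sym (map-∘ (z i) (z j) xs))
    (trans (map-cong (z-comm i j) xs) (map-∘ (z j) (z i) xs))

  T-z-diff : ∀ i {xs} → T xs ≡ map (z i) xs → xs ≡ V.0#
  T-z-diff i {xs} eq = lookup-ext λ j →
    trans (cyclicPred-closed (λ l → lookup xs l ≡ 0#) closed (cyclicPred i) start j)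
          (sym (lookup-replicate j 0#))
    where
    eqAt : ∀ j → z j (lookup xs j) + lookup xs (cyclicPred j) ≡ z i (lookup xs j)
    eqAt j = trans (sym (lookup-T xs j)) (trans (cong (λ v → lookup v j) eq) (lookup-map j (z i) xs))
    start : lookup xs (cyclicPred i) ≡ 0#
    start = ∙-cancelˡ (z i (lookup xs i)) _ _ (trans (eqAt i) (sym (identityʳ _)))
    closed : ∀ j → lookup xs j ≡ 0# → lookup xs (cyclicPred j) ≡ 0#
    closed j xj≡0 = ∙-cancelˡ (z j (lookup xs j)) _ _ (trans (eqAt j)
      (trans (cong (z i) xj≡0) (trans (z-0 i) (trans (sym (z-0 j))
        (trans (cong (z j) (sym xj≡0)) (sym (identityʳ _)))))))

  z′-diff : ∀ i j → i ≢ j → ∀ {xs} → z′ i xs ≡ z′ j xs → xs ≡ V.0#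
  z′-diff zero    zero    i≢j _  = ⊥-elim (i≢j refl)
  z′-diff zero    (suc j) _   eq = T-z-diff j eq
  z′-diff (suc i) zero    _   eq = T-z-diff i (sym eq)
  z′-diff (suc i) (suc j) i≢j {xs} eq = lookup-ext λ l →
    trans (z-diff (i≢j ∘ cong suc) (trans (sym (lookup-map l (z i) xs))
            (trans (cong (λ v → lookup v l) eq) (lookup-map l (z j) xs))))
          (sym (lookup-replicate l 0#))

-- This is K!, since adjoining a point raises the order to the number of points already present.
towerExponent : ℕ → ℕ
towerExponent zero    = 1
towerExponent (suc K) = towerExponent K ℕ.* suc K

towerExponent>0 : ∀ K → 0 < towerExponent K
towerExponent>0 zero    = s≤s z≤n
towerExponent>0 (suc K) = ℕ.*-mono-< (towerExponent>0 K) (s≤s z≤n)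

-- The surjection `φ` onto ℤ/(p+1) is kept along the tower because codes will be cut into classes by
-- the image under `φ` of the value at one point.
record Tower (p K : ℕ) : Set₁ where
  field
    module′ : PointedModule (suc K)
  open PointedModule module′ public
  field
    order≡  : order ≡ suc p ℕ.^ towerExponent K
    φ       : Carrier → Fin (suc p)
    φ-+     : ∀ x y → φ (x + y) ≡ FiniteAbelianGroup._+_ (ℤ/ p) (φ x) (φ y)
    ι       : Fin (suc p) → Carrier
    φ-ι     : ∀ x → φ (ι x) ≡ x

tower : ∀ p K → Tower p K
tower p zero = record
  { module′ = record
    { group = ℤ/ p ; z = λ _ x → x ; z-+ = λ _ _ _ → refl ; z-comm = λ _ _ _ → refl
    ; z-diff = λ { {zero} {zero} 0≢0 _ → ⊥-elim (0≢0 refl) } }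
  ; order≡ = sym (ℕ.^-identityʳ (suc p))
  ; φ = id ; φ-+ = λ _ _ → refl ; ι = id ; φ-ι = λ _ → refl }
tower p (suc K) = record
  { module′ = adjoinPoint M.module′
  ; order≡ = trans (cong (ℕ._^ suc K) M.order≡) (ℕ.^-*-assoc (suc p) (towerExponent K) (suc K))
  ; φ = λ { (x ∷ _) → M.φ x }
  ; φ-+ = λ { (x ∷ _) (y ∷ _) → M.φ-+ x y }
  ; ι = λ a → M.ι a ∷ replicate K M.0#
  ; φ-ι = M.φ-ι }
  where module M = Tower (tower p K)

-- Finite sums, sets of columns and label counts.

∑ : (Fin n → ℕ) → ℕ
∑ {zero}  f = 0
∑ {suc n} f = f zero ℕ.+ ∑ (f ∘ suc)

∑-mono : {f g : Fin n → ℕ} → (∀ i → f i ≤ g i) → ∑ f ≤ ∑ g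
∑-mono {zero}  f≤g = z≤n
∑-mono {suc n} f≤g = ℕ.+-mono-≤ (f≤g zero) (∑-mono (f≤g ∘ suc))

∑-cong : {f g : Fin n → ℕ} → (∀ i → f i ≡ g i) → ∑ f ≡ ∑ g
∑-cong {zero}  f≡g = refl
∑-cong {suc n} f≡g = cong₂ ℕ._+_ (f≡g zero) (∑-cong (f≡g ∘ suc))

∑-zero : {f : Fin n → ℕ} → (∀ i → f i ≡ 0) → ∑ f ≡ 0
∑-zero {zero}  f≡0 = refl
∑-zero {suc n} f≡0 = cong₂ ℕ._+_ (f≡0 zero) (∑-zero (f≡0 ∘ suc))

∑-decrement : (f g : Fin n → ℕ) → ∀ c → f c ≡ suc (g c) → (∀ i → i ≢ c → f i ≡ g i) →
              ∑ f ≡ suc (∑ g)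
∑-decrement f g zero eq neq =
  cong₂ ℕ._+_ eq (∑-cong λ i → neq (suc i) λ ())
∑-decrement f g (suc c) eq neq = trans
  (cong₂ ℕ._+_ (neq zero λ ()) (∑-decrement (f ∘ suc) (g ∘ suc) c eq λ i i≢c → neq (suc i) (i≢c ∘ Fin.suc-injective)))
  (ℕ.+-suc (g zero) _)

card : Vec Bool k → ℕ
card []          = 0
card (true  ∷ S) = suc (card S)
card (false ∷ S) = card S

labelCount : Vec Bool k → (Fin k → Maybe (Fin l)) → Fin l → ℕ
labelCount []          κ c = 0
labelCount (false ∷ S) κ c = labelCount S (κ ∘ suc) c
labelCount (true  ∷ S) κ c with κ zero
... | nothing = labelCount S (κ ∘ suc) c
... | just c′ = (if does (c Fin.≟ c′) then 1 else 0) ℕ.+ labelCount S (κ ∘ suc) c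

labelCount-cong : (S : Vec Bool k) {κ κ′ : Fin k → Maybe (Fin l)} →
                  (∀ i → lookup S i ≡ true → κ i ≡ κ′ i) → ∀ c → labelCount S κ c ≡ labelCount S κ′ c
labelCount-cong []          eq c = refl
labelCount-cong (false ∷ S) eq c = labelCount-cong S (eq ∘ suc) c
labelCount-cong (true  ∷ S) {κ} {κ′} eq c with κ zero | κ′ zero | eq zero refl
... | nothing | .nothing | refl = labelCount-cong S (eq ∘ suc) c
... | just c′ | .(just c′) | refl = cong ((if does (c Fin.≟ c′) then 1 else 0) ℕ.+_) (labelCount-cong S (eq ∘ suc) c)

count : Fin l → List (Fin l) → ℕ
count c []       = 0
count c (c′ ∷ h) = (if does (c Fin.≟ c′) then 1 else 0) ℕ.+ count c h

if-yes : {A : Set} (d : Dec A) {x y : ℕ} → A → (if does d then x else y) ≡ x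
if-yes (yes _) _ = refl
if-yes (no ¬a) a = ⊥-elim (¬a a)

if-no : {A : Set} (d : Dec A) {x y : ℕ} → ¬ A → (if does d then x else y) ≡ y
if-no (yes a) ¬a = ⊥-elim (¬a a)
if-no (no _)  _  = refl

-- Polynomials and Hermite interpolation

module Polynomial {K : ℕ} (M : PointedModule K) where
  open PointedModule M

  module _ (γ : Carrier) where

    -- A vector (x₀ , … , x_{d-1}) stands for the polynomial γ z^d + x_{d-1} z^{d-1} + … + x₀;
    -- con c a q is a + (z - z_c) q.
    con : Fin K → Carrier → Vec Carrier d → Vec Carrier (suc d)
    con c a []       = (a - z c γ) ∷ []
    con c a (x ∷ xs) = (a - z c x) ∷ con c x xs

    -- Horner's scheme for division by z - z_c; the remainder is the value at c, which `eval` takes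
    -- as its definition.
    divide : Fin K → Vec Carrier (suc d) → Carrier × Vec Carrier d
    divide {zero}  c (x ∷ [])  = x + z c γ , []
    divide {suc d} c (x ∷ xs) = x + z c (proj₁ (divide c xs)) , proj₁ (divide c xs) ∷ proj₂ (divide c xs)

    eval : Fin K → Vec Carrier d → Carrier
    eval {zero}  i _  = γ
    eval {suc d} i xs = proj₁ (divide i xs)

    quotient : Fin K → Vec Carrier (suc d) → Vec Carrier d
    quotient c xs = proj₂ (divide c xs)

    divide-con : ∀ c a (q : Vec Carrier d) → divide c (con c a q) ≡ (a , q)
    divide-con c a []       = cong (_, []) (x-y+y≡x a (z c γ))
    divide-con c a (x ∷ xs) = cong₂ _,_
      (trans (cong (λ r → (a - z c x) + z c (proj₁ r)) (divide-con c x xs)) (x-y+y≡x a (z c x)))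
      (cong (λ r → proj₁ r ∷ proj₂ r) (divide-con c x xs))

    con-divide : ∀ c (D : Vec Carrier (suc d)) → con c (eval c D) (quotient c D) ≡ D
    con-divide {zero}  c (x ∷ []) = cong (_∷ []) (x+y-y≡x x (z c γ))
    con-divide {suc d} c (x ∷ xs) = cong₂ _∷_ (x+y-y≡x x _) (con-divide c xs)

    private
      head-swap : ∀ a b x i j →
        a - z i (b - z j x) ≡ (a + δ j i b) - z j (b - z i x)
      head-swap a b x i j = begin
        a - z i (b - z j x)
          ≡⟨ cong (a +_) (expand i j) ⟩
        a + (- z i b + z i (z j x))
          ≡⟨ cong (a +_) (sym (xyx⁻¹≈y (z j b) _)) ⟩
        a + (z j b + (- z i b + z i (z j x)) - z j b)
          ≡⟨ cong (a +_) (trans (cong (_- z j b) (sym (assoc (z j b) (- z i b) (z i (z j x)))))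
               (assoc (δ j i b) (z i (z j x)) (- z j b))) ⟩
        a + (δ j i b + (z i (z j x) - z j b))
          ≡⟨ sym (assoc a (δ j i b) _) ⟩
        (a + δ j i b) + (z i (z j x) - z j b)
          ≡⟨ cong ((a + δ j i b) +_) (trans (comm (z i (z j x)) (- z j b)) (cong (- z j b +_) (z-comm i j x))) ⟩
        (a + δ j i b) + (- z j b + z j (z i x))
          ≡⟨ cong ((a + δ j i b) +_) (sym (expand j i)) ⟩
        (a + δ j i b) - z j (b - z i x) ∎
        where
        open ≡-Reasoning
        expand : ∀ i j → - z i (b - z j x) ≡ - z i b + z i (z j x)
        expand i j = trans (cong -_ (trans (z-+ i b (- z j x)) (cong (z i b +_) (z-neg i (z j x)))))
          (trans (sym (⁻¹-∙-comm (z i b) (- z i (z j x)))) (cong (- z i b +_) (⁻¹-involutive (z i (z j x)))))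

    -- Exchange of two nodes in Newton's form: z - z_c = (z_c′ - z_c) + (z - z_c′), so only the
    -- constant term changes. Facts about another point i follow by moving its factor to the front.
    con-swap : ∀ c c′ a b (q : Vec Carrier d) →
               con c a (con c′ b q) ≡ con c′ (a + δ c′ c b) (con c b q)
    con-swap c c′ a b []       = cong₂ _∷_ (head-swap a b γ c c′) (cong (_∷ [])
      (trans (assoc b _ _) (trans (cong (b +_) (comm (- z c′ γ) (- z c γ))) (sym (assoc b _ _)))))
    con-swap c c′ a b (x ∷ xs) = cong₂ _∷_ (head-swap a b x c c′)
      (trans (con-swap c c′ (b - z c′ x) x xs) (cong (λ s → con c′ s (con c x xs))
        (trans (sym (assoc (b - z c′ x) (z c′ x) _)) (cong (_- z c x) (x-y+y≡x b (z c′ x))))))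

    eval-con : ∀ i c a (q : Vec Carrier d) → eval i (con c a q) ≡ a + δ i c (eval i q)
    eval-con {zero}  i c a [] = trans (assoc a (- z c γ) (z i γ)) (cong (a +_) (comm (- z c γ) (z i γ)))
    eval-con {suc d} i c a q  = trans
      (cong (λ r → eval i (con c a r)) (sym (con-divide i q)))
      (cong proj₁ (trans (cong (divide i) (con-swap c i a (eval i q) (quotient i q)))
                         (divide-con i (a + δ i c (eval i q)) (con c (eval i q) (quotient i q)))))

    eval-con-self : ∀ c a (q : Vec Carrier d) → eval c (con c a q) ≡ a
    eval-con-self c a q = cong proj₁ (divide-con c a q)

    ord : Fin K → Vec Carrier d → ℕ
    ord {zero}  c _ = 0
    ord {suc d} c D with eval c D ≟ 0#
    ... | yes _ = suc (ord c (quotient c D))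
    ... | no  _ = 0

    ord-con-self : ∀ c (q : Vec Carrier d) → ord c (con c 0# q) ≡ suc (ord c q)
    ord-con-self c q with eval c (con c 0# q) ≟ 0#
    ... | yes _  = cong (suc ∘ ord c ∘ proj₂) (divide-con c 0# q)
    ... | no neq = ⊥-elim (neq (eval-con-self c 0# q))

    ord>0⇒eval≡0 : ∀ c (D : Vec Carrier (suc d)) → 0 < ord c D → eval c D ≡ 0#
    ord>0⇒eval≡0 c D 0<ord with eval c D ≟ 0#
    ... | yes eq = eq
    ... | no _ = contradiction 0<ord λ ()

    ord>0⇒con : ∀ c (D : Vec Carrier (suc d)) → 0 < ord c D → con c 0# (quotient c D) ≡ D
    ord>0⇒con c D 0<ord = trans (cong (λ a → con c a (quotient c D)) (sym (ord>0⇒eval≡0 c D 0<ord))) (con-divide c D)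

    eval≢0⇒ord≡0 : ∀ c (D : Vec Carrier (suc d)) → eval c D ≢ 0# → ord c D ≡ 0
    eval≢0⇒ord≡0 c D neq with eval c D ≟ 0#
    ... | yes eq = ⊥-elim (neq eq)
    ... | no _ = refl

    eval≡0⇒ord≡suc : ∀ c (D : Vec Carrier (suc d)) → eval c D ≡ 0# → ord c D ≡ suc (ord c (quotient c D))
    eval≡0⇒ord≡suc c D eq with eval c D ≟ 0#
    ... | yes _ = refl
    ... | no neq = ⊥-elim (neq eq)

    -- The value at i is multiplied by the injective `δ i c`, and division by the factor of i
    -- commutes with the factor of c. In degree 0 the value is `δ i c γ`, which is where γ ≠ 0
    -- enters.
    ord-con-other : γ ≢ 0# → ∀ {i c} → i ≢ c → (q : Vec Carrier d) → ord i (con c 0# q) ≡ ord i q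
    ord-con-other {d} γ≢0 {i} {c} i≢c q = go d q
      where
      value : ∀ {d} (q : Vec Carrier d) → eval i (con c 0# q) ≡ δ i c (eval i q)
      value q = trans (eval-con i c 0# q) (identityˡ _)
      go : ∀ d (q : Vec Carrier d) → ord i (con c 0# q) ≡ ord i q
      go zero    [] = eval≢0⇒ord≡0 i (con c 0# []) λ eq → γ≢0 (δ≡0⇒≡0 i≢c (trans (sym (value [])) eq))
      go (suc d) q with eval i q ≟ 0#
      ... | no neq = eval≢0⇒ord≡0 i (con c 0# q) λ eq → neq (δ≡0⇒≡0 i≢c (trans (sym (value q)) eq))
      ... | yes eq = trans
        (eval≡0⇒ord≡suc i (con c 0# q) (trans (value q) (trans (cong (δ i c) eq) (δ-0 i c))))
        (cong suc (trans (cong (ord i) quotient-con) (go d (quotient i q))))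
        where
        open ≡-Reasoning
        quotient-con : quotient i (con c 0# q) ≡ con c 0# (quotient i q)
        quotient-con = begin
          quotient i (con c 0# q)
            ≡⟨ cong (λ r → quotient i (con c 0# r)) (sym (con-divide i q)) ⟩
          quotient i (con c 0# (con i (eval i q) (quotient i q)))
            ≡⟨ cong proj₂ (trans (cong (divide i) (con-swap c i 0# (eval i q) (quotient i q))) (divide-con i _ _)) ⟩
          con c (eval i q) (quotient i q)
            ≡⟨ cong (λ a → con c a (quotient i q)) eq ⟩
          con c 0# (quotient i q) ∎

    -- Newton's divided differences: the values that the quotient by the factor of `y zero` has to
    -- take at the other nodes.
    slope : (y : Fin (suc k) → Fin K) → (∀ {i j} → y i ≡ y j → i ≡ j) → (x : Fin (suc k) → Carrier) →
            ∀ j → ∃ λ a → δ (y (suc j)) (y zero) a ≡ x (suc j) - x zero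
    slope y inj x j = δ-surjective {y (suc j)} {y zero} (Fin.0≢1+n ∘ sym ∘ inj) (x (suc j) - x zero)

    interpolate : (S : Vec Bool k) (y : Fin k → Fin K) → (∀ {i j} → y i ≡ y j → i ≡ j) →
                  (Fin k → Carrier) → Vec Carrier (card S)
    interpolate []          y inj x = []
    interpolate (false ∷ S) y inj x = interpolate S (y ∘ suc) (Fin.suc-injective ∘ inj) (x ∘ suc)
    interpolate (true  ∷ S) y inj x = con (y zero) (x zero)
      (interpolate S (y ∘ suc) (Fin.suc-injective ∘ inj) (proj₁ ∘ slope y inj x))

    eval-interpolate : (S : Vec Bool k) (y : Fin k → Fin K) (inj : ∀ {i j} → y i ≡ y j → i ≡ j) →
                       (x : Fin k → Carrier) → ∀ i → lookup S i ≡ true →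
                       eval (y i) (interpolate S y inj x) ≡ x i
    eval-interpolate (false ∷ S) y inj x (suc i) i∈S = eval-interpolate S (y ∘ suc) _ (x ∘ suc) i i∈S
    eval-interpolate (true  ∷ S) y inj x zero    i∈S = eval-con-self (y zero) (x zero)
      (interpolate S (y ∘ suc) (Fin.suc-injective ∘ inj) (proj₁ ∘ slope y inj x))
    eval-interpolate (true  ∷ S) y inj x (suc i) i∈S = trans (eval-con (y (suc i)) (y zero) (x zero) q)
      (trans (cong (λ a → x zero + δ (y (suc i)) (y zero) a)
               (eval-interpolate S (y ∘ suc) (Fin.suc-injective ∘ inj) (proj₁ ∘ slope y inj x) i i∈S))
      (trans (cong (x zero +_) (proj₂ (slope y inj x i)))
      (trans (comm (x zero) _) (x-y+y≡x (x (suc i)) (x zero)))))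
      where
      q : Vec Carrier (card S)
      q = interpolate S (y ∘ suc) (Fin.suc-injective ∘ inj) (proj₁ ∘ slope y inj x)

    interpolate-unique : (S : Vec Bool k) (y : Fin k → Fin K) → (∀ {i j} → y i ≡ y j → i ≡ j) →
                         (D E : Vec Carrier (card S)) →
                         (∀ i → lookup S i ≡ true → eval (y i) D ≡ eval (y i) E) → D ≡ E
    interpolate-unique []          y inj [] [] eq = refl
    interpolate-unique (false ∷ S) y inj D E eq = interpolate-unique S (y ∘ suc) (Fin.suc-injective ∘ inj) D E (eq ∘ suc)
    interpolate-unique (true  ∷ S) y inj D E eq = begin
      D                                                ≡⟨ sym (con-divide (y zero) D) ⟩
      con (y zero) (eval (y zero) D) (quotient (y zero) D) ≡⟨ cong₂ (con (y zero)) (eq zero refl)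
        (interpolate-unique S (y ∘ suc) (Fin.suc-injective ∘ inj) _ _ quotients-agree) ⟩
      con (y zero) (eval (y zero) E) (quotient (y zero) E) ≡⟨ con-divide (y zero) E ⟩
      E                                                ∎
      where
      open ≡-Reasoning
      split : ∀ i (D : Vec Carrier (suc (card S))) →
              eval (y i) D ≡ eval (y zero) D + δ (y i) (y zero) (eval (y i) (quotient (y zero) D))
      split i D = trans (cong (eval (y i)) (sym (con-divide (y zero) D)))
        (eval-con (y i) (y zero) (eval (y zero) D) (quotient (y zero) D))
      quotients-agree : ∀ i → lookup S i ≡ true →
        eval (y (suc i)) (quotient (y zero) D) ≡ eval (y (suc i)) (quotient (y zero) E)
      quotients-agree i i∈S = δ-injective {y (suc i)} {y zero} (Fin.0≢1+n ∘ sym ∘ inj)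
        (∙-cancelˡ (eval (y zero) D) _ _ (trans (sym (split (suc i) D)) (trans (eq (suc i) i∈S)
          (trans (split (suc i) E) (cong (_+ δ (y (suc i)) (y zero) (eval (y (suc i)) (quotient (y zero) E))) (sym (eq zero refl)))))))

    -- Interpolation with prescribed zeros: the labels in h are zeros ζ c, with multiplicity.
    module _ (y : Fin k → Fin K) (y-injective : ∀ {i j} → y i ≡ y j → i ≡ j)
             (ζ : Fin l → Fin K) (Active : Fin l → Set)
             (ζ-injective : ∀ {c c′} → Active c → Active c′ → ζ c ≡ ζ c′ → c ≡ c′)
             (y≢ζ : ∀ i c → y i ≢ ζ c) (γ≢0 : γ ≢ 0#) where

      hermite : (h : List (Fin l)) (S : Vec Bool k) → (Fin k → Carrier) → Vec Carrier (length h ℕ.+ card S)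
      hermite []      S x = interpolate S y y-injective x
      hermite (c ∷ h) S x = con (ζ c) 0# (hermite h S (λ i → proj₁ (δ-surjective (y≢ζ i c) (x i))))

      eval-hermite : ∀ h S x i → lookup S i ≡ true → eval (y i) (hermite h S x) ≡ x i
      eval-hermite []      S x i i∈S = eval-interpolate S y y-injective x i i∈S
      eval-hermite (c ∷ h) S x i i∈S = trans (eval-con (y i) (ζ c) 0# (hermite h S x′)) (trans (identityˡ _)
        (trans (cong (δ (y i) (ζ c)) (eval-hermite h S x′ i i∈S)) (proj₂ (δ-surjective (y≢ζ i c) (x i)))))
        where
        x′ : Fin k → Carrier
        x′ i = proj₁ (δ-surjective (y≢ζ i c) (x i))

      ord-con-≥ : ∀ {c c′} → Active c → Active c′ → (q : Vec Carrier d) →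
                  ord (ζ c) (con (ζ c′) 0# q) ≡ (if does (c Fin.≟ c′) then 1 else 0) ℕ.+ ord (ζ c) q
      ord-con-≥ {c = c} {c′} ac ac′ q with c Fin.≟ c′
      ... | yes refl = ord-con-self (ζ c) q
      ... | no  c≢c′ = ord-con-other γ≢0 (c≢c′ ∘ ζ-injective ac ac′) q

      ord-hermite : ∀ h S x → All Active h → ∀ c → Active c → count c h ≤ ord (ζ c) (hermite h S x)
      ord-hermite []       S x []         c ac = z≤n
      ord-hermite (c′ ∷ h) S x (ac′ ∷ ah) c ac = subst (count c (c′ ∷ h) ≤_) (sym (ord-con-≥ ac ac′ _))
        (ℕ.+-monoʳ-≤ (if does (c Fin.≟ c′) then 1 else 0) (ord-hermite h S _ ah c ac))

      -- Prescribed zeros are peeled off one at a time: the multiplicity bounds make both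
      -- polynomials divisible by the factor of ζ c′. Values and bounds descend to the quotients,
      -- the former because `δ` is injective, the latter by `ord-con-≥`.
      hermite-unique : ∀ h S → All Active h → (D E : Vec Carrier (length h ℕ.+ card S)) →
                       (∀ i → lookup S i ≡ true → eval (y i) D ≡ eval (y i) E) →
                       (∀ c → Active c → count c h ≤ ord (ζ c) D) →
                       (∀ c → Active c → count c h ≤ ord (ζ c) E) → D ≡ E
      hermite-unique []       S []         D E eq _  _  = interpolate-unique S y y-injective D E eq
      hermite-unique (c′ ∷ h) S (ac′ ∷ ah) D E eq oD oE = trans (sym (factor D oD))
        (trans (cong (con (ζ c′) 0#) (hermite-unique h S ah (quotient (ζ c′) D) (quotient (ζ c′) E)
                  (λ i i∈S → δ-injective (y≢ζ i c′) (trans (sym (eval-factor D oD i)) (trans (eq i i∈S) (eval-factor E oE i))))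
                  (ord-quotient D oD) (ord-quotient E oE)))
               (factor E oE))
        where
        Deep : Vec Carrier (suc (length h ℕ.+ card S)) → Set
        Deep D = ∀ c → Active c → count c (c′ ∷ h) ≤ ord (ζ c) D
        factor : ∀ D → Deep D → con (ζ c′) 0# (quotient (ζ c′) D) ≡ D
        factor D oD = ord>0⇒con (ζ c′) D (ℕ.≤-trans
          (subst (λ b → 1 ≤ b ℕ.+ count c′ h) (sym (if-yes (c′ Fin.≟ c′) refl)) (s≤s z≤n)) (oD c′ ac′))
        eval-factor : ∀ D → Deep D → ∀ i → eval (y i) D ≡ δ (y i) (ζ c′) (eval (y i) (quotient (ζ c′) D))
        eval-factor D oD i = trans (cong (eval (y i)) (sym (factor D oD)))
          (trans (eval-con (y i) (ζ c′) 0# (quotient (ζ c′) D)) (identityˡ _))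
        ord-quotient : ∀ D → Deep D → ∀ c → Active c → count c h ≤ ord (ζ c) (quotient (ζ c′) D)
        ord-quotient D oD c ac = ℕ.+-cancelˡ-≤ (if does (c Fin.≟ c′) then 1 else 0) _ _
          (subst (count c (c′ ∷ h) ≤_) (trans (cong (ord (ζ c)) (sym (factor D oD))) (ord-con-≥ ac ac′ _)) (oD c ac))

      -- Dividing by a zero that f counts lowers the degree and one value of f by 1 and, as γ ≠ 0,
      -- leaves the other multiplicities alone. A function f below `ord` is allowed because types
      -- are truncated, and its support is confined to active labels because other labels may share
      -- their points.
      ∑-ord≤ : ∀ {d} (D : Vec Carrier d) (f : Fin l → ℕ) → (∀ c → 0 < f c → Active c) →
               (∀ c → f c ≤ ord (ζ c) D) → ∑ f ≤ d
      ∑-ord≤ {zero}  D f act f≤ = ℕ.≤-reflexive (∑-zero λ c → ℕ.n≤0⇒n≡0 (f≤ c))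
      ∑-ord≤ {suc d} D f act f≤ with Fin.any? (λ c → 1 ℕ.≤? f c)
      ... | no none = ℕ.≤-trans (ℕ.≤-reflexive (∑-zero λ c → ℕ.n<1⇒n≡0 (ℕ.≰⇒> λ 1≤f → none (c , 1≤f)))) z≤n
      ... | yes (c , 0<fc) = subst (_≤ suc d)
            (sym (∑-decrement f g c (sym (trans (cong suc gc) (ℕ.suc-pred (f c) {{ℕ.>-nonZero 0<fc}}))) (λ i i≢c → sym (gi i i≢c))))
            (s≤s (∑-ord≤ (quotient (ζ c) D) g (λ i 0<gi → act i (ℕ.≤-trans 0<gi (g≤f i))) g≤))
        where
        g : Fin l → ℕ
        g i = if does (i Fin.≟ c) then pred (f i) else f i
        gc : g c ≡ pred (f c)
        gc = if-yes (c Fin.≟ c) refl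
        gi : ∀ i → i ≢ c → g i ≡ f i
        gi i i≢c = if-no (i Fin.≟ c) i≢c
        g≤f : ∀ i → g i ≤ f i
        g≤f i with i Fin.≟ c
        ... | yes _ = ℕ.pred[n]≤n
        ... | no _  = ℕ.≤-refl
        factor : con (ζ c) 0# (quotient (ζ c) D) ≡ D
        factor = ord>0⇒con (ζ c) D (ℕ.≤-trans 0<fc (f≤ c))
        g≤ : ∀ i → g i ≤ ord (ζ i) (quotient (ζ c) D)
        g≤ i with i Fin.≟ c
        ... | yes refl = ℕ.pred-mono-≤ (subst (f i ≤_) (trans (cong (ord (ζ i)) (sym factor)) (ord-con-self (ζ i) (quotient (ζ i) D))) (f≤ i))
        ... | no i≢c with 1 ℕ.≤? f i
        ... | no fi<1 = ℕ.≤-trans (ℕ.≤-reflexive (ℕ.n<1⇒n≡0 (ℕ.≰⇒> fi<1))) z≤n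
        ... | yes 0<fi = subst (f i ≤_) (trans (cong (ord (ζ i)) (sym factor))
                (ord-con-other γ≢0 (i≢c ∘ ζ-injective (act i 0<fi) (act c 0<fc)) (quotient (ζ c) D))) (f≤ i)

-- Typed arrays

infix 4 _≈[_]_
_≈[_]_ : {A : Set} → (Fin k → A) → Vec Bool k → (Fin k → A) → Set
r ≈[ S ] u = ∀ i → lookup S i ≡ true → r i ≡ u i

labelCount>0 : (S : Vec Bool k) (κ : Fin k → Maybe (Fin l)) → ∀ {i c} →
               lookup S i ≡ true → κ i ≡ just c → 0 < labelCount S κ c
labelCount>0 (false ∷ S) κ {suc i} i∈S eq = labelCount>0 S (κ ∘ suc) i∈S eq
labelCount>0 (true  ∷ S) κ {zero} {c} i∈S eq rewrite eq =
  subst (λ b → 0 < b ℕ.+ labelCount S (κ ∘ suc) c) (sym (if-yes (c Fin.≟ c) refl)) (s≤s z≤n)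
labelCount>0 (true  ∷ S) κ {suc i} i∈S eq with κ zero
... | nothing = labelCount>0 S (κ ∘ suc) i∈S eq
... | just c′ = ℕ.≤-trans (labelCount>0 S (κ ∘ suc) i∈S eq) (ℕ.m≤n+m _ _)

ordinaryPart : Vec Bool k → (Fin k → Maybe (Fin l)) → Vec Bool k
ordinaryPart []          κ = []
ordinaryPart (false ∷ S) κ = false ∷ ordinaryPart S (κ ∘ suc)
ordinaryPart (true  ∷ S) κ with κ zero
... | nothing = true ∷ ordinaryPart S (κ ∘ suc)
... | just _  = false ∷ ordinaryPart S (κ ∘ suc)

labelPart : Vec Bool k → (Fin k → Maybe (Fin l)) → List (Fin l)
labelPart []          κ = []
labelPart (false ∷ S) κ = labelPart S (κ ∘ suc)
labelPart (true  ∷ S) κ with κ zero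
... | nothing = labelPart S (κ ∘ suc)
... | just c  = c ∷ labelPart S (κ ∘ suc)

labelPart+ordinaryPart : (S : Vec Bool k) (κ : Fin k → Maybe (Fin l)) →
                         card S ≡ length (labelPart S κ) ℕ.+ card (ordinaryPart S κ)
labelPart+ordinaryPart []          κ = refl
labelPart+ordinaryPart (false ∷ S) κ = labelPart+ordinaryPart S (κ ∘ suc)
labelPart+ordinaryPart (true  ∷ S) κ with κ zero
... | nothing = trans (cong suc (labelPart+ordinaryPart S (κ ∘ suc))) (sym (ℕ.+-suc _ _))
... | just c  = cong suc (labelPart+ordinaryPart S (κ ∘ suc))

count-labelPart : (S : Vec Bool k) (κ : Fin k → Maybe (Fin l)) → ∀ c →
                  count c (labelPart S κ) ≡ labelCount S κ c
count-labelPart []          κ c = refl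
count-labelPart (false ∷ S) κ c = count-labelPart S (κ ∘ suc) c
count-labelPart (true  ∷ S) κ c with κ zero
... | nothing = count-labelPart S (κ ∘ suc) c
... | just c′ = cong ((if does (c Fin.≟ c′) then 1 else 0) ℕ.+_) (count-labelPart S (κ ∘ suc) c)

∈-ordinaryPart⁻ : (S : Vec Bool k) (κ : Fin k → Maybe (Fin l)) → ∀ i →
                  lookup (ordinaryPart S κ) i ≡ true → lookup S i ≡ true × κ i ≡ nothing
∈-ordinaryPart⁻ (false ∷ S) κ (suc i) eq = ∈-ordinaryPart⁻ S (κ ∘ suc) i eq
∈-ordinaryPart⁻ (true  ∷ S) κ i       eq with κ zero in κ0
∈-ordinaryPart⁻ (true  ∷ S) κ zero    eq | nothing = refl , κ0
∈-ordinaryPart⁻ (true  ∷ S) κ (suc i) eq | nothing = ∈-ordinaryPart⁻ S (κ ∘ suc) i eq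
∈-ordinaryPart⁻ (true  ∷ S) κ (suc i) eq | just _  = ∈-ordinaryPart⁻ S (κ ∘ suc) i eq

∈-ordinaryPart⁺ : (S : Vec Bool k) (κ : Fin k → Maybe (Fin l)) → ∀ i →
                  lookup S i ≡ true → κ i ≡ nothing → lookup (ordinaryPart S κ) i ≡ true
∈-ordinaryPart⁺ (false ∷ S) κ (suc i) i∈S eq = ∈-ordinaryPart⁺ S (κ ∘ suc) i i∈S eq
∈-ordinaryPart⁺ (true  ∷ S) κ zero    i∈S eq rewrite eq = refl
∈-ordinaryPart⁺ (true  ∷ S) κ (suc i) i∈S eq with κ zero
... | nothing = ∈-ordinaryPart⁺ S (κ ∘ suc) i i∈S eq
... | just _  = ∈-ordinaryPart⁺ S (κ ∘ suc) i i∈S eq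

labelPart-All : {P : Fin l → Set} (S : Vec Bool k) (κ : Fin k → Maybe (Fin l)) →
                (∀ i c → lookup S i ≡ true → κ i ≡ just c → P c) → All P (labelPart S κ)
labelPart-All []          κ p = []
labelPart-All (false ∷ S) κ p = labelPart-All S (κ ∘ suc) (p ∘ suc)
labelPart-All (true  ∷ S) κ p with κ zero in κ0
... | nothing = labelPart-All S (κ ∘ suc) (p ∘ suc)
... | just c  = p zero c refl κ0 ∷ labelPart-All S (κ ∘ suc) (p ∘ suc)

-- Symbols of class nothing are ordinary, those of class just c carry the label c.  A tuple with
-- more than e c occurrences of some label c is covered by no row.
record TypedArray (t k : ℕ) {Sym : Set} (class : Sym → Maybe (Fin l)) (e : Fin l → ℕ) : Set₁ where
  field
    Row     : Set
    row     : Row → Fin k → Sym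
    bounded : ∀ r S → card S ≡ t → ∀ c → labelCount S (class ∘ row r) c ≤ e c
    covers  : ∀ S → card S ≡ t → (u : Fin k → Sym) → (∀ c → labelCount S (class ∘ u) c ≤ e c) →
              ∃ λ r → row r ≈[ S ] u
    unique  : ∀ S → card S ≡ t → ∀ {r r′} → row r ≈[ S ] row r′ → r ≡ r′

Live : (Fin l → ℕ) → Maybe (Fin l) → Set
Live e nothing  = ⊤
Live e (just c) = 0 < e c

counts⇒Live : (e : Fin l → ℕ) (S : Vec Bool k) (κ : Fin k → Maybe (Fin l)) →
              (∀ c → labelCount S κ c ≤ e c) → ∀ i → lookup S i ≡ true → Live e (κ i)
counts⇒Live e S κ ≤e i i∈S with κ i in κi
... | nothing = tt
... | just c  = ℕ.≤-trans (labelCount>0 S κ i∈S κi) (≤e c)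

-- On a t-set, rows and admissible tuples contain live symbols only, so `g` and `h` need to be
-- mutually inverse only there. Hence labels of capacity 0 may have different weights on the two
-- sides, which `resize` exploits.
relabel : {Sym Sym′ : Set} {class : Sym → Maybe (Fin l)} {class′ : Sym′ → Maybe (Fin l)} {e : Fin l → ℕ}
          (g : Sym → Sym′) (h : Sym′ → Sym) →
          (∀ s → Live e (class s) → class′ (g s) ≡ class s) →
          (∀ s → Live e (class s) → h (g s) ≡ s) →
          (∀ s → Live e (class′ s) → class (h s) ≡ class′ s) →
          (∀ s → Live e (class′ s) → g (h s) ≡ s) →
          TypedArray strength k class e → TypedArray strength k class′ e
relabel {class = class} {class′} {e} g h class-g hg class-h gh A = record
  { Row     = Row
  ; row     = λ r → g ∘ row r
  ; bounded = λ r S ∣S∣ c → subst (_≤ e c)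
      (labelCount-cong S (λ i i∈S → sym (class-g (row r i) (live r S ∣S∣ i i∈S))) c) (bounded r S ∣S∣ c)
  ; covers  = λ S ∣S∣ u u≤e →
      let liveU = counts⇒Live e S (class′ ∘ u) u≤e
          r , agree = covers S ∣S∣ (h ∘ u) (λ c → subst (_≤ e c)
                        (labelCount-cong S (λ i i∈S → sym (class-h (u i) (liveU i i∈S))) c) (u≤e c))
      in r , λ i i∈S → trans (cong g (agree i i∈S)) (gh (u i) (liveU i i∈S))
  ; unique  = λ S ∣S∣ {r} {r′} agree → unique S ∣S∣ λ i i∈S →
      trans (sym (hg (row r i) (live r S ∣S∣ i i∈S)))
        (trans (cong h (agree i i∈S)) (hg (row r′ i) (live r′ S ∣S∣ i i∈S))) }
  where
  open TypedArray A
  live : ∀ r S → card S ≡ _ → ∀ i → lookup S i ≡ true → Live e (class (row r i))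
  live r S ∣S∣ = counts⇒Live e S (class ∘ row r) (bounded r S ∣S∣)

-- Placing typed arrays over polynomials.

module Blocks {K : ℕ} (M : PointedModule K) where
  open PointedModule M
  open Polynomial M

  module _ (γ : Carrier) (y : Fin k → Fin K) (y-injective : ∀ {i j} → y i ≡ y j → i ≡ j)
           (ζ : Fin l → Fin K) (Active : Fin l → Set)
           (ζ-injective : ∀ {c c′} → Active c → Active c′ → ζ c ≡ ζ c′ → c ≡ c′)
           (y≢ζ : ∀ i c → y i ≢ ζ c) (γ≢0 : γ ≢ 0#) where

    block-exists : ∀ {t} S → card S ≡ t → (κ : Fin k → Maybe (Fin l)) (x : Fin k → Carrier) →
                   (∀ i c → lookup S i ≡ true → κ i ≡ just c → Active c) →
                   ∃ λ (D : Vec Carrier t) →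
                     (∀ i → lookup S i ≡ true → κ i ≡ nothing → eval γ (y i) D ≡ x i) ×
                     (∀ c → Active c → labelCount S κ c ≤ ord γ (ζ c) D)
    block-exists {t} S ∣S∣ κ x act with trans (sym ∣S∣) (labelPart+ordinaryPart S κ)
    ... | refl = D ,
      (λ i i∈S κi → eval-hermite γ y y-injective ζ Active ζ-injective y≢ζ γ≢0 h O x i (∈-ordinaryPart⁺ S κ i i∈S κi)) ,
      (λ c ac → subst (_≤ ord γ (ζ c) D) (count-labelPart S κ c)
        (ord-hermite γ y y-injective ζ Active ζ-injective y≢ζ γ≢0 h O x (labelPart-All S κ act) c ac))
      where
      h = labelPart S κ
      O = ordinaryPart S κ
      D = hermite γ y y-injective ζ Active ζ-injective y≢ζ γ≢0 h O x

    block-unique : ∀ {t} S → card S ≡ t → (κ : Fin k → Maybe (Fin l)) →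
                   (∀ i c → lookup S i ≡ true → κ i ≡ just c → Active c) →
                   (D E : Vec Carrier t) →
                   (∀ i → lookup S i ≡ true → κ i ≡ nothing → eval γ (y i) D ≡ eval γ (y i) E) →
                   (∀ c → Active c → labelCount S κ c ≤ ord γ (ζ c) D) →
                   (∀ c → Active c → labelCount S κ c ≤ ord γ (ζ c) E) → D ≡ E
    block-unique {t} S ∣S∣ κ act D E eq oD oE with trans (sym ∣S∣) (labelPart+ordinaryPart S κ)
    ... | refl = hermite-unique γ y y-injective ζ Active ζ-injective y≢ζ γ≢0 (labelPart S κ) (ordinaryPart S κ)
      (labelPart-All S κ act) D E
      (λ i i∈O → let i∈S , κi = ∈-ordinaryPart⁻ S κ i i∈O in eq i i∈S κi)
      (λ c ac → subst (_≤ ord γ (ζ c) D) (sym (count-labelPart S κ c)) (oD c ac))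
      (λ c ac → subst (_≤ ord γ (ζ c) E) (sym (count-labelPart S κ c)) (oE c ac))

    -- Rows are pairs of a polynomial D and a row of the base array whose type records how often
    -- D vanishes at the points of the free labels; symbols with a free label get no D-coordinate.
    module _ {t : ℕ} {Sym : Set} (class : Sym → Maybe (Fin l)) (e : Fin l → ℕ) (free : Fin l → Bool)
             (active⁺ : ∀ c → free c ≡ true → 0 < e c → Active c)
             (active⁻ : ∀ c → Active c → free c ≡ true)
             (base : ∀ e′ → (∀ c → e′ c ≤ e c) → ∑ (λ c → if free c then e′ c else 0) ≤ t → TypedArray t k class e′)
             where

      -- Towards D, a label that is not free behaves like an ordinary symbol: it carries a
      -- coordinate, and its occurrence imposes a value instead of a zero.
      freeClass : Maybe (Fin l) → Maybe (Fin l)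
      freeClass nothing  = nothing
      freeClass (just c) = if free c then just c else nothing

      Fibre : Maybe (Fin l) → Set
      Fibre nothing  = Carrier
      Fibre (just _) = ⊤

      Sym′ : Set
      Sym′ = Σ Sym (Fibre ∘ freeClass ∘ class)

      coordinate : ∀ κ → Fibre κ → Carrier
      coordinate nothing  a = a
      coordinate (just _) _ = 0#

      fibre : ∀ κ → Carrier → Fibre κ
      fibre nothing  a = a
      fibre (just _) _ = tt

      fibre≡ : ∀ κ {a} (p : Fibre κ) → (κ ≡ nothing → a ≡ coordinate κ p) → fibre κ a ≡ p
      fibre≡ nothing  p eq = eq refl
      fibre≡ (just _) p eq = refl

      value : Sym′ → Carrier
      value (s , p) = coordinate (freeClass (class s)) p

      attach : Sym → Carrier → Sym′
      attach s a = s , fibre (freeClass (class s)) a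

      attach≡ : ∀ {s a} (s′ : Sym′) → s ≡ proj₁ s′ →
                (freeClass (class (proj₁ s′)) ≡ nothing → a ≡ value s′) → attach s a ≡ s′
      attach≡ (s , p) refl eq = cong (s ,_) (fibre≡ (freeClass (class s)) p eq)

      value-attach : ∀ s {a} → freeClass (class s) ≡ nothing → value (attach s a) ≡ a
      value-attach s = go (freeClass (class s))
        where
        go : ∀ κ {a} → κ ≡ nothing → coordinate κ (fibre κ a) ≡ a
        go nothing refl = refl

      -- A free label may occur as often as D vanishes at its point. Truncation at `e c` ensures
      -- that `base` is asked only for capacities below `e`; the sum over the free labels stays at
      -- most t by `∑-ord≤`.
      typeOf : Vec Carrier t → Fin l → ℕ
      typeOf D c = if free c then e c ⊓ ord γ (ζ c) D else e c

      typeOf-free : ∀ D c → free c ≡ true → typeOf D c ≡ e c ⊓ ord γ (ζ c) D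
      typeOf-free D c fc rewrite fc = refl

      typeOf-bound : ∀ D c → typeOf D c ≤ e c
      typeOf-bound D c with free c
      ... | true  = ℕ.m⊓n≤m (e c) _
      ... | false = ℕ.≤-refl

      base′ : ∀ D → TypedArray t k class (typeOf D)
      base′ D = base (typeOf D) (typeOf-bound D)
        (∑-ord≤ γ y y-injective ζ Active ζ-injective y≢ζ γ≢0 D _ act ≤ord)
        where
        act : ∀ c → 0 < (if free c then typeOf D c else 0) → Active c
        act c 0< with free c in fc
        ... | true = active⁺ c fc (ℕ.≤-trans 0< (ℕ.m⊓n≤m (e c) _))
        ≤ord : ∀ c → (if free c then typeOf D c else 0) ≤ ord γ (ζ c) D
        ≤ord c with free c
        ... | true  = ℕ.m⊓n≤n (e c) _
        ... | false = z≤n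

      private module Base D = TypedArray (base′ D)

      labelCount-freeClass : (S : Vec Bool n) (κ : Fin n → Maybe (Fin l)) → ∀ c → free c ≡ true →
                             labelCount S (freeClass ∘ κ) c ≡ labelCount S κ c
      labelCount-freeClass []          κ c fc = refl
      labelCount-freeClass (false ∷ S) κ c fc = labelCount-freeClass S (κ ∘ suc) c fc
      labelCount-freeClass (true  ∷ S) κ c fc with κ zero
      ... | nothing = labelCount-freeClass S (κ ∘ suc) c fc
      ... | just c′ with free c′ in fc′
      ... | true  = cong ((if does (c Fin.≟ c′) then 1 else 0) ℕ.+_) (labelCount-freeClass S (κ ∘ suc) c fc)
      ... | false = trans (labelCount-freeClass S (κ ∘ suc) c fc)
        (cong (ℕ._+ labelCount S (κ ∘ suc) c) (sym (if-no (c Fin.≟ c′) λ c≡c′ →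
          contradiction (trans (sym fc) (trans (cong free c≡c′) fc′)) λ ())))

      freeClass≡just : ∀ κ {c} → freeClass κ ≡ just c → κ ≡ just c × free c ≡ true
      freeClass≡just (just c′) eq with free c′ in fc′
      freeClass≡just (just c′) refl | true = refl , fc′

      classActive : (S : Vec Bool k) (κ : Fin k → Maybe (Fin l)) → (∀ c → labelCount S κ c ≤ e c) →
                    ∀ i c → lookup S i ≡ true → freeClass (κ i) ≡ just c → Active c
      classActive S κ κ≤e i c i∈S eq = let κi , fc = freeClass≡just (κ i) eq in
        active⁺ c fc (ℕ.≤-trans (labelCount>0 S κ i∈S κi) (κ≤e c))

      row′ : Σ (Vec Carrier t) Base.Row → Fin k → Sym′
      row′ (D , r) i = attach (Base.row D r i) (eval γ (y i) D)

      ord-row′ : ∀ D r S → card S ≡ t → ∀ c → Active c →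
                 labelCount S (freeClass ∘ class ∘ Base.row D r) c ≤ ord γ (ζ c) D
      ord-row′ D r S ∣S∣ c ac = ℕ.≤-trans
        (ℕ.≤-reflexive (labelCount-freeClass S (class ∘ Base.row D r) c (active⁻ c ac)))
        (ℕ.≤-trans (Base.bounded D r S ∣S∣ c)
          (ℕ.≤-trans (ℕ.≤-reflexive (typeOf-free D c (active⁻ c ac))) (ℕ.m⊓n≤n (e c) _)))

      product : TypedArray t k {Sym = Sym′} (class ∘ proj₁) e
      product = record
        { Row     = Σ (Vec Carrier t) Base.Row
        ; row     = row′
        ; bounded = λ (D , r) S ∣S∣ c → ℕ.≤-trans (Base.bounded D r S ∣S∣ c) (typeOf-bound D c)
        ; covers  = covers′
        ; unique  = unique′ }
        where
        covers′ : ∀ S → card S ≡ t → (u : Fin k → Sym′) → (∀ c → labelCount S (class ∘ proj₁ ∘ u) c ≤ e c) →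
                  ∃ λ r → row′ r ≈[ S ] u
        covers′ S ∣S∣ u u≤e = (D , proj₁ found) , λ i i∈S → attach≡ (u i) (proj₂ found i i∈S) (values i i∈S)
          where
          κ : Fin k → Maybe (Fin l)
          κ = class ∘ proj₁ ∘ u
          block = block-exists S ∣S∣ (freeClass ∘ κ) (value ∘ u) (classActive S κ u≤e)
          D = proj₁ block
          values = proj₁ (proj₂ block)
          orders : ∀ c → free c ≡ true → labelCount S κ c ≤ e c ⊓ ord γ (ζ c) D
          orders c fc with 1 ℕ.≤? e c
          ... | no ec<1 = ℕ.≤-trans (u≤e c) (ℕ.≤-trans (ℕ.≤-reflexive (ℕ.n<1⇒n≡0 (ℕ.≰⇒> ec<1))) z≤n)
          ... | yes 0<ec = ℕ.⊓-glb (u≤e c) (subst (_≤ ord γ (ζ c) D) (labelCount-freeClass S κ c fc)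
                  (proj₂ (proj₂ block) c (active⁺ c fc 0<ec)))
          counts : ∀ c → labelCount S κ c ≤ typeOf D c
          counts c with free c in fc
          ... | true  = orders c fc
          ... | false = u≤e c
          found = Base.covers D S ∣S∣ (proj₁ ∘ u) counts
        unique′ : ∀ S → card S ≡ t → ∀ {r r′} → row′ r ≈[ S ] row′ r′ → r ≡ r′
        -- D and E satisfy the same t interpolation constraints and hence coincide; only then do r
        -- and r′ belong to the same base array and become comparable.
        unique′ S ∣S∣ {D , r} {E , r′} agree with block-unique S ∣S∣ κ act D E values ordD ordE
          where
          κ : Fin k → Maybe (Fin l)
          κ = freeClass ∘ class ∘ Base.row D r
          act = classActive S (class ∘ Base.row D r) (λ c → ℕ.≤-trans (Base.bounded D r S ∣S∣ c) (typeOf-bound D c))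
          values : ∀ i → lookup S i ≡ true → κ i ≡ nothing → eval γ (y i) D ≡ eval γ (y i) E
          values i i∈S κi = trans (sym (value-attach (Base.row D r i) κi)) (trans (cong value (agree i i∈S))
            (value-attach (Base.row E r′ i) (trans (cong (freeClass ∘ class ∘ proj₁) (sym (agree i i∈S))) κi)))
          ordD = ord-row′ D r S ∣S∣
          ordE : ∀ c → Active c → labelCount S κ c ≤ ord γ (ζ c) E
          ordE c ac = ℕ.≤-trans (ℕ.≤-reflexive (labelCount-cong S
            (λ i i∈S → cong (freeClass ∘ class ∘ proj₁) (agree i i∈S)) c)) (ord-row′ E r′ S ∣S∣ c ac)
        ... | refl = cong (D ,_) (Base.unique D S ∣S∣ λ i i∈S → cong proj₁ (agree i i∈S))

restrict : PointedModule points → (f : Fin n → Fin points) → (∀ {i j} → f i ≡ f j → i ≡ j) → PointedModule n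
restrict M f f-injective = record
  { group = group ; z = z ∘ f ; z-+ = z-+ ∘ f ; z-comm = λ i j → z-comm (f i) (f j)
  ; z-diff = λ i≢j → z-diff (i≢j ∘ f-injective) }
  where open PointedModule M

Symbols : ℕ → (Fin l → ℕ) → Set
Symbols {l} m w = Fin m ⊎ Σ (Fin l) (Fin ∘ w)

label : {w : Fin l → ℕ} → Symbols m w → Maybe (Fin l)
label (inj₁ _)       = nothing
label (inj₂ (c , _)) = just c

Array[_,_] : (t k m : ℕ) (w e : Fin l → ℕ) → Set₁
Array[ t , k ] m w e = TypedArray t k (label {m = m} {w = w}) e

resize : {m′ : ℕ} {w w′ e : Fin l → ℕ} → 0 < m → 0 < m′ → m ≡ m′ → (∀ c → 0 < e c → w c ≡ w′ c) →
         Array[ strength , k ] m w e → Array[ strength , k ] m′ w′ e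
resize {l = l} {m = m} {w = w} {w′} {e} 0<m _ refl w≡w′ = relabel (move w w′) (move w′ w)
  (label-move w w′ w≡w′) (move-move w w′ w≡w′) (label-move w′ w (λ c p → sym (w≡w′ c p)))
  (move-move w′ w (λ c p → sym (w≡w′ c p)))
  where
  move : ∀ w w′ → Symbols {l} m w → Symbols {l} m w′
  move w w′ (inj₁ i) = inj₁ i
  move w w′ (inj₂ (c , j)) with w c ℕ.≟ w′ c
  ... | yes eq = inj₂ (c , cast eq j)
  -- The weights can differ only for a label of capacity 0. Any symbol serves as its image, and 0 <
  -- m provides an ordinary one.
  ... | no  _  = inj₁ (fromℕ< 0<m)
  label-move : ∀ w w′ → (∀ c → 0 < e c → w c ≡ w′ c) → ∀ s → Live e (label {w = w} s) → label {w = w′} (move w w′ s) ≡ label {w = w} s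
  label-move w w′ eq (inj₁ i) _ = refl
  label-move w w′ eq (inj₂ (c , j)) 0<ec with w c ℕ.≟ w′ c
  ... | yes _ = refl
  ... | no neq = ⊥-elim (neq (eq c 0<ec))
  move-move : ∀ w w′ → (∀ c → 0 < e c → w c ≡ w′ c) → ∀ s → Live e (label {w = w} s) → move w′ w (move w w′ s) ≡ s
  move-move w w′ eq (inj₁ i) _ = refl
  move-move w w′ eq (inj₂ (c , j)) 0<ec with w c ℕ.≟ w′ c
  ... | no neq = ⊥-elim (neq (eq c 0<ec))
  ... | yes eq₁ with w′ c ℕ.≟ w c
  ... | no neq = ⊥-elim (neq (sym eq₁))
  ... | yes eq₂ = cong (λ i → inj₂ (c , i)) (Fin.toℕ-injective (trans (Fin.toℕ-cast eq₂ _) (Fin.toℕ-cast eq₁ j)))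

module _ (M : PointedModule (k ℕ.+ n)) where
  open PointedModule M

  ↑ˡ≢↑ʳ : ∀ (i : Fin k) (j : Fin n) → i ↑ˡ n ≢ k ↑ʳ j
  ↑ˡ≢↑ʳ i j eq = ℕ.<⇒≢ (ℕ.<-≤-trans (Fin.toℕ<n i) (ℕ.m≤m+n k (toℕ j)))
    (trans (sym (Fin.toℕ-↑ˡ i n)) (trans (cong toℕ eq) (Fin.toℕ-↑ʳ k j)))

  -- The first k points belong to the columns, the last n to the zeros. Since `p` has to separate
  -- only labels of positive capacity, many labels can share few points as long as few are live.
  multiply : {w e : Fin l → ℕ} (γ : Carrier) → γ ≢ 0# → (free : Fin l → Bool) (p : Fin l → Fin n) →
             (∀ {c c′} → 0 < e c → 0 < e c′ → p c ≡ p c′ → c ≡ c′) →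
             (∀ e′ → (∀ c → e′ c ≤ e c) → ∑ (λ c → if free c then e′ c else 0) ≤ strength → Array[ strength , k ] m w e′) →
             Array[ strength , k ] (m ℕ.* order) (λ c → if free c then w c else w c ℕ.* order) e
  multiply {l = l} {strength = t} {m = m} {w = w} {e} γ γ≢0 free p p-injective base =
    relabel g h (λ s _ → class-g s) (λ s _ → hg s) (λ s _ → class-h s) (λ s _ → gh s)
      (product γ (_↑ˡ n) y-injective ((k ↑ʳ_) ∘ p) Active ζ-injective (λ i c → ↑ˡ≢↑ʳ i (p c)) γ≢0
        (label {m = m} {w = w}) e free (λ _ → _,_) (λ _ → proj₁) base)
    where
    Active : Fin l → Set
    Active c = free c ≡ true × 0 < e c

    y-injective : ∀ {i j : Fin k} → i ↑ˡ n ≡ j ↑ˡ n → i ≡ j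
    y-injective {i} {j} = Fin.↑ˡ-injective n i j

    ζ-injective : ∀ {c c′} → Active c → Active c′ → k ↑ʳ p c ≡ k ↑ʳ p c′ → c ≡ c′
    ζ-injective (_ , 0<e) (_ , 0<e′) eq = p-injective 0<e 0<e′ (Fin.↑ʳ-injective k _ _ eq)

    open Blocks M using (Fibre; product)

    Base : Fin l → Bool → Set
    Base c b = Fibre γ (_↑ˡ n) y-injective ((k ↑ʳ_) ∘ p) Active ζ-injective (λ i c → ↑ˡ≢↑ʳ i (p c)) γ≢0
      (label {m = m} {w = w}) e free (λ _ → _,_) (λ _ → proj₁) base (if b then just c else nothing)

    pack : ∀ c b {a} → Fin a → Base c b → Fin (if b then a else a ℕ.* order)
    pack c true  i _ = i
    pack c false i x = combine i (index x)

    unpack : ∀ c b {a} → Fin (if b then a else a ℕ.* order) → Fin a × Base c b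
    unpack c true  i = i , tt
    unpack c false {a} i = proj₁ (remQuot {a} order i) , element (proj₂ (remQuot {a} order i))

    unpack-pack : ∀ c b {a} (i : Fin a) x → unpack c b (pack c b i x) ≡ (i , x)
    unpack-pack c true  i tt = refl
    unpack-pack c false i x  = cong₂ _,_ (cong proj₁ (Fin.remQuot-combine i (index x)))
      (trans (cong (element ∘ proj₂) (Fin.remQuot-combine i (index x))) (element-index x))

    pack-unpack : ∀ c b {a} i → pack c b (proj₁ (unpack c b {a} i)) (proj₂ (unpack c b {a} i)) ≡ i
    pack-unpack c true  i = refl
    pack-unpack c false {a} i = trans (cong (combine (proj₁ (remQuot {a} order i))) (index-element _)) (Fin.combine-remQuot {a} order i)

    module B = Blocks M
    Sym′ : Set
    Sym′ = B.Sym′ γ (_↑ˡ n) y-injective ((k ↑ʳ_) ∘ p) Active ζ-injective (λ i c → ↑ˡ≢↑ʳ i (p c)) γ≢0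
      (label {m = m} {w = w}) e free (λ _ → _,_) (λ _ → proj₁) base

    w′ : Fin l → ℕ
    w′ c = if free c then w c else w c ℕ.* order

    g : Sym′ → Symbols (m ℕ.* order) w′
    g (inj₁ i , x)       = inj₁ (combine i (index x))
    g (inj₂ (c , j) , x) = inj₂ (c , pack c (free c) j x)

    h : Symbols (m ℕ.* order) w′ → Sym′
    h (inj₁ i) = inj₁ (proj₁ (remQuot {m} order i)) , element (proj₂ (remQuot {m} order i))
    h (inj₂ (c , j)) = inj₂ (c , proj₁ (unpack c (free c) j)) , proj₂ (unpack c (free c) j)

    class-g : ∀ s → label {w = w′} (g s) ≡ label (proj₁ s)
    class-g (inj₁ _ , _) = refl
    class-g (inj₂ _ , _) = refl

    class-h : ∀ s → label (proj₁ (h s)) ≡ label s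
    class-h (inj₁ _) = refl
    class-h (inj₂ _) = refl

    hg : ∀ s → h (g s) ≡ s
    hg (inj₁ i , x) = cong₂ (λ a b → inj₁ a , b) (cong proj₁ (Fin.remQuot-combine i (index x)))
      (trans (cong (element ∘ proj₂) (Fin.remQuot-combine i (index x))) (element-index x))
    hg (inj₂ (c , j) , x) = cong (λ r → inj₂ (c , proj₁ r) , proj₂ r) (unpack-pack c (free c) j x)

    gh : ∀ s → g (h s) ≡ s
    gh (inj₁ i) = cong inj₁ (trans (cong (combine (proj₁ (remQuot {m} order i))) (index-element _)) (Fin.combine-remQuot {m} order i))
    gh (inj₂ (c , j)) = cong (λ r → inj₂ (c , r)) (pack-unpack c (free c) j)

-- Numbering the live labels, and kinds without live labels.

prefix : (Fin l → ℕ) → Fin l → ℕ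
prefix e zero    = 0
prefix e (suc c) = e zero ℕ.+ prefix (e ∘ suc) c

prefix-bound : (e : Fin l → ℕ) → ∀ c → prefix e c ℕ.+ e c ≤ ∑ e
prefix-bound e zero    = ℕ.m≤m+n (e zero) _
prefix-bound e (suc c) = ℕ.≤-trans (ℕ.≤-reflexive (ℕ.+-assoc (e zero) _ _)) (ℕ.+-monoʳ-≤ (e zero) (prefix-bound (e ∘ suc) c))

prefix-injective : (e : Fin l → ℕ) → ∀ {c c′} → 0 < e c → 0 < e c′ → prefix e c ≡ prefix e c′ → c ≡ c′
prefix-injective e {zero}  {zero}   _   _    _  = refl
prefix-injective e {zero}  {suc c′} 0<e _    eq = contradiction (ℕ.m+n≡0⇒m≡0 (e zero) (sym eq)) (ℕ.n>0⇒n≢0 0<e)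
prefix-injective e {suc c} {zero}   _   0<e′ eq = contradiction (ℕ.m+n≡0⇒m≡0 (e zero) eq) (ℕ.n>0⇒n≢0 0<e′)
prefix-injective e {suc c} {suc c′} 0<e 0<e′ eq =
  cong suc (prefix-injective (e ∘ suc) 0<e 0<e′ (ℕ.+-cancelˡ-≡ (e zero) _ _ eq))

-- The intervals of length e c laid end to end start at distinct numbers below ∑ e when e c > 0. The
-- reduction modulo `suc strength` is harmless there and merely gives the other labels some value.
colouring : (e : Fin l → ℕ) → ∑ e ≤ suc strength →
            ∃ λ (p : Fin l → Fin (suc strength)) → ∀ {c c′} → 0 < e c → 0 < e c′ → p c ≡ p c′ → c ≡ c′
colouring {strength = t} e ∑e≤ = (λ c → prefix e c mod suc t) , λ {c} {c′} 0<e 0<e′ eq →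
  prefix-injective e 0<e 0<e′ (trans (sym (small c 0<e)) (trans (cong toℕ eq) (small c′ 0<e′)))
  where
  small : ∀ c → 0 < e c → toℕ (prefix e c mod suc t) ≡ prefix e c
  small c 0<e = trans (Fin.toℕ-fromℕ< (m%n<n (prefix e c) (suc t))) (m<n⇒m%n≡m (ℕ.<-≤-trans
    (ℕ.m<m+n (prefix e c) 0<e) (ℕ.≤-trans (prefix-bound e c) ∑e≤)))

-- Pigeonhole: otherwise a live label chosen for each kind, followed by its colour, would inject the
-- kinds into a set with one element fewer.
unusedKind : (e : Fin l → ℕ) (kind : Fin l → Fin (suc (suc strength))) → ∑ e ≤ suc strength →
             ∃ λ j → ∀ c → kind c ≡ j → e c ≡ 0
unusedKind {l = l} {strength = t} e kind ∑e≤
  with Fin.any? (λ j → Fin.all? (λ c → (kind c Fin.≟ j) →-dec (e c ℕ.≟ 0)))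
... | yes found = found
... | no none = ⊥-elim (ℕ.1+n≰n (Fin.injective⇒≤ {f = proj₁ col ∘ proj₁ ∘ used} λ {j} {j′} eq →
        trans (sym (proj₁ (proj₂ (used j)))) (trans (cong kind (proj₂ col (proj₂ (proj₂ (used j))) (proj₂ (proj₂ (used j′))) eq))
          (proj₁ (proj₂ (used j′))))))
  where
  col = colouring e ∑e≤
  used : ∀ j → ∃ λ c → kind c ≡ j × 0 < e c
  used j with Fin.¬∀⟶∃¬ l _ (λ c → (kind c Fin.≟ j) →-dec (e c ℕ.≟ 0)) (λ all → none (j , all))
  ... | c , ¬imp with kind c Fin.≟ j | e c ℕ.≟ 0
  ... | no kc≢j | _ = ⊥-elim (¬imp λ kc≡j → ⊥-elim (kc≢j kc≡j))
  ... | yes _ | yes ec≡0 = ⊥-elim (¬imp λ _ → ec≡0)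
  ... | yes kc≡j | no ec≢0 = c , kc≡j , ℕ.n≢0⇒n>0 ec≢0

-- Folded arrays

# : (A → Bool) → List A → ℕ
# P []       = 0
# P (x ∷ xs) = (if P x then 1 else 0) ℕ.+ # P xs

#-++ : (P : A → Bool) → ∀ xs ys → # P (xs ++ ys) ≡ # P xs ℕ.+ # P ys
#-++ P []       ys = refl
#-++ P (x ∷ xs) ys = trans (cong ((if P x then 1 else 0) ℕ.+_) (#-++ P xs ys)) (sym (ℕ.+-assoc (if P x then 1 else 0) _ _))

#-map : (P : B → Bool) (f : A → B) → ∀ xs → # P (List.map f xs) ≡ # (P ∘ f) xs
#-map P f []       = refl
#-map P f (x ∷ xs) = cong ((if P (f x) then 1 else 0) ℕ.+_) (#-map P f xs)

#-cong : {P Q : A → Bool} → (∀ x → P x ≡ Q x) → ∀ xs → # P xs ≡ # Q xs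
#-cong eq []       = refl
#-cong eq (x ∷ xs) = cong₂ (λ b r → (if b then 1 else 0) ℕ.+ r) (eq x) (#-cong eq xs)

#-false : {P : A → Bool} → (∀ x → P x ≡ false) → ∀ xs → # P xs ≡ 0
#-false eq []       = refl
#-false eq (x ∷ xs) = cong₂ (λ b r → (if b then 1 else 0) ℕ.+ r) (eq x) (#-false eq xs)

concatTabulate : (Fin n → List A) → List A
concatTabulate {zero}  f = []
concatTabulate {suc n} f = f zero ++ concatTabulate (f ∘ suc)

#-concatTabulate : (P : A → Bool) (f : Fin n → List A) → # P (concatTabulate f) ≡ ∑ (# P ∘ f)
#-concatTabulate {n = zero}  P f = refl
#-concatTabulate {n = suc n} P f = trans (#-++ P (f zero) _) (cong (# P (f zero) ℕ.+_) (#-concatTabulate P (f ∘ suc)))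

∑-const : ∀ n a → ∑ {n} (λ _ → a) ≡ n ℕ.* a
∑-const zero    a = refl
∑-const (suc n) a = cong (a ℕ.+_) (∑-const n a)

∑-* : (f : Fin n → ℕ) → ∀ a → ∑ (λ i → f i ℕ.* a) ≡ ∑ f ℕ.* a
∑-* {zero}  f a = refl
∑-* {suc n} f a = trans (cong (f zero ℕ.* a ℕ.+_) (∑-* (f ∘ suc) a)) (sym (ℕ.*-distribʳ-+ a (f zero) _))

∑-*ˡ : (f : Fin n → ℕ) → ∀ a → ∑ (λ i → a ℕ.* f i) ≡ a ℕ.* ∑ f
∑-*ˡ f a = trans (∑-cong λ i → ℕ.*-comm a (f i)) (trans (∑-* f a) (ℕ.*-comm (∑ f) a))

∑-single : (f : Fin n → ℕ) → ∀ c → (∀ i → i ≢ c → f i ≡ 0) → ∑ f ≡ f c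
∑-single f zero    eq = trans (cong (f zero ℕ.+_) (∑-zero λ i → eq (suc i) λ ())) (ℕ.+-identityʳ (f zero))
∑-single f (suc c) eq = trans (cong (ℕ._+ ∑ (f ∘ suc)) (eq zero λ ())) (∑-single (f ∘ suc) c λ i i≢c → eq (suc i) (i≢c ∘ Fin.suc-injective))

module _ (P : A → Bool) where

  -- The number of earlier entries satisfying P. On the positions where P holds it is a bijection
  -- onto the numbers below `# P xs`. Positions and not entries are numbered, because words will be
  -- repeated.
  rank : (xs : List A) → Fin (length xs) → ℕ
  rank (x ∷ xs) zero    = 0
  rank (x ∷ xs) (suc i) = (if P x then 1 else 0) ℕ.+ rank xs i

  rank-bound : ∀ xs i → P (List.lookup xs i) ≡ true → rank xs i < # P xs
  rank-bound (x ∷ xs) zero    eq rewrite eq = s≤s z≤n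
  rank-bound (x ∷ xs) (suc i) eq = ℕ.+-monoʳ-< (if P x then 1 else 0) (rank-bound xs i eq)

  rank-exists : ∀ xs a → a < # P xs → ∃ λ i → P (List.lookup xs i) ≡ true × rank xs i ≡ a
  rank-exists (x ∷ xs) a a< with P x in Px
  rank-exists (x ∷ xs) zero    a< | true = zero , Px , refl
  rank-exists (x ∷ xs) (suc a) a< | true with rank-exists xs a (ℕ.≤-pred a<)
  ... | i , Pi , eq = suc i , Pi , trans (cong (λ b → (if b then 1 else 0) ℕ.+ rank xs i) Px) (cong suc eq)
  rank-exists (x ∷ xs) a a< | false with rank-exists xs a a<
  ... | i , Pi , eq = suc i , Pi , trans (cong (λ b → (if b then 1 else 0) ℕ.+ rank xs i) Px) eq

  rank-injective : ∀ xs i j → P (List.lookup xs i) ≡ true → P (List.lookup xs j) ≡ true →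
                   rank xs i ≡ rank xs j → i ≡ j
  rank-injective (x ∷ xs) zero    zero    Pi Pj eq = refl
  rank-injective (x ∷ xs) zero    (suc j) Pi Pj eq rewrite Pi = contradiction eq λ ()
  rank-injective (x ∷ xs) (suc i) zero    Pi Pj eq rewrite Pj = contradiction eq λ ()
  rank-injective (x ∷ xs) (suc i) (suc j) Pi Pj eq =
    cong suc (rank-injective xs i j Pi Pj (ℕ.+-cancelˡ-≡ (if P x then 1 else 0) _ _ eq))

rank-cong : {P Q : A → Bool} → (∀ x → P x ≡ Q x) → ∀ xs i → rank P xs i ≡ rank Q xs i
rank-cong eq (x ∷ xs) zero    = refl
rank-cong eq (x ∷ xs) (suc i) = cong₂ (λ b r → (if b then 1 else 0) ℕ.+ r) (eq x) (rank-cong eq xs i)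

-- Capacity vectors and the triangular system.

decrement : Vec ℕ l → Fin l → Maybe (Vec ℕ l)
decrement (x ∷ xs)     (suc c) = Maybe.map (x ∷_) (decrement xs c)
decrement (zero  ∷ xs) zero    = nothing
decrement (suc x ∷ xs) zero    = just (x ∷ xs)

decrement-comm : (xs : Vec ℕ l) → ∀ c c′ →
                 (decrement xs c >>= λ ys → decrement ys c′) ≡ (decrement xs c′ >>= λ ys → decrement ys c)
decrement-comm xs zero zero = refl
decrement-comm (zero  ∷ xs) zero (suc c′) with decrement xs c′
... | nothing = refl
... | just _  = refl
decrement-comm (suc x ∷ xs) zero (suc c′) with decrement xs c′
... | nothing = refl
... | just _  = refl
decrement-comm (zero  ∷ xs) (suc c) zero with decrement xs c
... | nothing = refl
... | just _  = refl
decrement-comm (suc x ∷ xs) (suc c) zero with decrement xs c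
... | nothing = refl
... | just _  = refl
decrement-comm (x ∷ xs) (suc c) (suc c′) with decrement xs c | decrement xs c′ | decrement-comm xs c c′
... | nothing | nothing | eq = refl
... | nothing | just zs | eq = cong (Maybe.map (x ∷_)) eq
... | just ys | nothing | eq = cong (Maybe.map (x ∷_)) eq
... | just ys | just zs | eq = cong (Maybe.map (x ∷_)) eq

decrement-sum : (xs : Vec ℕ l) → ∀ c {ys} → decrement xs c ≡ just ys → sum xs ≡ suc (sum ys)
decrement-sum (suc x ∷ xs) zero    refl = refl
decrement-sum (x ∷ xs)     (suc c) eq with decrement xs c in eq′
decrement-sum (x ∷ xs)     (suc c) refl | just ys = trans (cong (x ℕ.+_) (decrement-sum xs c eq′)) (ℕ.+-suc x _)

decrement-lookup : (xs : Vec ℕ l) → ∀ c {ys} → decrement xs c ≡ just ys → ∀ i →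
                   lookup xs i ≡ (if does (i Fin.≟ c) then 1 else 0) ℕ.+ lookup ys i
decrement-lookup (suc x ∷ xs) zero    refl zero    = refl
decrement-lookup (suc x ∷ xs) zero    refl (suc i) = refl
decrement-lookup (x ∷ xs)     (suc c) eq i with decrement xs c in eq′
decrement-lookup (x ∷ xs)     (suc c) refl zero    | just ys = refl
decrement-lookup (x ∷ xs)     (suc c) refl (suc i) | just ys with i Fin.≟ c | decrement-lookup xs c eq′ i
... | yes _ | eq = eq
... | no  _ | eq = eq

decrement-just : (xs : Vec ℕ l) → ∀ c → 0 < lookup xs c → ∃ λ ys → decrement xs c ≡ just ys
decrement-just (suc x ∷ xs) zero    0< = xs′ , refl where xs′ = x ∷ xs
decrement-just (x ∷ xs)     (suc c) 0< with decrement-just xs c 0<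
... | ys , eq = x ∷ ys , cong (Maybe.map (x ∷_)) eq

value : (Vec ℕ l → ℕ) → Maybe (Vec ℕ l) → ℕ
value F nothing   = 0
value F (just xs) = F xs

value->>= : (F : Vec ℕ l → ℕ) → ∀ a (f : Vec ℕ l → Maybe (Vec ℕ l)) →
            value (λ xs → value F (f xs)) a ≡ value F (a >>= f)
value->>= F nothing   f = refl
value->>= F (just xs) f = refl

value-mono : {F G : Vec ℕ l → ℕ} → ∀ a → (∀ xs → a ≡ just xs → F xs ≤ G xs) → value F a ≤ value G a
value-mono nothing   _   = z≤n
value-mono (just xs) F≤G = F≤G xs refl

value-cong : {F G : Vec ℕ l → ℕ} → ∀ a → (∀ xs → a ≡ just xs → F xs ≡ G xs) → value F a ≡ value G a
value-cong nothing   _   = refl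
value-cong (just xs) F≡G = F≡G xs refl

value-* : ∀ b (F : Vec ℕ l → ℕ) a → value (λ xs → b ℕ.* F xs) a ≡ b ℕ.* value F a
value-* b F nothing   = sym (ℕ.*-zeroʳ b)
value-* b F (just xs) = refl

-- N F e sums F over the capacity vectors obtained from e by using one label.
N : (Vec ℕ l → ℕ) → Vec ℕ l → ℕ
N F e = ∑ (λ c → value F (decrement e c))

N-mono : {F G : Vec ℕ l → ℕ} → ∀ e → (∀ e′ → sum e ≡ suc (sum e′) → F e′ ≤ G e′) → N F e ≤ N G e
N-mono e F≤G = ∑-mono λ c → value-mono (decrement e c) λ e′ eq → F≤G e′ (decrement-sum e c eq)

N-cong : {F G : Vec ℕ l → ℕ} → ∀ e → (∀ e′ → sum e ≡ suc (sum e′) → F e′ ≡ G e′) → N F e ≡ N G e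
N-cong e F≡G = ∑-cong λ c → value-cong (decrement e c) λ e′ eq → F≡G e′ (decrement-sum e c eq)

-- The solution H of H + N H = F (truncated subtraction is exact when F decays fast enough);
-- the first argument bounds the recursion depth.
invert′ : ℕ → (Vec ℕ l → ℕ) → Vec ℕ l → ℕ
invert′ zero    F e = F e
invert′ (suc n) F e = F e ℕ.∸ N (invert′ n F) e

invert : (Vec ℕ l → ℕ) → Vec ℕ l → ℕ
invert F e = invert′ (sum e) F e

N-zero : {F : Vec ℕ l → ℕ} → ∀ e → sum e ≡ 0 → N F e ≡ 0
N-zero {F = F} e ∑e≡0 = ∑-zero λ c → go (decrement e c) (λ eq → decrement-sum e c eq)
  where
  go : ∀ a → (∀ {ys} → a ≡ just ys → sum e ≡ suc (sum ys)) → value F a ≡ 0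
  go nothing   _  = refl
  go (just ys) eq = contradiction (trans (sym ∑e≡0) (eq refl)) λ ()

invert′-fuel : (F : Vec ℕ l → ℕ) → ∀ n n′ e → sum e ≤ n → sum e ≤ n′ → invert′ n F e ≡ invert′ n′ F e
invert′-fuel F zero    zero     e _ _ = refl
invert′-fuel F zero    (suc n′) e ≤0 _ = sym (cong (F e ℕ.∸_) (N-zero e (ℕ.n≤0⇒n≡0 ≤0)))
invert′-fuel F (suc n) zero     e _ ≤0 = cong (F e ℕ.∸_) (N-zero e (ℕ.n≤0⇒n≡0 ≤0))
invert′-fuel F (suc n) (suc n′) e ≤n ≤n′ = cong (F e ℕ.∸_) (N-cong e λ e′ eq →
  invert′-fuel F n n′ e′ (ℕ.≤-pred (subst (_≤ suc n) eq ≤n)) (ℕ.≤-pred (subst (_≤ suc n′) eq ≤n′)))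

invert≡ : (F : Vec ℕ l → ℕ) → ∀ e → invert F e ≡ F e ℕ.∸ N (invert F) e
invert≡ F e = trans (invert′-fuel F (sum e) (suc (sum e)) e ℕ.≤-refl (ℕ.n≤1+n _))
  (cong (F e ℕ.∸_) (N-cong e λ e′ eq → invert′-fuel F (sum e) (sum e′) e′ (ℕ.≤-trans (ℕ.n≤1+n _) (ℕ.≤-reflexive (sym eq))) ℕ.≤-refl))

-- Inverting 1 + N once lowers the constant C by one (`invert-decays`), so the constant d + 1
-- permits d successive inversions without a negative value.
Decays : ℕ → ℕ → (Vec ℕ l → ℕ) → Set
Decays T C F = ∀ e → sum e ≤ T → C ℕ.* N F e ≤ F e

module _ {T C : ℕ} {F : Vec ℕ l → ℕ} (decays : Decays T (suc C) F) where

  N-invert≤ : ∀ e → N (invert F) e ≤ N F e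
  N-invert≤ e = N-mono e λ e′ _ → subst (_≤ F e′) (sym (invert≡ F e′)) (ℕ.m∸n≤m (F e′) (N (invert F) e′))

  invert-solves : ∀ e → sum e ≤ T → invert F e ℕ.+ N (invert F) e ≡ F e
  invert-solves e ≤T = trans (cong (ℕ._+ N (invert F) e) (invert≡ F e))
    (ℕ.m∸n+n≡m (ℕ.≤-trans (N-invert≤ e) (ℕ.≤-trans (ℕ.m≤m+n (N F e) (C ℕ.* N F e)) (decays e ≤T))))

  invert-decays : Decays T C (invert F)
  invert-decays e ≤T = begin
    C ℕ.* N (invert F) e                     ≤⟨ ℕ.*-monoʳ-≤ C (N-invert≤ e) ⟩
    C ℕ.* N F e                              ≡⟨ ℕ.m+n∸m≡n (N F e) _ ⟨
    suc C ℕ.* N F e ℕ.∸ N F e                ≤⟨ ℕ.∸-mono (decays e ≤T) (N-invert≤ e) ⟩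
    F e ℕ.∸ N (invert F) e                   ≡⟨ invert≡ F e ⟨
    invert F e                               ∎
    where open ℕ.≤-Reasoning

-- The power (1 + N)^d. Each column outside S will contribute one factor: it holds either an
-- ordinary symbol or a label that uses up capacity.
iterate : ℕ → (Vec ℕ l → ℕ) → Vec ℕ l → ℕ
iterate zero    F e = F e
iterate (suc d) F e = iterate d F e ℕ.+ N (iterate d F) e

invertⁿ : ℕ → (Vec ℕ l → ℕ) → Vec ℕ l → ℕ
invertⁿ zero    F = F
invertⁿ (suc d) F = invertⁿ d (invert F)

iterate-invertⁿ : ∀ d {T} {F : Vec ℕ l → ℕ} → Decays T (suc d) F → ∀ e → sum e ≤ T → iterate d (invertⁿ d F) e ≡ F e
iterate-invertⁿ zero    decays e ≤T = refl
iterate-invertⁿ (suc d) {T} {F} decays e ≤T = trans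
  (cong₂ ℕ._+_ (ih e ≤T) (N-cong e λ e′ eq → ih e′ (ℕ.≤-trans (ℕ.n≤1+n _) (subst (_≤ T) eq ≤T))))
  (invert-solves {C = suc d} decays e ≤T)
  where
  ih = iterate-invertⁿ d (invert-decays {C = suc d} decays)

-- Words over v ordinary symbols and the labels; a label stands for v copies of itself, so that
-- every column outside S contributes a factor v.
module Words (v l : ℕ) where

  Symbol : Set
  Symbol = Fin v ⊎ Fin l

  class : Symbol → Maybe (Fin l)
  class (inj₁ _) = nothing
  class (inj₂ c) = just c

  _≟ˢ_ : (s s′ : Symbol) → Dec (s ≡ s′)
  _≟ˢ_ = Sum.≡-dec Fin._≟_ Fin._≟_

  copies : ℕ → List A → List A
  copies n xs = concatTabulate {n} (λ _ → xs)

  #-copies : (P : A → Bool) → ∀ n xs → # P (copies n xs) ≡ n ℕ.* # P xs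
  #-copies P n xs = trans (#-concatTabulate {n = n} P (λ _ → xs)) (∑-const n (# P xs))

  fromMaybe : (Vec ℕ l → List A) → Maybe (Vec ℕ l) → List A
  fromMaybe f nothing  = []
  fromMaybe f (just e) = f e

  #-fromMaybe : (P : A → Bool) → ∀ f a → # P (fromMaybe f a) ≡ value (# P ∘ f) a
  #-fromMaybe P f nothing  = refl
  #-fromMaybe P f (just e) = refl

  -- The multiplicity τ is the unknown of the triangular system and depends only on the capacity
  -- left over: a word with j labels that leaves e′ occurs v^j τ(e′) times.
  words : ∀ k → (Vec ℕ l → ℕ) → Vec ℕ l → List (Vec Symbol k)
  words zero    τ e = copies (τ e) ([] ∷ [])
  words (suc k) τ e =
    concatTabulate (λ x → List.map (inj₁ x ∷_) (words k τ e)) ++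
    concatTabulate (λ c → fromMaybe (λ e′ → copies v (List.map (inj₂ c ∷_) (words k τ e′))) (decrement e c))

  matches : Vec Bool k → (Fin k → Symbol) → Vec Symbol k → Bool
  matches []          u []      = true
  matches (true  ∷ S) u (s ∷ w) = does (s ≟ˢ u zero) ∧ matches S (u ∘ suc) w
  matches (false ∷ S) u (s ∷ w) = matches S (u ∘ suc) w

  matches⁺ : (S : Vec Bool k) (u : Fin k → Symbol) (w : Vec Symbol k) → lookup w ≈[ S ] u → matches S u w ≡ true
  matches⁺ []          u []      agree = refl
  matches⁺ (false ∷ S) u (s ∷ w) agree = matches⁺ S (u ∘ suc) w (agree ∘ suc)
  matches⁺ (true  ∷ S) u (s ∷ w) agree with s ≟ˢ u zero
  ... | yes _ = matches⁺ S (u ∘ suc) w (agree ∘ suc)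
  ... | no neq = ⊥-elim (neq (agree zero refl))

  matches⁻ : (S : Vec Bool k) (u : Fin k → Symbol) (w : Vec Symbol k) → matches S u w ≡ true → lookup w ≈[ S ] u
  matches⁻ (false ∷ S) u (s ∷ w) eq (suc i) i∈S = matches⁻ S (u ∘ suc) w eq i i∈S
  matches⁻ (true  ∷ S) u (s ∷ w) eq i i∈S with s ≟ˢ u zero
  matches⁻ (true  ∷ S) u (s ∷ w) eq zero    i∈S | yes s≡ = s≡
  matches⁻ (true  ∷ S) u (s ∷ w) eq (suc i) i∈S | yes _  = matches⁻ S (u ∘ suc) w eq i i∈S

  matches-cong : (S : Vec Bool k) {u u′ : Fin k → Symbol} → u ≈[ S ] u′ → ∀ w → matches S u w ≡ matches S u′ w
  matches-cong []          eq []      = refl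
  matches-cong (false ∷ S) eq (s ∷ w) = matches-cong S (eq ∘ suc) w
  matches-cong (true  ∷ S) eq (s ∷ w) = cong₂ (λ a b → does (s ≟ˢ a) ∧ b) (eq zero refl) (matches-cong S (eq ∘ suc) w)

  outside : Vec Bool k → ℕ
  outside []          = 0
  outside (true  ∷ S) = outside S
  outside (false ∷ S) = suc (outside S)

  outside+card : (S : Vec Bool k) → outside S ℕ.+ card S ≡ k
  outside+card []          = refl
  outside+card (true  ∷ S) = trans (ℕ.+-suc _ _) (cong suc (outside+card S))
  outside+card (false ∷ S) = cong suc (outside+card S)

  labels : Vec Bool k → (Fin k → Symbol) → ℕ
  labels []          u = 0
  labels (false ∷ S) u = labels S (u ∘ suc)
  labels (true  ∷ S) u with u zero
  ... | inj₁ _ = labels S (u ∘ suc)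
  ... | inj₂ _ = suc (labels S (u ∘ suc))

  remaining : Vec Bool k → (Fin k → Symbol) → Vec ℕ l → Maybe (Vec ℕ l)
  remaining []          u e = just e
  remaining (false ∷ S) u e = remaining S (u ∘ suc) e
  remaining (true  ∷ S) u e with u zero
  ... | inj₁ _ = remaining S (u ∘ suc) e
  ... | inj₂ c = decrement e c >>= remaining S (u ∘ suc)

  >>=-assoc : ∀ (a : Maybe (Vec ℕ l)) {f g : Vec ℕ l → Maybe (Vec ℕ l)} →
              ((a >>= f) >>= g) ≡ (a >>= λ x → f x >>= g)
  >>=-assoc nothing  = refl
  >>=-assoc (just x) = refl

  >>=-cong : ∀ (a : Maybe (Vec ℕ l)) {f g : Vec ℕ l → Maybe (Vec ℕ l)} → (∀ x → f x ≡ g x) → (a >>= f) ≡ (a >>= g)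
  >>=-cong nothing  eq = refl
  >>=-cong (just x) eq = eq x

  remaining-decrement : (S : Vec Bool k) (u : Fin k → Symbol) → ∀ e c →
                        (decrement e c >>= remaining S u) ≡ (remaining S u e >>= λ e′ → decrement e′ c)
  remaining-decrement []          u e c with decrement e c
  ... | nothing = refl
  ... | just _  = refl
  remaining-decrement (false ∷ S) u e c = remaining-decrement S (u ∘ suc) e c
  remaining-decrement (true  ∷ S) u e c with u zero
  ... | inj₁ _  = remaining-decrement S (u ∘ suc) e c
  ... | inj₂ c′ = begin
    (decrement e c >>= λ e′ → decrement e′ c′ >>= rest)     ≡⟨ >>=-assoc (decrement e c) ⟨
    ((decrement e c >>= λ e′ → decrement e′ c′) >>= rest)   ≡⟨ cong (_>>= rest) (decrement-comm e c c′) ⟩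
    ((decrement e c′ >>= λ e′ → decrement e′ c) >>= rest)   ≡⟨ >>=-assoc (decrement e c′) ⟩
    (decrement e c′ >>= λ e′ → decrement e′ c >>= rest)     ≡⟨ >>=-cong (decrement e c′) (λ e′ → remaining-decrement S (u ∘ suc) e′ c) ⟩
    (decrement e c′ >>= λ e′ → rest e′ >>= λ e″ → decrement e″ c) ≡⟨ >>=-assoc (decrement e c′) ⟨
    ((decrement e c′ >>= rest) >>= λ e″ → decrement e″ c)   ∎
    where
    open ≡-Reasoning
    rest = remaining S (u ∘ suc)

  private
    value-zero : {F : Vec ℕ l → ℕ} → ∀ a → (∀ e → F e ≡ 0) → value F a ≡ 0
    value-zero nothing  _  = refl
    value-zero (just e) eq = eq e

  head-match : (S : Vec Bool k) (u : Fin (suc k) → Symbol) → ∀ {s} → s ≡ u zero → ∀ w →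
               matches (true ∷ S) u (s ∷ w) ≡ matches S (u ∘ suc) w
  head-match S u {s} eq w with s ≟ˢ u zero
  ... | yes _  = refl
  ... | no neq = ⊥-elim (neq eq)

  head-mismatch : (S : Vec Bool k) (u : Fin (suc k) → Symbol) → ∀ s → s ≢ u zero → ∀ w →
                  matches (true ∷ S) u (s ∷ w) ≡ false
  head-mismatch S u s neq w with s ≟ˢ u zero
  ... | yes eq = ⊥-elim (neq eq)
  ... | no _   = refl

  #-words-suc : (P : Vec Symbol (suc k) → Bool) → ∀ τ e → # P (words (suc k) τ e) ≡
                ∑ (λ x → # (P ∘ (inj₁ x ∷_)) (words k τ e)) ℕ.+
                ∑ (λ c → value (λ e′ → v ℕ.* # (P ∘ (inj₂ c ∷_)) (words k τ e′)) (decrement e c))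
  #-words-suc {k} P τ e = trans (#-++ P (concatTabulate λ x → List.map (inj₁ x ∷_) (words k τ e)) (concatTabulate labelled)) (cong₂ ℕ._+_
    (trans (#-concatTabulate P (λ x → List.map (inj₁ x ∷_) (words k τ e))) (∑-cong λ x → #-map P (inj₁ x ∷_) (words k τ e)))
    (trans (#-concatTabulate P labelled) (∑-cong λ c → trans (#-fromMaybe P (copied c) (decrement e c))
      (value-cong (decrement e c) λ e′ _ → trans (#-copies P v (List.map (inj₂ c ∷_) (words k τ e′)))
        (cong (v ℕ.*_) (#-map P (inj₂ c ∷_) (words k τ e′)))))))
    where
    copied : Fin l → Vec ℕ l → List (Vec Symbol (suc k))
    copied c e′ = copies v (List.map (inj₂ c ∷_) (words k τ e′))
    labelled : Fin l → List (Vec Symbol (suc k))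
    labelled c = fromMaybe (copied c) (decrement e c)

  -- Column by column: in S an ordinary symbol contributes 1 and a label its v copies; outside S the
  -- v ordinary symbols and the v copies of each label together contribute v (1 + N). By
  -- `remaining-decrement` it does not matter in which order the labels inside and outside S use up
  -- capacity.
  #-words : (S : Vec Bool k) (u : Fin k → Symbol) → ∀ τ e →
            # (matches S u) (words k τ e) ≡ v ℕ.^ (outside S ℕ.+ labels S u) ℕ.* value (iterate (outside S) τ) (remaining S u e)
  #-words [] u τ e = trans (#-copies (matches [] u) (τ e) ([] ∷ [])) (trans (ℕ.*-identityʳ (τ e)) (sym (ℕ.*-identityˡ (τ e))))
  #-words {suc k} (false ∷ S) u τ e = begin
    # (matches (false ∷ S) u) (words (suc k) τ e)
      ≡⟨ #-words-suc (matches (false ∷ S) u) τ e ⟩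
    ∑ {v} (λ _ → # P (words k τ e)) ℕ.+ ∑ (λ c → value (λ e′ → v ℕ.* # P (words k τ e′)) (decrement e c))
      ≡⟨ cong₂ ℕ._+_ (trans (∑-const v _) (cong (v ℕ.*_) (#-words S (u ∘ suc) τ e)))
          (∑-cong λ c → value-cong (decrement e c) λ e′ _ → cong (v ℕ.*_) (#-words S (u ∘ suc) τ e′)) ⟩
    v ℕ.* (V ℕ.* value G (rest e)) ℕ.+ ∑ (λ c → value (λ e′ → v ℕ.* (V ℕ.* value G (rest e′))) (decrement e c))
      ≡⟨ cong₂ ℕ._+_ (sym (ℕ.*-assoc v V _)) (trans (∑-cong per-label) (∑-*ˡ (λ c → value G (rest e >>= λ e′ → decrement e′ c)) (v ℕ.* V))) ⟩
    v ℕ.* V ℕ.* value G (rest e) ℕ.+ v ℕ.* V ℕ.* ∑ (λ c → value G (rest e >>= λ e′ → decrement e′ c))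
      ≡⟨ sym (ℕ.*-distribˡ-+ (v ℕ.* V) _ _) ⟩
    v ℕ.* V ℕ.* (value G (rest e) ℕ.+ ∑ (λ c → value G (rest e >>= λ e′ → decrement e′ c)))
      ≡⟨ cong (v ℕ.* V ℕ.*_) (collect (rest e)) ⟩
    v ℕ.* V ℕ.* value (iterate (suc (outside S)) τ) (rest e) ∎
    where
    open ≡-Reasoning
    P = matches S (u ∘ suc)
    V = v ℕ.^ (outside S ℕ.+ labels S (u ∘ suc))
    G = iterate (outside S) τ
    rest = remaining S (u ∘ suc)
    per-label : ∀ c → value (λ e′ → v ℕ.* (V ℕ.* value G (rest e′))) (decrement e c) ≡
                v ℕ.* V ℕ.* value G (rest e >>= λ e′ → decrement e′ c)
    per-label c = trans (value-cong (decrement e c) λ e′ _ → sym (ℕ.*-assoc v V _))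
      (trans (value-* (v ℕ.* V) _ (decrement e c)) (cong (v ℕ.* V ℕ.*_)
        (trans (value->>= G (decrement e c) rest) (cong (value G) (remaining-decrement S (u ∘ suc) e c)))))
    collect : ∀ a → value G a ℕ.+ ∑ (λ c → value G (a >>= λ e′ → decrement e′ c)) ≡ value (iterate (suc (outside S)) τ) a
    collect nothing  = ∑-zero {l} λ _ → refl
    collect (just e) = refl
  #-words {suc k} (true ∷ S) u τ e with u zero in u₀
  ... | inj₁ x₀ = begin
    # (matches (true ∷ S) u) (words (suc k) τ e)
      ≡⟨ #-words-suc (matches (true ∷ S) u) τ e ⟩
    ∑ (λ x → # (matches (true ∷ S) u ∘ (inj₁ x ∷_)) (words k τ e)) ℕ.+
    ∑ (λ c → value (λ e′ → v ℕ.* # (matches (true ∷ S) u ∘ (inj₂ c ∷_)) (words k τ e′)) (decrement e c))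
      ≡⟨ cong₂ ℕ._+_
          (∑-single _ x₀ λ x x≢x₀ → #-false (head-mismatch S u (inj₁ x) λ eq → x≢x₀ (Sum.inj₁-injective (trans eq u₀))) (words k τ e))
          (∑-zero λ c → value-zero (decrement e c) λ e′ → trans (cong (v ℕ.*_)
            (#-false (head-mismatch S u (inj₂ c) λ eq → contradiction (trans eq u₀) λ ()) (words k τ e′))) (ℕ.*-zeroʳ v)) ⟩
    # (matches (true ∷ S) u ∘ (inj₁ x₀ ∷_)) (words k τ e) ℕ.+ 0
      ≡⟨ trans (ℕ.+-identityʳ _) (#-cong (head-match S u (sym u₀)) (words k τ e)) ⟩
    # (matches S (u ∘ suc)) (words k τ e)
      ≡⟨ #-words S (u ∘ suc) τ e ⟩
    v ℕ.^ (outside S ℕ.+ labels S (u ∘ suc)) ℕ.* value (iterate (outside S) τ) (remaining S (u ∘ suc) e) ∎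
    where open ≡-Reasoning
  ... | inj₂ c₀ = begin
    # (matches (true ∷ S) u) (words (suc k) τ e)
      ≡⟨ #-words-suc (matches (true ∷ S) u) τ e ⟩
    ∑ (λ x → # (matches (true ∷ S) u ∘ (inj₁ x ∷_)) (words k τ e)) ℕ.+
    ∑ (λ c → value (λ e′ → v ℕ.* # (matches (true ∷ S) u ∘ (inj₂ c ∷_)) (words k τ e′)) (decrement e c))
      ≡⟨ cong₂ ℕ._+_
          (∑-zero λ x → #-false (head-mismatch S u (inj₁ x) λ eq → contradiction (trans eq u₀) λ ()) (words k τ e))
          (∑-single _ c₀ λ c c≢c₀ → value-zero (decrement e c) λ e′ → trans (cong (v ℕ.*_)
            (#-false (head-mismatch S u (inj₂ c) λ eq → c≢c₀ (Sum.inj₂-injective (trans eq u₀))) (words k τ e′))) (ℕ.*-zeroʳ v)) ⟩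
    value (λ e′ → v ℕ.* # (matches (true ∷ S) u ∘ (inj₂ c₀ ∷_)) (words k τ e′)) (decrement e c₀)
      ≡⟨ value-cong (decrement e c₀) (λ e′ _ → trans (cong (v ℕ.*_)
          (trans (#-cong (head-match S u (sym u₀)) (words k τ e′)) (#-words S (u ∘ suc) τ e′))) (sym (ℕ.*-assoc v V _))) ⟩
    value (λ e′ → v ℕ.* V ℕ.* value G (rest e′)) (decrement e c₀)
      ≡⟨ trans (value-* (v ℕ.* V) _ (decrement e c₀)) (cong (v ℕ.* V ℕ.*_) (value->>= G (decrement e c₀) rest)) ⟩
    v ℕ.* V ℕ.* value G (decrement e c₀ >>= rest)
      ≡⟨ cong (λ a → v ℕ.^ a ℕ.* value G (decrement e c₀ >>= rest)) (sym (ℕ.+-suc (outside S) (labels S (u ∘ suc)))) ⟩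
    v ℕ.^ (outside S ℕ.+ suc (labels S (u ∘ suc))) ℕ.* value G (decrement e c₀ >>= rest) ∎
    where
    open ≡-Reasoning
    V = v ℕ.^ (outside S ℕ.+ labels S (u ∘ suc))
    G = iterate (outside S) τ
    rest = remaining S (u ∘ suc)

  remaining-sum : (S : Vec Bool k) (u : Fin k → Symbol) → ∀ e {e′} → remaining S u e ≡ just e′ →
                  sum e ≡ labels S u ℕ.+ sum e′
  remaining-sum []          u e refl = refl
  remaining-sum (false ∷ S) u e eq = remaining-sum S (u ∘ suc) e eq
  remaining-sum (true  ∷ S) u e eq with u zero
  ... | inj₁ _ = remaining-sum S (u ∘ suc) e eq
  ... | inj₂ c with decrement e c in eq₁
  ... | just e₁ = trans (decrement-sum e c eq₁) (cong suc (remaining-sum S (u ∘ suc) e₁ eq))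

  remaining-bounded : (S : Vec Bool k) (u : Fin k → Symbol) → ∀ e {e′} → remaining S u e ≡ just e′ →
                      ∀ c → labelCount S (class ∘ u) c ≤ lookup e c
  remaining-bounded []          u e eq c = z≤n
  remaining-bounded (false ∷ S) u e eq c = remaining-bounded S (u ∘ suc) e eq c
  remaining-bounded (true  ∷ S) u e eq c with u zero
  ... | inj₁ _ = remaining-bounded S (u ∘ suc) e eq c
  ... | inj₂ c₀ with decrement e c₀ in eq₁
  ... | just e₁ = subst ((if does (c Fin.≟ c₀) then 1 else 0) ℕ.+ labelCount S (class ∘ u ∘ suc) c ≤_)
    (sym (decrement-lookup e c₀ eq₁ c)) (ℕ.+-monoʳ-≤ _ (remaining-bounded S (u ∘ suc) e₁ eq c))

  remaining-just : (S : Vec Bool k) (u : Fin k → Symbol) → ∀ e → (∀ c → labelCount S (class ∘ u) c ≤ lookup e c) →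
                   ∃ λ e′ → remaining S u e ≡ just e′
  remaining-just []          u e ≤e = e , refl
  remaining-just (false ∷ S) u e ≤e = remaining-just S (u ∘ suc) e ≤e
  remaining-just (true  ∷ S) u e ≤e with u zero
  ... | inj₁ _  = remaining-just S (u ∘ suc) e ≤e
  ... | inj₂ c₀ with decrement-just e c₀ (ℕ.≤-trans (subst (λ b → 1 ≤ b ℕ.+ labelCount S (class ∘ u ∘ suc) c₀) (sym (if-yes (c₀ Fin.≟ c₀) refl)) (s≤s z≤n)) (≤e c₀))
  ... | e₁ , eq rewrite eq = remaining-just S (u ∘ suc) e₁ λ c → ℕ.+-cancelˡ-≤ (if does (c Fin.≟ c₀) then 1 else 0) _ _
    (subst ((if does (c Fin.≟ c₀) then 1 else 0) ℕ.+ labelCount S (class ∘ u ∘ suc) c ≤_) (decrement-lookup e c₀ eq c) (≤e c))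

sum≡∑ : (xs : Vec ℕ l) → sum xs ≡ ∑ (lookup xs)
sum≡∑ []       = refl
sum≡∑ (x ∷ xs) = cong (x ℕ.+_) (sum≡∑ xs)

-- At most `sum e` ≤ T labels have positive capacity, and using one of them divides the power by v;
-- so N loses a factor v and gains at most a factor T.
power-decays : ∀ {l} v T C X → C ℕ.* T ≤ v → Decays {l} T C (λ e → v ℕ.^ (X ℕ.+ sum e))
power-decays {l} v T C X CT≤v e ≤T with sum e in ∑e
... | zero  = subst (_≤ v ℕ.^ (X ℕ.+ 0)) (sym (trans (cong (C ℕ.*_) (N-zero e ∑e)) (ℕ.*-zeroʳ C))) z≤n
... | suc s = begin
  C ℕ.* ∑ (λ c → value (λ e → v ℕ.^ (X ℕ.+ sum e)) (decrement e c))
    ≤⟨ ℕ.*-monoʳ-≤ C (∑-mono term) ⟩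
  C ℕ.* ∑ (λ c → lookup e c ℕ.* v ℕ.^ (X ℕ.+ s))
    ≡⟨ cong (C ℕ.*_) (trans (∑-* (lookup e) _) (cong (ℕ._* v ℕ.^ (X ℕ.+ s)) (trans (sym (sum≡∑ e)) ∑e))) ⟩
  C ℕ.* (suc s ℕ.* v ℕ.^ (X ℕ.+ s))
    ≡⟨ ℕ.*-assoc C (suc s) _ ⟨
  C ℕ.* suc s ℕ.* v ℕ.^ (X ℕ.+ s)
    ≤⟨ ℕ.*-monoˡ-≤ _ (ℕ.≤-trans (ℕ.*-monoʳ-≤ C ≤T) CT≤v) ⟩
  v ℕ.^ suc (X ℕ.+ s)
    ≡⟨ cong (v ℕ.^_) (sym (ℕ.+-suc X s)) ⟩
  v ℕ.^ (X ℕ.+ suc s) ∎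
  where
  open ℕ.≤-Reasoning
  term : ∀ c → value (λ e → v ℕ.^ (X ℕ.+ sum e)) (decrement e c) ≤ lookup e c ℕ.* v ℕ.^ (X ℕ.+ s)
  term c with decrement e c in eq
  ... | nothing = z≤n
  ... | just e′ = ℕ.≤-trans
    (ℕ.≤-reflexive (cong (λ a → v ℕ.^ (X ℕ.+ a)) (ℕ.suc-injective (trans (sym (decrement-sum e c eq)) ∑e))))
    (ℕ.m≤n*m _ (lookup e c) {{ℕ.>-nonZero (subst (0 <_) (sym (trans (decrement-lookup e c eq c) (cong (ℕ._+ lookup e′ c) (if-yes (c Fin.≟ c) refl)))) (s≤s z≤n))}})

-- Like TypedArray, but every admissible tuple on S is covered q times; the rows covering it are
-- told apart by their colours at S.
record FoldedArray (t k q : ℕ) {Sym : Set} (class : Sym → Maybe (Fin l)) (e : Fin l → ℕ) : Set₁ where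
  field
    Row     : Set
    row     : Row → Fin k → Sym
    colour  : Row → Vec Bool k → Fin q
    bounded : ∀ r S → card S ≡ t → ∀ c → labelCount S (class ∘ row r) c ≤ e c
    covers  : ∀ S → card S ≡ t → (u : Fin k → Sym) → (∀ c → labelCount S (class ∘ u) c ≤ e c) →
              ∀ a → ∃ λ r → row r ≈[ S ] u × colour r S ≡ a
    unique  : ∀ S → card S ≡ t → ∀ {r r′} → row r ≈[ S ] row r′ → colour r S ≡ colour r′ S → r ≡ r′

module _ (v : ℕ) (t k : ℕ) (v-large : suc k ℕ.* t ≤ v) .{{_ : NonZero v}} (e : Fin l → ℕ) (∑e≤t : ∑ e ≤ t) where
  open Words v l

  private
    instance
      v^k≢0 : NonZero (v ℕ.^ k)
      v^k≢0 = ℕ.m^n≢0 v k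

    cap : Vec ℕ l
    cap = tabulate e

    lookup-cap : ∀ c → lookup cap c ≡ e c
    lookup-cap = lookup∘tabulate e

    sum-cap : sum cap ≡ ∑ e
    sum-cap = trans (sum≡∑ cap) (∑-cong lookup-cap)

    -- The right-hand side of the system. If u leaves the capacity e′ then ∑ e = labels + sum e′, so
    -- the exponents of v in the counting formula add up to k: every admissible tuple is covered v^k
    -- times, whatever its labels.
    F : Vec ℕ l → ℕ
    F e′ = v ℕ.^ (t ℕ.∸ ∑ e ℕ.+ sum e′)

    τ : Vec ℕ l → ℕ
    τ = invertⁿ (k ℕ.∸ t) F

    W : List (Vec Symbol k)
    W = words k τ cap

    outside≡ : (S : Vec Bool k) → card S ≡ t → outside S ≡ k ℕ.∸ t
    outside≡ S ∣S∣ = trans (sym (ℕ.m+n∸n≡m (outside S) (card S))) (cong₂ ℕ._∸_ (outside+card S) ∣S∣)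

    -- One inversion for each of the k - t columns outside S requires the constant k - t + 1, whence
    -- the hypothesis v ≥ (k + 1) t.
    F-decays : Decays t (suc (k ℕ.∸ t)) F
    F-decays = power-decays v t (suc (k ℕ.∸ t)) (t ℕ.∸ ∑ e) (ℕ.≤-trans (ℕ.*-monoˡ-≤ t (s≤s (ℕ.m∸n≤m k t))) v-large)

    #-matches : ∀ S → card S ≡ t → ∀ u {e′} → remaining S u cap ≡ just e′ → # (matches S u) W ≡ v ℕ.^ k
    #-matches S ∣S∣ u {e′} eq = begin
      # (matches S u) W
        ≡⟨ trans (#-words S u τ cap) (cong (λ a → v ℕ.^ (outside S ℕ.+ labels S u) ℕ.* value (iterate (outside S) τ) a) eq) ⟩
      v ℕ.^ (outside S ℕ.+ labels S u) ℕ.* iterate (outside S) τ e′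
        ≡⟨ cong (λ d → v ℕ.^ (outside S ℕ.+ labels S u) ℕ.* iterate d τ e′) (outside≡ S ∣S∣) ⟩
      v ℕ.^ (outside S ℕ.+ labels S u) ℕ.* iterate (k ℕ.∸ t) τ e′
        ≡⟨ cong (v ℕ.^ (outside S ℕ.+ labels S u) ℕ.*_) (iterate-invertⁿ (k ℕ.∸ t) F-decays e′ sum-e′) ⟩
      v ℕ.^ (outside S ℕ.+ labels S u) ℕ.* v ℕ.^ (t ℕ.∸ ∑ e ℕ.+ sum e′)
        ≡⟨ ℕ.^-distribˡ-+-* v (outside S ℕ.+ labels S u) _ ⟨
      v ℕ.^ (outside S ℕ.+ labels S u ℕ.+ (t ℕ.∸ ∑ e ℕ.+ sum e′))
        ≡⟨ cong (v ℕ.^_) exponent ⟩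
      v ℕ.^ k ∎
      where
      open ≡-Reasoning
      total : ∑ e ≡ labels S u ℕ.+ sum e′
      total = trans (sym sum-cap) (remaining-sum S u cap eq)
      sum-e′ : sum e′ ≤ t
      sum-e′ = ℕ.≤-trans (ℕ.≤-trans (ℕ.m≤n+m (sum e′) (labels S u)) (ℕ.≤-reflexive (sym total))) ∑e≤t
      exponent : outside S ℕ.+ labels S u ℕ.+ (t ℕ.∸ ∑ e ℕ.+ sum e′) ≡ k
      exponent = begin
        outside S ℕ.+ labels S u ℕ.+ (t ℕ.∸ ∑ e ℕ.+ sum e′)   ≡⟨ ℕ.+-assoc (outside S) _ _ ⟩
        outside S ℕ.+ (labels S u ℕ.+ (t ℕ.∸ ∑ e ℕ.+ sum e′)) ≡⟨ cong (outside S ℕ.+_) (cong (labels S u ℕ.+_) (ℕ.+-comm (t ℕ.∸ ∑ e) _)) ⟩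
        outside S ℕ.+ (labels S u ℕ.+ (sum e′ ℕ.+ (t ℕ.∸ ∑ e))) ≡⟨ cong (outside S ℕ.+_) (sym (ℕ.+-assoc (labels S u) _ _)) ⟩
        outside S ℕ.+ (labels S u ℕ.+ sum e′ ℕ.+ (t ℕ.∸ ∑ e)) ≡⟨ cong (λ a → outside S ℕ.+ (a ℕ.+ (t ℕ.∸ ∑ e))) (sym total) ⟩
        outside S ℕ.+ (∑ e ℕ.+ (t ℕ.∸ ∑ e))                   ≡⟨ cong (outside S ℕ.+_) (trans (ℕ.m+[n∸m]≡n ∑e≤t) (sym ∣S∣)) ⟩
        outside S ℕ.+ card S                                  ≡⟨ outside+card S ⟩
        k                                                     ∎

    Row : Set
    Row = Fin (length W)

    word : Row → Vec Symbol k
    word = List.lookup W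

    -- A row matches itself, so the number of words over its tuple is positive, whereas the counting
    -- formula gives 0 for a tuple that exceeds the capacity.
    row-remaining : ∀ r S → card S ≡ t → ∃ λ e′ → remaining S (lookup (word r)) cap ≡ just e′
    row-remaining r S ∣S∣ = go (remaining S u cap) refl
      where
      u = lookup (word r)
      positive : 0 < # (matches S u) W
      positive = ℕ.≤-<-trans z≤n (rank-bound (matches S u) W r (matches⁺ S u (word r) λ _ _ → refl))
      go : ∀ a → remaining S u cap ≡ a → ∃ λ e′ → a ≡ just e′
      go (just e′) _  = e′ , refl
      go nothing   eq = contradiction (trans (#-words S u τ cap)
        (trans (cong (λ a → v ℕ.^ (outside S ℕ.+ labels S u) ℕ.* value (iterate (outside S) τ) a) eq)
          (ℕ.*-zeroʳ (v ℕ.^ (outside S ℕ.+ labels S u))))) (ℕ.n>0⇒n≢0 positive)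

    -- The number of r, in list order, among the words that agree with it on S. There are v^k of
    -- these when S has t elements, so the reduction in `colourOf` then loses nothing.
    position : Row → Vec Bool k → ℕ
    position r S = rank (matches S (lookup (word r))) W r

    colourOf : Row → Vec Bool k → Fin (v ℕ.^ k)
    colourOf r S = position r S mod (v ℕ.^ k)

    toℕ-colour : ∀ r S → card S ≡ t → toℕ (colourOf r S) ≡ position r S
    toℕ-colour r S ∣S∣ = trans (Fin.toℕ-fromℕ< (m%n<n (position r S) (v ℕ.^ k))) (m<n⇒m%n≡m
      (subst (position r S <_) (#-matches S ∣S∣ (lookup (word r)) (proj₂ (row-remaining r S ∣S∣)))
        (rank-bound _ W r (matches⁺ S (lookup (word r)) (word r) λ _ _ → refl))))

  foldedArray : FoldedArray t k (v ℕ.^ k) class e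
  foldedArray = record
    { Row     = Row
    ; row     = lookup ∘ word
    ; colour  = colourOf
    ; bounded = λ r S ∣S∣ c → subst (labelCount S (class ∘ lookup (word r)) c ≤_) (lookup-cap c)
        (remaining-bounded S (lookup (word r)) cap (proj₂ (row-remaining r S ∣S∣)) c)
    ; covers  = λ S ∣S∣ u u≤e a →
        let e′ , eq = remaining-just S u cap (λ c → subst (labelCount S (class ∘ u) c ≤_) (sym (lookup-cap c)) (u≤e c))
            r , match , rank≡ = rank-exists (matches S u) W (toℕ a) (subst (toℕ a <_) (sym (#-matches S ∣S∣ u eq)) (Fin.toℕ<n a))
            agree = matches⁻ S u (word r) match
        in r , agree , Fin.toℕ-injective (trans (toℕ-colour r S ∣S∣) (trans (rank-cong (matches-cong S agree) W r) rank≡))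
    ; unique  = λ S ∣S∣ {r} {r′} agree eq → rank-injective (matches S (lookup (word r))) W r r′
        (matches⁺ S (lookup (word r)) (word r) λ _ _ → refl)
        (matches⁺ S (lookup (word r)) (word r′) λ i i∈S → sym (agree i i∈S))
        (trans (sym (toℕ-colour r S ∣S∣)) (trans (cong toℕ eq) (trans (toℕ-colour r′ S ∣S∣)
          (rank-cong (matches-cong S λ i i∈S → sym (agree i i∈S)) W r′)))) }

module _ (G : FiniteAbelianGroup) where
  open FiniteAbelianGroup G

  ∑ᴮ : (Vec Bool n → Carrier) → Carrier
  ∑ᴮ {zero}  F = F []
  ∑ᴮ {suc n} F = ∑ᴮ (F ∘ (false ∷_)) + ∑ᴮ (F ∘ (true ∷_))

  ∑ᴮ-cong : {F F′ : Vec Bool n → Carrier} → (∀ S → F S ≡ F′ S) → ∑ᴮ F ≡ ∑ᴮ F′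
  ∑ᴮ-cong {zero}  eq = eq []
  ∑ᴮ-cong {suc n} eq = cong₂ _+_ (∑ᴮ-cong (eq ∘ (false ∷_))) (∑ᴮ-cong (eq ∘ (true ∷_)))

  ∑ᴮ-zero : {F : Vec Bool n → Carrier} → (∀ S → F S ≡ 0#) → ∑ᴮ F ≡ 0#
  ∑ᴮ-zero {zero}  eq = eq []
  ∑ᴮ-zero {suc n} eq = trans (cong₂ _+_ (∑ᴮ-zero (eq ∘ (false ∷_))) (∑ᴮ-zero (eq ∘ (true ∷_)))) (identityˡ 0#)

  ∑ᴮ-single : {F : Vec Bool n → Carrier} → ∀ S → (∀ S′ → S ≢ S′ → F S′ ≡ 0#) → ∑ᴮ F ≡ F S
  ∑ᴮ-single []          eq = refl
  ∑ᴮ-single {F = F} (false ∷ S) eq = trans (cong₂ _+_ (∑ᴮ-single S λ S′ S≢ → eq (false ∷ S′) (S≢ ∘ ∷-injectiveʳ))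
    (∑ᴮ-zero λ S′ → eq (true ∷ S′) λ ())) (identityʳ _)
  ∑ᴮ-single {F = F} (true ∷ S) eq = trans (cong₂ _+_ (∑ᴮ-zero λ S′ → eq (false ∷ S′) λ ())
    (∑ᴮ-single S λ S′ S≢ → eq (true ∷ S′) (S≢ ∘ ∷-injectiveʳ))) (identityˡ _)

∑ᴮ-hom : (G H : FiniteAbelianGroup) (h : FiniteAbelianGroup.Carrier G → FiniteAbelianGroup.Carrier H) →
         (∀ x y → h (FiniteAbelianGroup._+_ G x y) ≡ FiniteAbelianGroup._+_ H (h x) (h y)) →
         (F : Vec Bool n → FiniteAbelianGroup.Carrier G) → ∑ᴮ H (h ∘ F) ≡ h (∑ᴮ G F)
∑ᴮ-hom {zero}  G H h h-+ F = refl
∑ᴮ-hom {suc n} G H h h-+ F = trans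
  (cong₂ (FiniteAbelianGroup._+_ H) (∑ᴮ-hom G H h h-+ (F ∘ (false ∷_))) (∑ᴮ-hom G H h h-+ (F ∘ (true ∷_))))
  (sym (h-+ _ _))

-- Codes with independently prescribed classes

module Kits (t k p : ℕ) where
  private
    module E = FiniteAbelianGroup (ℤ/ p)
    open E using (_+_; -_; _-_)

    Colour : Set
    Colour = Fin (suc p)

  -- A set of points such that every tuple x on S has a value θ S x, and such that for all
  -- parameters a and d there is an array covering exactly the tuples with θ S x = f a S + d,
  -- simultaneously for all S.
  record Kit (A : Set) (f : A → Vec Bool k → Colour) (size : ℕ) : Set₁ where
    field
      Point         : Set
      index         : Point → Fin size
      element       : Fin size → Point
      index-element : ∀ i → index (element i) ≡ i
      element-index : ∀ x → element (index x) ≡ x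
      θ             : Vec Bool k → (Fin k → Point) → Colour
      θ-cong        : ∀ S {x x′} → x ≈[ S ] x′ → θ S x ≡ θ S x′
      Row           : A → Colour → Set
      row           : ∀ {a d} → Row a d → Fin k → Point
      sound         : ∀ S → card S ≡ t → ∀ {a d} (r : Row a d) → θ S (row r) ≡ f a S + d
      covers        : ∀ S → card S ≡ t → ∀ a d x → θ S x ≡ f a S + d → ∃ λ (r : Row a d) → row r ≈[ S ] x
      unique        : ∀ S → card S ≡ t → ∀ {a d} {r r′ : Row a d} → row r ≈[ S ] row r′ → r ≡ r′

  reparametrise : {f : A → Vec Bool k → Colour} {f′ : B → Vec Bool k → Colour} (g : B → A) →
                  (∀ b S → f (g b) S ≡ f′ b S) → Kit A f m → Kit B f′ m
  reparametrise g f≡f′ κ = record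
    { Point = Point ; index = index ; element = element
    ; index-element = index-element ; element-index = element-index
    ; θ = θ ; θ-cong = θ-cong ; Row = Row ∘ g ; row = row
    ; sound = λ S ∣S∣ {b} {d} r → trans (sound S ∣S∣ r) (cong (_+ d) (f≡f′ b S))
    ; covers = λ S ∣S∣ b d x eq → covers S ∣S∣ (g b) d x (trans eq (cong (_+ d) (sym (f≡f′ b S))))
    ; unique = λ S ∣S∣ agree → unique S ∣S∣ agree }
    where open Kit κ

  -- Classes add if rows are paired so that their offsets b and d - b add up to d; the offset in a
  -- kit is there for this purpose. The classes of first components that agree on a t-set determine
  -- b, which gives uniqueness.
  _⊞_ : {f f′ : A → Vec Bool k → Colour} → Kit A f m → Kit A f′ n → Kit A (λ a S → f a S + f′ a S) (m ℕ.* n)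
  _⊞_ {A = A} {m = m} {n = n} {f = f} {f′} κ κ′ = record
    { Point = κ.Point × κ′.Point
    ; index = λ (x , y) → combine (κ.index x) (κ′.index y)
    ; element = λ i → κ.element (proj₁ (remQuot {m} n i)) , κ′.element (proj₂ (remQuot {m} n i))
    ; index-element = λ i → trans (cong₂ combine (κ.index-element _) (κ′.index-element _)) (Fin.combine-remQuot {m} n i)
    ; element-index = λ (x , y) → cong₂ _,_
        (trans (cong (κ.element ∘ proj₁) (Fin.remQuot-combine (κ.index x) (κ′.index y))) (κ.element-index x))
        (trans (cong (κ′.element ∘ proj₂) (Fin.remQuot-combine (κ.index x) (κ′.index y))) (κ′.element-index y))
    ; θ = λ S x → κ.θ S (proj₁ ∘ x) + κ′.θ S (proj₂ ∘ x)
    ; θ-cong = λ S agree → cong₂ _+_ (κ.θ-cong S λ i i∈S → cong proj₁ (agree i i∈S)) (κ′.θ-cong S λ i i∈S → cong proj₂ (agree i i∈S))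
    ; Row = λ a d → Σ Colour λ b → κ.Row a b × κ′.Row a (d - b)
    ; row = λ (b , r , r′) i → κ.row r i , κ′.row r′ i
    ; sound = λ S ∣S∣ {a} {d} (b , r , r′) → trans (cong₂ _+_ (κ.sound S ∣S∣ r) (κ′.sound S ∣S∣ r′)) (total (f a S) (f′ a S) b d)
    ; covers = λ S ∣S∣ a d x eq →
        let b = κ.θ S (proj₁ ∘ x) - f a S
            eq₁ = trans (sym (E.x-y+y≡x (κ.θ S (proj₁ ∘ x)) (f a S))) (E.comm b (f a S))
            r , agree = κ.covers S ∣S∣ a b (proj₁ ∘ x) eq₁
            r′ , agree′ = κ′.covers S ∣S∣ a (d - b) (proj₂ ∘ x) (E.∙-cancelˡ (κ.θ S (proj₁ ∘ x)) _ _
              (trans eq (sym (trans (cong (_+ (f′ a S + (d - b))) eq₁) (total (f a S) (f′ a S) b d)))))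
        in (b , r , r′) , λ i i∈S → cong₂ _,_ (agree i i∈S) (agree′ i i∈S)
    ; unique = unique′ }
    where
    module κ = Kit κ
    module κ′ = Kit κ′
    total : ∀ a a′ b d → (a + b) + (a′ + (d - b)) ≡ (a + a′) + d
    total a a′ b d = trans (E.interchange a b a′ (d - b))
      (cong ((a + a′) +_) (trans (E.comm b (d - b)) (E.x-y+y≡x d b)))
    unique′ : ∀ S → card S ≡ t → ∀ {a d} {r r′ : Σ Colour λ b → κ.Row a b × κ′.Row a (d - b)} →
              (λ i → κ.row (proj₁ (proj₂ r)) i , κ′.row (proj₂ (proj₂ r)) i) ≈[ S ]
              (λ i → κ.row (proj₁ (proj₂ r′)) i , κ′.row (proj₂ (proj₂ r′)) i) → r ≡ r′
    unique′ S ∣S∣ {a} {d} {b , r , r′} {c , s , s′} agree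
      with E.∙-cancelˡ (f a S) b c (trans (sym (κ.sound S ∣S∣ r))
             (trans (κ.θ-cong S λ i i∈S → cong proj₁ (agree i i∈S)) (κ.sound S ∣S∣ s)))
    ... | refl = cong₂ (λ x y → b , x , y) (κ.unique S ∣S∣ λ i i∈S → cong proj₁ (agree i i∈S))
                                           (κ′.unique S ∣S∣ λ i i∈S → cong proj₂ (agree i i∈S))

  sumKit : ∀ n (f : Vec Bool n → A → Vec Bool k → Colour) → (∀ S → Kit A (f S) m) →
           Kit A (λ a S → ∑ᴮ (ℤ/ p) (λ S′ → f S′ a S)) (m ℕ.^ (2 ℕ.^ n))
  sumKit {A = A} {m = m} zero f κ = subst (Kit A (f [])) (sym (ℕ.^-identityʳ m)) (κ [])
  sumKit {A = A} {m = m} (suc n) f κ = subst (Kit A _)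
    (trans (sym (ℕ.^-distribˡ-+-* m (2 ℕ.^ n) (2 ℕ.^ n))) (cong (λ a → m ℕ.^ (2 ℕ.^ n ℕ.+ a)) (sym (ℕ.+-identityʳ (2 ℕ.^ n)))))
    (sumKit n (f ∘ (false ∷_)) (κ ∘ (false ∷_)) ⊞ sumKit n (f ∘ (true ∷_)) (κ ∘ (true ∷_)))

  private
    -- Point zero is where the class is read off; the other 2k points form a pair for each column.
    module M = Tower (tower p (k ℕ.* 2))
  open M hiding (_+_; -_; _-_)
  open Polynomial module′

  φ-0 : φ 0# ≡ E.0#
  φ-0 = E.∙-cancelˡ (φ 0#) _ _ (trans (sym (φ-+ 0# 0#)) (trans (cong φ (identityˡ 0#)) (sym (E.identityʳ _))))

  -- The value at point zero of γ ∏ (z - y i) over i in S, the polynomial with leading coefficient γ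
  -- that vanishes on S.
  prod : Vec Bool n → (Fin n → Fin (suc (k ℕ.* 2))) → Carrier → Carrier
  prod []          y γ = γ
  prod (true  ∷ S) y γ = δ zero (y zero) (prod S (y ∘ suc) γ)
  prod (false ∷ S) y γ = prod S (y ∘ suc) γ

  -- Subtracting the interpolant with leading coefficient 0 from D leaves a polynomial with leading
  -- coefficient γ that vanishes on S, hence γ ∏ (z - y i).
  eval-leading : (S : Vec Bool n) (y : Fin n → Fin (suc (k ℕ.* 2))) (inj : ∀ {i j} → y i ≡ y j → i ≡ j) →
                 ∀ γ (D : Vec Carrier (card S)) x → (∀ i → lookup S i ≡ true → eval γ (y i) D ≡ x i) →
                 eval γ zero D ≡ eval 0# zero (interpolate 0# S y inj x) M.+ prod S y γ
  eval-leading []          y inj γ [] x eq = sym (identityˡ γ)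
  eval-leading (false ∷ S) y inj γ D x eq = eval-leading S (y ∘ suc) (Fin.suc-injective ∘ inj) γ D (x ∘ suc) (eq ∘ suc)
  eval-leading (true  ∷ S) y inj γ D x eq = begin
    eval γ zero D
      ≡⟨ trans (cong (eval γ zero) (sym (con-divide γ (y zero) D))) (eval-con γ zero (y zero) (eval γ (y zero) D) Q) ⟩
    eval γ (y zero) D M.+ δ zero (y zero) (eval γ zero Q)
      ≡⟨ cong₂ (λ a b → a M.+ δ zero (y zero) b) (eq zero refl)
          (eval-leading S (y ∘ suc) (Fin.suc-injective ∘ inj) γ Q (proj₁ ∘ slope 0# y inj x) slopes) ⟩
    x zero M.+ δ zero (y zero) (eval 0# zero Q₀ M.+ prod S (y ∘ suc) γ)
      ≡⟨ trans (cong (x zero M.+_) (δ-+ zero (y zero) (eval 0# zero Q₀) _)) (sym (assoc (x zero) _ _)) ⟩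
    (x zero M.+ δ zero (y zero) (eval 0# zero Q₀)) M.+ prod (true ∷ S) y γ
      ≡⟨ cong (M._+ prod (true ∷ S) y γ) (sym (eval-con 0# zero (y zero) (x zero) Q₀)) ⟩
    eval 0# zero (interpolate 0# (true ∷ S) y inj x) M.+ prod (true ∷ S) y γ ∎
    where
    open ≡-Reasoning
    Q = quotient γ (y zero) D
    Q₀ = interpolate 0# S (y ∘ suc) (Fin.suc-injective ∘ inj) (proj₁ ∘ slope 0# y inj x)
    slopes : ∀ i → lookup S i ≡ true → eval γ (y (suc i)) Q ≡ proj₁ (slope 0# y inj x i)
    slopes i i∈S = δ-injective {y (suc i)} {y zero} (Fin.0≢1+n ∘ sym ∘ inj) (∙-cancelˡ (x zero) _ _ (begin
      x zero M.+ δ (y (suc i)) (y zero) (eval γ (y (suc i)) Q)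
        ≡⟨ cong (M._+ δ (y (suc i)) (y zero) (eval γ (y (suc i)) Q)) (sym (eq zero refl)) ⟩
      eval γ (y zero) D M.+ δ (y (suc i)) (y zero) (eval γ (y (suc i)) Q)
        ≡⟨ trans (sym (eval-con γ (y (suc i)) (y zero) (eval γ (y zero) D) Q)) (cong (eval γ (y (suc i))) (con-divide γ (y zero) D)) ⟩
      eval γ (y (suc i)) D
        ≡⟨ eq (suc i) i∈S ⟩
      x (suc i)
        ≡⟨ sym (trans (comm (x zero) _) (x-y+y≡x (x (suc i)) (x zero))) ⟩
      x zero M.+ (x (suc i) M.- x zero)
        ≡⟨ cong (x zero M.+_) (sym (proj₂ (slope 0# y inj x i))) ⟩
      x zero M.+ δ (y (suc i)) (y zero) (proj₁ (slope 0# y inj x i)) ∎))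

  -- The class of a tuple is `φ` of the value at point zero of its interpolant with γ = 0. Passing
  -- to another γ shifts the class on S by - φ (prod S y γ): the leading coefficient controls the
  -- classes, though not yet independently for different S.
  polynomialKit : (y : Fin k → Fin (suc (k ℕ.* 2))) → (∀ {i j} → y i ≡ y j → i ≡ j) →
                  Kit Carrier (λ γ S → - φ (prod S y γ)) order
  polynomialKit y inj = record
    { Point = Carrier ; index = index ; element = element
    ; index-element = index-element ; element-index = element-index
    ; θ = θ
    ; θ-cong = θ-cong
    ; Row = λ γ d → Σ (Vec Carrier t) λ D → φ (eval γ zero D) ≡ d
    ; row = λ {γ} (D , _) i → eval γ (y i) D
    ; sound = λ { S refl {γ} {d} (D , eq) → trans (θ-row S γ D) (trans (cong (_- φ (prod S y γ)) eq) (E.comm d _)) }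
    ; covers = λ { S refl γ d x eq →
        let D = interpolate γ S y inj x
            agree = eval-interpolate γ S y inj x
        in (D , trans (sym (E.x-y+y≡x (φ (eval γ zero D)) (φ (prod S y γ))))
                 (trans (cong (_+ φ (prod S y γ)) (trans (sym (θ-row S γ D)) (trans (θ-cong S agree) (trans eq (E.comm (- φ (prod S y γ)) d)))))
                   (E.x-y+y≡x d (φ (prod S y γ))))) , agree }
    ; unique = λ { S refl {γ} {d} {D , eq} {D′ , eq′} agree → pair (interpolate-unique γ S y inj D D′ agree) } }
    where
    θ : Vec Bool k → (Fin k → Carrier) → Colour
    θ S x = φ (eval 0# zero (interpolate 0# S y inj x))
    θ-cong : ∀ S {x x′} → x ≈[ S ] x′ → θ S x ≡ θ S x′
    θ-cong S {x} {x′} agree = cong (φ ∘ eval 0# zero) (interpolate-unique 0# S y inj _ _ λ i i∈S →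
      trans (eval-interpolate 0# S y inj x i i∈S) (trans (agree i i∈S) (sym (eval-interpolate 0# S y inj x′ i i∈S))))
    θ-row : ∀ S γ (D : Vec Carrier (card S)) → θ S (λ i → eval γ (y i) D) ≡ φ (eval γ zero D) - φ (prod S y γ)
    θ-row S γ D = sym (trans (cong (λ a → a - φ (prod S y γ))
      (trans (cong φ (eval-leading S y inj γ D (λ i → eval γ (y i) D) λ _ _ → refl)) (φ-+ _ _)))
      (E.x+y-y≡x _ (φ (prod S y γ))))
    pair : ∀ {γ d} {D D′ : Vec Carrier t} {eq : φ (eval γ zero D) ≡ d} {eq′ : φ (eval γ zero D′) ≡ d} → D ≡ D′ → (D , eq) ≡ (D′ , eq′)
    pair refl = cong (_ ,_) (Decidable⇒UIP.≡-irrelevant Fin._≟_ _ _)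

  prod-δ : ∀ (S : Vec Bool n) y i j γ → prod S y (δ i j γ) ≡ δ i j (prod S y γ)
  prod-δ []          y i j γ = refl
  prod-δ (true  ∷ S) y i j γ = trans (cong (δ zero (y zero)) (prod-δ S (y ∘ suc) i j γ)) (δ-comm zero (y zero) i j _)
  prod-δ (false ∷ S) y i j γ = prod-δ S (y ∘ suc) i j γ

  prod-neg : ∀ (S : Vec Bool n) y γ → prod S y (M.- γ) ≡ M.- prod S y γ
  prod-neg []          y γ = refl
  prod-neg (true  ∷ S) y γ = trans (cong (δ zero (y zero)) (prod-neg S (y ∘ suc) γ)) (δ-neg zero (y zero) _)
  prod-neg (false ∷ S) y γ = prod-neg S (y ∘ suc) γ

  -- Each column j has two points pts j false and pts j true.  A suitable combination over all
  -- choices of the factor δ 0 (pts j b) (if j ∈ S) or 1 (if j ∉ S) vanishes unless S = S₀.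
  module Select where

    pick : (Fin n → Bool → Fin (suc (k ℕ.* 2))) → Vec Bool n → Fin n → Fin (suc (k ℕ.* 2))
    pick pts bs i = pts i (lookup bs i)

    weight : Vec Bool n → (Fin n → Bool → Fin (suc (k ℕ.* 2))) → Vec Bool n → Carrier → Carrier
    weight []           pts []           γ = γ
    weight (true  ∷ S₀) pts (false ∷ bs) γ = weight S₀ (pts ∘ suc) bs γ
    weight (true  ∷ S₀) pts (true  ∷ bs) γ = M.- weight S₀ (pts ∘ suc) bs γ
    weight (false ∷ S₀) pts (false ∷ bs) γ = δ zero (pts zero true) (weight S₀ (pts ∘ suc) bs γ)
    weight (false ∷ S₀) pts (true  ∷ bs) γ = M.- δ zero (pts zero false) (weight S₀ (pts ∘ suc) bs γ)

    select : Vec Bool n → Vec Bool n → (Fin n → Bool → Fin (suc (k ℕ.* 2))) → Carrier → Carrier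
    select []          []           pts γ = γ
    select (true  ∷ S) (true  ∷ S₀) pts γ = δ (pts zero true) (pts zero false) (select S S₀ (pts ∘ suc) γ)
    select (false ∷ S) (false ∷ S₀) pts γ = δ (pts zero false) (pts zero true) (select S S₀ (pts ∘ suc) γ)
    select (true  ∷ S) (false ∷ S₀) pts γ = 0#
    select (false ∷ S) (true  ∷ S₀) pts γ = 0#

    δ-δ : ∀ i j l x → δ i j x M.- δ i l x ≡ δ l j x
    δ-δ i j l x = begin
      (z i x M.- z j x) M.+ M.- (z i x M.- z l x)
        ≡⟨ cong ((z i x M.- z j x) M.+_) (trans (sym (⁻¹-∙-comm (z i x) (M.- z l x))) (cong (M.- z i x M.+_) (⁻¹-involutive (z l x)))) ⟩
      (z i x M.- z j x) M.+ (M.- z i x M.+ z l x)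
        ≡⟨ interchange (z i x) (M.- z j x) (M.- z i x) (z l x) ⟩
      (z i x M.- z i x) M.+ (M.- z j x M.+ z l x)
        ≡⟨ trans (cong (M._+ (M.- z j x M.+ z l x)) (inverseʳ (z i x))) (identityˡ _) ⟩
      M.- z j x M.+ z l x
        ≡⟨ comm (M.- z j x) (z l x) ⟩
      z l x M.- z j x ∎
      where open ≡-Reasoning

    -- For one column j write P_b for `δ zero (pts j b)`. If j ∈ S₀, the weights 1 and -1 give
    -- P_false - P_true for j ∈ S and 1 - 1 = 0 for j ∉ S. If j ∉ S₀, the weights P_true and
    -- -P_false give P_true - P_false for j ∉ S, and the two products cancel by commutativity for j
    -- ∈ S.
    ∑-weight : (S S₀ : Vec Bool n) (pts : Fin n → Bool → Fin (suc (k ℕ.* 2))) → ∀ γ →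
               ∑ᴮ group (λ bs → prod S (pick pts bs) (weight S₀ pts bs γ)) ≡ select S S₀ pts γ
    ∑-weight []          []           pts γ = refl
    ∑-weight (true ∷ S)  (true ∷ S₀)  pts γ = trans (cong₂ M._+_
      (trans (∑ᴮ-hom group group (δ zero y₀) (δ-+ zero y₀) R) (cong (δ zero y₀) ih))
      (trans (∑ᴮ-cong group λ bs → trans (cong (δ zero y₁) (prod-neg S (pick (pts ∘ suc) bs) _)) (δ-neg zero y₁ _))
        (trans (∑ᴮ-hom group group (λ x → M.- δ zero y₁ x) neg-δ-+ R) (cong (λ x → M.- δ zero y₁ x) ih))))
      (δ-δ zero y₀ y₁ _)
      where
      y₀ = pts zero false
      y₁ = pts zero true
      R = λ bs → prod S (pick (pts ∘ suc) bs) (weight S₀ (pts ∘ suc) bs γ)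
      ih = ∑-weight S S₀ (pts ∘ suc) γ
      neg-δ-+ : ∀ a b → M.- δ zero y₁ (a M.+ b) ≡ M.- δ zero y₁ a M.+ M.- δ zero y₁ b
      neg-δ-+ a b = trans (cong M.-_ (δ-+ zero y₁ a b)) (sym (⁻¹-∙-comm _ _))
    ∑-weight (false ∷ S) (false ∷ S₀) pts γ = trans (cong₂ M._+_
      (trans (∑ᴮ-cong group λ bs → prod-δ S (pick (pts ∘ suc) bs) zero y₁ _)
        (trans (∑ᴮ-hom group group (δ zero y₁) (δ-+ zero y₁) R) (cong (δ zero y₁) ih)))
      (trans (∑ᴮ-cong group λ bs → trans (prod-neg S (pick (pts ∘ suc) bs) _) (cong M.-_ (prod-δ S (pick (pts ∘ suc) bs) zero y₀ _)))
        (trans (∑ᴮ-hom group group (λ x → M.- δ zero y₀ x) neg-δ-+ R) (cong (λ x → M.- δ zero y₀ x) ih))))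
      (δ-δ zero y₁ y₀ _)
      where
      y₀ = pts zero false
      y₁ = pts zero true
      R = λ bs → prod S (pick (pts ∘ suc) bs) (weight S₀ (pts ∘ suc) bs γ)
      ih = ∑-weight S S₀ (pts ∘ suc) γ
      neg-δ-+ : ∀ a b → M.- δ zero y₀ (a M.+ b) ≡ M.- δ zero y₀ a M.+ M.- δ zero y₀ b
      neg-δ-+ a b = trans (cong M.-_ (δ-+ zero y₀ a b)) (sym (⁻¹-∙-comm _ _))
    ∑-weight (false ∷ S) (true ∷ S₀) pts γ = trans (cong (X M.+_)
      (trans (∑ᴮ-cong group λ bs → prod-neg S (pick (pts ∘ suc) bs) _)
        (∑ᴮ-hom group group M.-_ (λ a b → sym (⁻¹-∙-comm a b)) R))) (inverseʳ X)
      where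
      R = λ bs → prod S (pick (pts ∘ suc) bs) (weight S₀ (pts ∘ suc) bs γ)
      X = ∑ᴮ group R
    ∑-weight (true ∷ S) (false ∷ S₀) pts γ = trans (cong (X M.+_)
      (trans (∑ᴮ-cong group λ bs → begin
          δ zero y₁ (prod S (pick (pts ∘ suc) bs) (M.- δ zero y₀ (W bs)))
            ≡⟨ cong (δ zero y₁) (trans (prod-neg S (pick (pts ∘ suc) bs) _) (cong M.-_ (prod-δ S (pick (pts ∘ suc) bs) zero y₀ (W bs)))) ⟩
          δ zero y₁ (M.- δ zero y₀ (prod S (pick (pts ∘ suc) bs) (W bs)))
            ≡⟨ trans (δ-neg zero y₁ _) (cong M.-_ (δ-comm zero y₁ zero y₀ _)) ⟩
          M.- δ zero y₀ (δ zero y₁ (prod S (pick (pts ∘ suc) bs) (W bs)))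
            ≡⟨ cong (λ x → M.- δ zero y₀ x) (sym (prod-δ S (pick (pts ∘ suc) bs) zero y₁ (W bs))) ⟩
          M.- δ zero y₀ (prod S (pick (pts ∘ suc) bs) (δ zero y₁ (W bs))) ∎)
        (∑ᴮ-hom group group M.-_ (λ a b → sym (⁻¹-∙-comm a b)) Y))) (inverseʳ X)
      where
      open ≡-Reasoning
      y₀ = pts zero false
      y₁ = pts zero true
      W = λ bs → weight S₀ (pts ∘ suc) bs γ
      Y = λ bs → δ zero y₀ (prod S (pick (pts ∘ suc) bs) (δ zero y₁ (W bs)))
      X = ∑ᴮ group Y

    select-other : (S S₀ : Vec Bool n) (pts : Fin n → Bool → Fin (suc (k ℕ.* 2))) → ∀ γ → S₀ ≢ S → select S S₀ pts γ ≡ 0#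
    select-other []          []           pts γ neq = ⊥-elim (neq refl)
    select-other (true ∷ S)  (true ∷ S₀)  pts γ neq = trans (cong (δ _ _) (select-other S S₀ (pts ∘ suc) γ (neq ∘ cong (true ∷_)))) (δ-0 _ _)
    select-other (false ∷ S) (false ∷ S₀) pts γ neq = trans (cong (δ _ _) (select-other S S₀ (pts ∘ suc) γ (neq ∘ cong (false ∷_)))) (δ-0 _ _)
    select-other (true ∷ S)  (false ∷ S₀) pts γ neq = refl
    select-other (false ∷ S) (true ∷ S₀)  pts γ neq = refl

    select-self : (S : Vec Bool n) (pts : Fin n → Bool → Fin (suc (k ℕ.* 2))) → (∀ i → pts i false ≢ pts i true) →
                  ∀ x → ∃ λ γ → select S S pts γ ≡ x
    select-self []          pts distinct x = x , refl
    select-self (true ∷ S)  pts distinct x =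
      let x′ , eq = δ-surjective (distinct zero ∘ sym) x
          γ , eq′ = select-self S (pts ∘ suc) (distinct ∘ suc) x′
      in γ , trans (cong (δ _ _) eq′) eq
    select-self (false ∷ S) pts distinct x =
      let x′ , eq = δ-surjective (distinct zero) x
          γ , eq′ = select-self S (pts ∘ suc) (distinct ∘ suc) x′
      in γ , trans (cong (δ _ _) eq′) eq

  open Select

  bit : Bool → Fin 2
  bit false = zero
  bit true  = suc zero

  columnPoint : Fin k → Bool → Fin (suc (k ℕ.* 2))
  columnPoint i b = suc (combine i (bit b))

  columnPoint-distinct : ∀ i → columnPoint i false ≢ columnPoint i true
  columnPoint-distinct i eq = Fin.0≢1+n (Fin.combine-injectiveʳ i zero i (suc zero) (Fin.suc-injective eq))

  selectKit : ∀ S₀ → Kit Carrier (λ γ S → ∑ᴮ (ℤ/ p) (λ bs → - φ (prod S (pick columnPoint bs) (weight S₀ columnPoint bs γ)))) (order ℕ.^ (2 ℕ.^ k))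
  selectKit S₀ = sumKit k _ λ bs → reparametrise (weight S₀ columnPoint bs) (λ _ _ → refl)
    (polynomialKit (pick columnPoint bs) λ {i} {j} eq → Fin.combine-injectiveˡ i _ j _ (Fin.suc-injective eq))

  -- The summand for S₀ affects the class on S₀ alone, and its leading coefficient is solved for so
  -- as to give f S₀; `ι (- f S₀)` compensates the sign in `polynomialKit`. The two exponents 2^k
  -- come from the choices of points and from the sets S₀.
  fullKit : Kit (Vec Bool k → Colour) (λ f → f) ((order ℕ.^ (2 ℕ.^ k)) ℕ.^ (2 ℕ.^ k))
  fullKit = reparametrise id (λ f S → trans
      (∑ᴮ-single (ℤ/ p) S λ S₀ S≢S₀ → trans (selected f S S₀) (trans (cong (-_ ∘ φ) (select-other S S₀ columnPoint (γ f S₀) (S≢S₀ ∘ sym)))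
        (trans (cong -_ φ-0) E.ε⁻¹≈ε)))
      (trans (selected f S S) (trans (cong (-_ ∘ φ) (proj₂ (choice f S))) (trans (cong -_ (φ-ι _)) (E.⁻¹-involutive (f S))))))
    (sumKit k _ λ S₀ → reparametrise (λ f → γ f S₀) (λ _ _ → refl) (selectKit S₀))
    where
    choice : ∀ (f : Vec Bool k → Colour) S₀ → ∃ λ γ → select S₀ S₀ columnPoint γ ≡ ι (- f S₀)
    choice f S₀ = select-self S₀ columnPoint columnPoint-distinct (ι (- f S₀))
    γ : (Vec Bool k → Colour) → Vec Bool k → Carrier
    γ f S₀ = proj₁ (choice f S₀)
    selected : ∀ f S S₀ → ∑ᴮ (ℤ/ p) (λ bs → - φ (prod S (pick columnPoint bs) (weight S₀ columnPoint bs (γ f S₀)))) ≡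
                       - φ (select S S₀ columnPoint (γ f S₀))
    selected f S S₀ = trans (∑ᴮ-hom group (ℤ/ p) (-_ ∘ φ) (λ a b → trans (cong -_ (φ-+ a b)) (sym (E.⁻¹-∙-comm (φ a) (φ b))))
        (λ bs → prod S (pick columnPoint bs) (weight S₀ columnPoint bs (γ f S₀))))
      (cong (-_ ∘ φ) (∑-weight S S₀ columnPoint (γ f S₀)))

module _ (t k p : ℕ) where
  open Kits t k p using (Kit)

  -- Of the words covering a tuple on S, exactly one has the colour that the kit coordinates of
  -- the tuple prescribe, so exactly one row remains.
  lift : {v q : ℕ} {e : Fin l → ℕ} → FoldedArray t k (suc p) (Words.class v l) e →
         Kit (Vec Bool k → Fin (suc p)) id q →
         Array[ t , k ] (v ℕ.* q) (λ _ → q) e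
  lift {l = l} {v} {q} {e} W κ =
    relabel {class = Words.class v l ∘ proj₁} g h (λ s _ → class-g s) (λ s _ → hg s) (λ s _ → class-h s) (λ s _ → gh s) blownUp
    where
    module W = FoldedArray W
    module κ = Kit κ
    open FiniteAbelianGroup (ℤ/ p) using (0#; identityʳ)

    Sym : Set
    Sym = Words.Symbol v l × κ.Point

    Row : Set
    Row = Σ W.Row λ w → κ.Row (W.colour w) 0#

    row : Row → Fin k → Sym
    row (w , r) i = W.row w i , κ.row r i

    blownUp : TypedArray t k {Sym = Sym} (Words.class v l ∘ proj₁) e
    blownUp = record
      { Row = Row ; row = row
      ; bounded = λ (w , _) → W.bounded w
      ; covers = λ S ∣S∣ u u≤e →
          let w , agree , colour≡ = W.covers S ∣S∣ (proj₁ ∘ u) u≤e (κ.θ S (proj₂ ∘ u))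
              r , agree′ = κ.covers S ∣S∣ (W.colour w) 0# (proj₂ ∘ u) (trans (sym colour≡) (sym (identityʳ _)))
          in (w , r) , λ i i∈S → cong₂ _,_ (agree i i∈S) (agree′ i i∈S)
      ; unique = unique }
      where
      unique : ∀ S → card S ≡ t → ∀ {r r′} → row r ≈[ S ] row r′ → r ≡ r′
      unique S ∣S∣ {w , r} {w′ , r′} agree with W.unique S ∣S∣ (λ i i∈S → cong proj₁ (agree i i∈S))
        (trans (sym (trans (κ.sound S ∣S∣ r) (identityʳ _)))
          (trans (κ.θ-cong S λ i i∈S → cong proj₂ (agree i i∈S)) (trans (κ.sound S ∣S∣ r′) (identityʳ _))))
      ... | refl = cong (w ,_) (κ.unique S ∣S∣ λ i i∈S → cong proj₂ (agree i i∈S))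

    g : Sym → Symbols {l} (v ℕ.* q) (λ _ → q)
    g (inj₁ i , x) = inj₁ (combine i (κ.index x))
    g (inj₂ c , x) = inj₂ (c , κ.index x)

    h : Symbols {l} (v ℕ.* q) (λ _ → q) → Sym
    h (inj₁ i)       = inj₁ (proj₁ (remQuot {v} q i)) , κ.element (proj₂ (remQuot {v} q i))
    h (inj₂ (c , j)) = inj₂ c , κ.element j

    class-g : ∀ s → label {w = λ _ → q} (g s) ≡ Words.class v l (proj₁ s)
    class-g (inj₁ _ , _) = refl
    class-g (inj₂ _ , _) = refl

    class-h : ∀ s → Words.class v l (proj₁ (h s)) ≡ label s
    class-h (inj₁ _) = refl
    class-h (inj₂ _) = refl

    hg : ∀ s → h (g s) ≡ s
    hg (inj₁ i , x) = cong₂ (λ a b → inj₁ a , b) (cong proj₁ (Fin.remQuot-combine i (κ.index x)))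
      (trans (cong (κ.element ∘ proj₂) (Fin.remQuot-combine i (κ.index x))) (κ.element-index x))
    hg (inj₂ c , x) = cong (inj₂ c ,_) (κ.element-index x)

    gh : ∀ s → g (h s) ≡ s
    gh (inj₁ i) = cong inj₁ (trans (cong (combine (proj₁ (remQuot {v} q i))) (κ.index-element _)) (Fin.combine-remQuot {v} q i))
    gh (inj₂ (c , j)) = cong (λ r → inj₂ (c , r)) (κ.index-element j)

-- Combining the constructions

∏ : (Fin n → ℕ) → ℕ
∏ {zero}  f = 1
∏ {suc n} f = f zero ℕ.* ∏ (f ∘ suc)

∏>0 : {f : Fin n → ℕ} → (∀ i → 0 < f i) → 0 < ∏ f
∏>0 {zero}  f>0 = s≤s z≤n
∏>0 {suc n} f>0 = ℕ.*-mono-< (f>0 zero) (∏>0 (f>0 ∘ suc))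

∏-except : (f : Fin n → ℕ) → ∀ j → f j ℕ.* ∏ (λ i → if does (i Fin.≟ j) then 1 else f i) ≡ ∏ f
∏-except f zero    = cong (f zero ℕ.*_) (ℕ.*-identityˡ _)
∏-except f (suc j) = begin
  f (suc j) ℕ.* (f zero ℕ.* rest)   ≡⟨ ℕ.*-assoc (f (suc j)) (f zero) rest ⟨
  f (suc j) ℕ.* f zero ℕ.* rest     ≡⟨ cong (ℕ._* rest) (ℕ.*-comm (f (suc j)) (f zero)) ⟩
  f zero ℕ.* f (suc j) ℕ.* rest     ≡⟨ ℕ.*-assoc (f zero) (f (suc j)) rest ⟩
  f zero ℕ.* (f (suc j) ℕ.* rest)   ≡⟨ cong (f zero ℕ.*_) (∏-except (f ∘ suc) j) ⟩
  f zero ℕ.* ∏ (f ∘ suc)            ∎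
  where
  open ≡-Reasoning
  rest = ∏ (λ i → if does (i Fin.≟ j) then 1 else f (suc i))

0<q⇒0<q^ : ∀ {q} n → 0 < q → 0 < q ℕ.^ n
0<q⇒0<q^ {q} n q>0 = ℕ.m^n>0 q {{ℕ.>-nonZero q>0}} n

1<q⇒1<q^ : ∀ {q n} → 1 < q → 0 < n → 1 < q ℕ.^ n
1<q⇒1<q^ {q} {suc n} 1<q _ = ℕ.<-≤-trans 1<q (ℕ.m≤m*n q (q ℕ.^ n) {{ℕ.>-nonZero (0<q⇒0<q^ n (ℕ.<-trans (s≤s z≤n) 1<q))}})

-- Arrays for types that miss a kind.

module Ingredients (t′ k : ℕ) (t≤k : suc t′ ≤ k) where

  t : ℕ
  t = suc t′

  X : ℕ
  X = towerExponent (k ℕ.* 2)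

  X>0 : 0 < X
  X>0 = towerExponent>0 (k ℕ.* 2)

  record HasModule (a : ℕ) : Set₁ where
    constructor hasModule
    field
      pointed : PointedModule (k ℕ.+ t)
      order≡  : FiniteAbelianGroup.order (PointedModule.group pointed) ≡ a

  tower-module : ∀ q → 0 < q → HasModule (q ℕ.^ X)
  tower-module (suc p) _ = hasModule (restrict module′ (λ i → inject≤ i k+t≤) (λ {i} {j} → Fin.inject≤-injective k+t≤ k+t≤ i j)) order≡
    where
    open Tower (tower p (k ℕ.* 2))
    k+t≤ : k ℕ.+ t ≤ suc (k ℕ.* 2)
    k+t≤ = ℕ.≤-trans (ℕ.+-monoʳ-≤ k t≤k) (ℕ.≤-trans (ℕ.≤-reflexive (trans (cong (k ℕ.+_) (sym (ℕ.+-identityʳ k))) (ℕ.*-comm 2 k))) (ℕ.n≤1+n _))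

  extend : ∀ {a} → HasModule a → 1 < a → {w e : Fin l → ℕ} → (free : Fin l → Bool) → ∑ e ≤ t →
           (∀ e′ → (∀ c → e′ c ≤ e c) → Array[ t , k ] m w e′) →
           Array[ t , k ] (m ℕ.* a) (λ c → if free c then w c else w c ℕ.* a) e
  extend (hasModule M refl) 1<a {e = e} free ∑e≤t base =
    let γ , γ≢0 = FiniteAbelianGroup.nonzero (PointedModule.group M) 1<a
        p , p-injective = colouring e ∑e≤t
    in multiply M γ γ≢0 free p p-injective λ e′ e′≤e _ → base e′ e′≤e

  -- The words of the folded array have V q ordinary symbols, fold q of them cover each tuple,
  -- and the kit that separates these has R q points.
  fold V R : ℕ → ℕ
  fold q = (q ℕ.^ X) ℕ.^ k
  V q = q ℕ.^ X
  R q = ((fold q ℕ.^ X) ℕ.^ (2 ℕ.^ k)) ℕ.^ (2 ℕ.^ k)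

  base : ∀ q → suc k ℕ.* t ≤ q → (e : Fin l → ℕ) → ∑ e ≤ t → Array[ t , k ] (V q ℕ.* R q) (λ _ → R q) e
  base {l = l} q q-large e ∑e≤t = go (fold q) refl
    where
    q>0 : 0 < q
    q>0 = ℕ.≤-trans (s≤s z≤n) q-large
    instance
      q≢0 : NonZero q
      q≢0 = ℕ.>-nonZero q>0
      V≢0 : NonZero (V q)
      V≢0 = ℕ.m^n≢0 q X
    q≤V : q ≤ V q
    q≤V = ℕ.≤-trans (ℕ.≤-reflexive (sym (ℕ.^-identityʳ q))) (ℕ.^-monoʳ-≤ q X>0)
    go : ∀ a → fold q ≡ a → Array[ t , k ] (V q ℕ.* R q) (λ _ → R q) e
    go zero    eq = contradiction eq (ℕ.≢-nonZero⁻¹ (fold q) {{ℕ.m^n≢0 (V q) k}})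
    go (suc p) eq = subst (λ r → Array[ t , k ] (V q ℕ.* r) (λ _ → r) e)
      (cong (λ a → (a ℕ.^ (2 ℕ.^ k)) ℕ.^ (2 ℕ.^ k)) (trans (Tower.order≡ (tower p (k ℕ.* 2))) (cong (ℕ._^ X) (sym eq))))
      (lift t k p (subst (λ a → FoldedArray t k a (Words.class (V q) l) e) eq
              (foldedArray (V q) t k (ℕ.≤-trans q-large q≤V) e ∑e≤t))
            (Kits.fullKit t k p))

  -- Being an Xth power, R q is itself the order of a tower module, so a factor that the kit
  -- supplies for one kind can be supplied by polynomials for the others. `V q` is taken as q^X for
  -- the same reason.
  R-power : ∀ q → ∃ λ Y → R q ≡ (q ℕ.^ Y) ℕ.^ X
  R-power q = (k ℕ.* (2 ℕ.^ k ℕ.* 2 ℕ.^ k)) ℕ.* X , (begin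
    (((V q ℕ.^ k) ℕ.^ X) ℕ.^ (2 ℕ.^ k)) ℕ.^ (2 ℕ.^ k) ≡⟨ ℕ.^-*-assoc ((V q ℕ.^ k) ℕ.^ X) (2 ℕ.^ k) (2 ℕ.^ k) ⟩
    ((V q ℕ.^ k) ℕ.^ X) ℕ.^ (2 ℕ.^ k ℕ.* 2 ℕ.^ k)     ≡⟨ cong (ℕ._^ (2 ℕ.^ k ℕ.* 2 ℕ.^ k)) (ℕ.^-*-assoc (V q) k X) ⟩
    (V q ℕ.^ (k ℕ.* X)) ℕ.^ Z                         ≡⟨ ℕ.^-*-assoc (V q) (k ℕ.* X) Z ⟩
    V q ℕ.^ (k ℕ.* X ℕ.* Z)                           ≡⟨ ℕ.^-*-assoc q X (k ℕ.* X ℕ.* Z) ⟩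
    q ℕ.^ (X ℕ.* (k ℕ.* X ℕ.* Z))                     ≡⟨ cong (q ℕ.^_) arith ⟩
    q ℕ.^ (k ℕ.* Z ℕ.* X ℕ.* X)                       ≡⟨ ℕ.^-*-assoc q (k ℕ.* Z ℕ.* X) X ⟨
    (q ℕ.^ (k ℕ.* Z ℕ.* X)) ℕ.^ X                     ∎)
    where
    open ≡-Reasoning
    Z = 2 ℕ.^ k ℕ.* 2 ℕ.^ k
    arith : X ℕ.* (k ℕ.* X ℕ.* Z) ≡ k ℕ.* Z ℕ.* X ℕ.* X
    arith = trans (ℕ.*-comm X _) (cong (ℕ._* X) (trans (ℕ.*-assoc k X Z)
      (trans (cong (k ℕ.*_) (ℕ.*-comm X Z)) (sym (ℕ.*-assoc k Z X)))))

  R-module : ∀ q → 0 < q → HasModule (R q)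
  R-module q q>0 = let Y , eq = R-power q in subst HasModule (sym eq) (tower-module (q ℕ.^ Y) (0<q⇒0<q^ Y q>0))

  1<R : ∀ {q} → 1 < q → 1 < R q
  1<R {q} 1<q = 1<q⇒1<q^ (1<q⇒1<q^ (1<q⇒1<q^ (1<q⇒1<q^ (1<q⇒1<q^ 1<q X>0) (ℕ.<-≤-trans (s≤s z≤n) t≤k)) X>0) (0<q⇒0<q^ k (s≤s z≤n))) (0<q⇒0<q^ k (s≤s z≤n))

  module _ {s : ℕ} (q : Fin s → ℕ) (q-large : ∀ i → suc k ℕ.* t ≤ q i) (1<q : ∀ i → 1 < q i)
           (kind : Fin l → Fin s) where

    private
      v r : Fin s → ℕ
      v = V ∘ q
      r = R ∘ q

      v>0 : ∀ i → 0 < v i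
      v>0 i = 0<q⇒0<q^ X (ℕ.<-trans (s≤s z≤n) (1<q i))
      r>1 : ∀ i → 1 < r i
      r>1 i = 1<R (1<q i)
      r>0 : ∀ i → 0 < r i
      r>0 i = ℕ.<-trans (s≤s z≤n) (r>1 i)

    weight : Fin s → ℕ
    weight j = ∏ (λ i → if does (j Fin.≟ i) then 1 else r i)

    module _ (j : Fin s) where

      Misses : (Fin l → ℕ) → Set
      Misses e = ∑ e ≤ t × (∀ c → kind c ≡ j → e c ≡ 0)

      Misses-≤ : ∀ {e e′} → (∀ c → e′ c ≤ e c) → Misses e → Misses e′
      Misses-≤ e′≤e (∑≤t , absent) = ℕ.≤-trans (∑-mono e′≤e) ∑≤t ,
        λ c kc≡j → ℕ.n≤0⇒n≡0 (ℕ.≤-trans (e′≤e c) (ℕ.≤-reflexive (absent c kc≡j)))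

      private
        a : Fin s → ℕ
        a i = if does (i Fin.≟ j) then 1 else v i ℕ.* r i

        b : Fin l → Fin s → ℕ
        b c i = if does (i Fin.≟ j) then 1 else (if does (kind c Fin.≟ i) then 1 else r i)

        a>0 : ∀ i → 0 < a i
        a>0 i with i Fin.≟ j
        ... | yes _ = s≤s z≤n
        ... | no _  = ℕ.*-mono-< (v>0 i) (r>0 i)

        -- Two extensions: one of order v i in which all labels are free, so that only the ordinary
        -- symbols are multiplied, and one of order r i in which just the labels of kind i are free,
        -- so that all other weights gain the factor r i.
        step : ∀ {w : Fin l → ℕ} i → 0 < m → (∀ e → Misses e → Array[ t , k ] m w e) →
               ∀ e → Misses e → Array[ t , k ] (m ℕ.* a i) (λ c → w c ℕ.* b c i) e
        step {m = m} {w = w} i m>0 A e ok with i Fin.≟ j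
        ... | yes _ = resize m>0 (ℕ.*-mono-< m>0 (s≤s z≤n)) (sym (ℕ.*-identityʳ m)) (λ c _ → sym (ℕ.*-identityʳ (w c))) (A e ok)
        ... | no _  = resize (ℕ.*-mono-< (ℕ.*-mono-< m>0 (v>0 i)) (r>0 i)) (ℕ.*-mono-< m>0 (ℕ.*-mono-< (v>0 i) (r>0 i)))
          (ℕ.*-assoc m (v i) (r i)) (λ c _ → weights c)
          (extend (R-module (q i) (ℕ.<-trans (s≤s z≤n) (1<q i))) (r>1 i) (λ c → does (kind c Fin.≟ i)) (proj₁ ok) λ e′ e′≤e →
            extend (tower-module (q i) (ℕ.<-trans (s≤s z≤n) (1<q i))) (1<q⇒1<q^ (1<q i) X>0) (λ _ → true) (proj₁ (Misses-≤ e′≤e ok)) λ e″ e″≤e′ →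
              A e″ (Misses-≤ e″≤e′ (Misses-≤ e′≤e ok)))
          where
          weights : ∀ c → (if does (kind c Fin.≟ i) then w c else w c ℕ.* r i) ≡ w c ℕ.* (if does (kind c Fin.≟ i) then 1 else r i)
          weights c with kind c Fin.≟ i
          ... | yes _ = sym (ℕ.*-identityʳ (w c))
          ... | no _  = refl

        steps : ∀ n (f : Fin n → Fin s) {m} {w : Fin l → ℕ} → 0 < m → (∀ e → Misses e → Array[ t , k ] m w e) →
                ∀ e → Misses e → Array[ t , k ] (m ℕ.* ∏ (a ∘ f)) (λ c → w c ℕ.* ∏ (b c ∘ f)) e
        steps zero    f {m} {w} m>0 A e ok = resize m>0 (ℕ.*-mono-< m>0 (s≤s z≤n)) (sym (ℕ.*-identityʳ m)) (λ c _ → sym (ℕ.*-identityʳ (w c))) (A e ok)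
        steps (suc n) f {m} {w} m>0 A e ok = resize
          (ℕ.*-mono-< (ℕ.*-mono-< m>0 (a>0 (f zero))) (∏>0 (a>0 ∘ f ∘ suc)))
          (ℕ.*-mono-< m>0 (∏>0 (a>0 ∘ f)))
          (ℕ.*-assoc m (a (f zero)) _) (λ c _ → ℕ.*-assoc (w c) (b c (f zero)) _)
          (steps n (f ∘ suc) (ℕ.*-mono-< m>0 (a>0 (f zero))) (step (f zero) m>0 A) e ok)

      -- The base array for j gives every label the weight r j, and the step for i ≠ j contributes r
      -- i unless i is the kind of the label. Live labels are not of kind j, so their weights come
      -- out as prescribed. Neither these weights nor the number of ordinary symbols depend on j,
      -- which lets arrays missing different kinds be used together.
      missing : ∀ e → Misses e → Array[ t , k ] (∏ (λ i → v i ℕ.* r i)) (weight ∘ kind) e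
      missing e ok = resize (ℕ.*-mono-< vr>0 (∏>0 a>0)) (∏>0 λ i → ℕ.*-mono-< (v>0 i) (r>0 i))
        (∏-except (λ i → v i ℕ.* r i) j) weights
        (steps s id vr>0 (λ e′ ok′ → base (q j) (q-large j) e′ (proj₁ ok′)) e ok)
        where
        vr>0 : 0 < v j ℕ.* r j
        vr>0 = ℕ.*-mono-< (v>0 j) (r>0 j)
        weights : ∀ c → 0 < e c → r j ℕ.* ∏ (b c) ≡ weight (kind c)
        weights c 0<ec = trans (cong (ℕ._* ∏ (b c)) (sym (if-no (kind c Fin.≟ j) λ kc≡j → ℕ.n>0⇒n≢0 0<ec (proj₂ ok c kc≡j))))
          (∏-except (λ i → if does (kind c Fin.≟ i) then 1 else r i) j)

open +-*-Solver using (solve; con; _:+_; _:*_; _:=_)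

-- Choosing the labels

weigh : (Fin n → ℕ) → List (Fin n) → ℕ
weigh w []       = 0
weigh w (i ∷ is) = w i ℕ.+ weigh w is

weigh-++ : (w : Fin n → ℕ) → ∀ is js → weigh w (is ++ js) ≡ weigh w is ℕ.+ weigh w js
weigh-++ w []       js = refl
weigh-++ w (i ∷ is) js = trans (cong (w i ℕ.+_) (weigh-++ w is js)) (sym (ℕ.+-assoc (w i) _ _))

weigh-replicate : (w : Fin n → ℕ) → ∀ a i → weigh w (List.replicate a i) ≡ a ℕ.* w i
weigh-replicate w zero    i = refl
weigh-replicate w (suc a) i = cong (w i ℕ.+_) (weigh-replicate w a i)

weigh-map-suc : (w : Fin (suc n) → ℕ) (w′ : Fin n → ℕ) → ∀ b → (∀ i → w (suc i) ≡ b ℕ.* w′ i) →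
                ∀ is → weigh w (List.map suc is) ≡ b ℕ.* weigh w′ is
weigh-map-suc w w′ b eq []       = sym (ℕ.*-zeroʳ b)
weigh-map-suc w w′ b eq (i ∷ is) = trans (cong₂ ℕ._+_ (eq i) (weigh-map-suc w w′ b eq is)) (sym (ℕ.*-distribˡ-+ b (w′ i) _))

∑-lookup : (w : Fin n → ℕ) → ∀ is → ∑ (w ∘ List.lookup is) ≡ weigh w is
∑-lookup w []       = refl
∑-lookup w (i ∷ is) = cong (w i ℕ.+_) (∑-lookup w is)

repeat : ℕ → List (Fin n) → List (Fin n)
repeat zero    is = []
repeat (suc a) is = is ++ repeat a is

weigh-repeat : (w : Fin n → ℕ) → ∀ a is → weigh w (repeat a is) ≡ a ℕ.* weigh w is
weigh-repeat w zero    is = refl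
weigh-repeat w (suc a) is = trans (weigh-++ w is (repeat a is)) (cong (weigh w is ℕ.+_) (weigh-repeat w a is))

length-repeat : ∀ a (is : List (Fin n)) → length (repeat a is) ≡ a ℕ.* length is
length-repeat zero    is = refl
length-repeat (suc a) is = trans (length-++ is) (cong (length is ℕ.+_) (length-repeat a is))

cofactor : (Fin n → ℕ) → Fin n → ℕ
cofactor r j = ∏ (λ i → if does (j Fin.≟ i) then 1 else r i)

_≡1mod_ : ℕ → ℕ → Set
a ≡1mod b = ∃ λ y → a ≡ 1 ℕ.+ y ℕ.* b

≡1mod-^ : ∀ {a b} n → a ≡1mod b → (a ℕ.^ n) ≡1mod b
≡1mod-^ zero    _        = 0 , refl
≡1mod-^ {a} {b} (suc n) (y , eq) with ≡1mod-^ n (y , eq)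
... | y′ , eq′ = y ℕ.+ (1 ℕ.+ y ℕ.* b) ℕ.* y′ , trans (cong₂ ℕ._*_ eq eq′)
  (solve 3 (λ y y′ b → (con 1 :+ y :* b) :* (con 1 :+ y′ :* b) := con 1 :+ (y :+ (con 1 :+ y :* b) :* y′) :* b) refl y y′ b)

-- A form of pairwise coprimality that survives the power map q ↦ R q and has Bézout coefficients
-- built in.
Chain : (Fin n → ℕ) → Set
Chain {zero}  r = ⊤
Chain {suc n} r = r zero ≡1mod ∏ (r ∘ suc) × Chain (r ∘ suc)

-- Bézout without subtraction: for r₀ = 1 + y P one wants r₀ - y P = 1, and modulo M + 1 the
-- coefficient - y may be replaced by y M. Here P is the cofactor of index zero, and the other
-- cofactors are r₀ times those of the shorter chain.
cofactors-generate : ∀ n (r : Fin (suc n) → ℕ) → Chain r → ∀ M → ∃ λ is → weigh (cofactor r) is ≡1mod suc M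
cofactors-generate zero    r _ M = zero ∷ [] , 0 , refl
cofactors-generate (suc n) r ((y , r₀≡) , chain) M with cofactors-generate n (r ∘ suc) chain M
... | is , x , eq = List.map suc is ++ List.replicate (y ℕ.* M) zero , r zero ℕ.* x ℕ.+ y ℕ.* P , (begin
  weigh (cofactor r) (List.map suc is ++ List.replicate (y ℕ.* M) zero)
    ≡⟨ weigh-++ (cofactor r) (List.map suc is) _ ⟩
  weigh (cofactor r) (List.map suc is) ℕ.+ weigh (cofactor r) (List.replicate (y ℕ.* M) zero)
    ≡⟨ cong₂ ℕ._+_ (trans (weigh-map-suc (cofactor r) (cofactor (r ∘ suc)) (r zero) (λ _ → refl) is) (cong (r zero ℕ.*_) eq))
        (trans (weigh-replicate (cofactor r) (y ℕ.* M) zero) (cong (y ℕ.* M ℕ.*_) (ℕ.*-identityˡ P))) ⟩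
  r zero ℕ.* (1 ℕ.+ x ℕ.* suc M) ℕ.+ y ℕ.* M ℕ.* P
    ≡⟨ cong (λ a → a ℕ.* (1 ℕ.+ x ℕ.* suc M) ℕ.+ y ℕ.* M ℕ.* P) r₀≡ ⟩
  (1 ℕ.+ y ℕ.* P) ℕ.* (1 ℕ.+ x ℕ.* suc M) ℕ.+ y ℕ.* M ℕ.* P
    ≡⟨ solve 4 (λ y P x M → (con 1 :+ y :* P) :* (con 1 :+ x :* (con 1 :+ M)) :+ y :* M :* P :=
                            con 1 :+ ((con 1 :+ y :* P) :* x :+ y :* P) :* (con 1 :+ M)) refl y P x M ⟩
  1 ℕ.+ ((1 ℕ.+ y ℕ.* P) ℕ.* x ℕ.+ y ℕ.* P) ℕ.* suc M
    ≡⟨ cong (λ a → 1 ℕ.+ (a ℕ.* x ℕ.+ y ℕ.* P) ℕ.* suc M) (sym r₀≡) ⟩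
  1 ℕ.+ (r zero ℕ.* x ℕ.+ y ℕ.* P) ℕ.* suc M ∎)
  where
  open ≡-Reasoning
  P = ∏ (r ∘ suc)

chain-exists : (R : ℕ → ℕ) → (∀ {q b} → q ≡1mod b → R q ≡1mod b) → (∀ {q} → 1 < q → 0 < R q) → ∀ c n →
               ∃ λ (q : Fin n → ℕ) → (∀ i → c ≤ q i) × (∀ i → 1 < q i) × Chain (R ∘ q)
chain-exists R R-1 R>0 c zero    = (λ ()) , (λ ()) , (λ ()) , tt
chain-exists R R-1 R>0 c (suc n) with chain-exists R R-1 R>0 c n
... | q , c≤q , 1<q , chain =
  (λ { zero → new ; (suc i) → q i }) ,
  (λ { zero → ℕ.≤-trans (ℕ.n≤1+n c) (ℕ.≤-trans (ℕ.m≤m*n (suc c) P) (ℕ.n≤1+n _)) ; (suc i) → c≤q i }) ,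
  (λ { zero → s≤s (ℕ.≤-trans (s≤s z≤n) (ℕ.m≤m*n (suc c) P)) ; (suc i) → 1<q i }) ,
  R-1 (suc c , refl) , chain
  where
  P = ∏ (R ∘ q)
  -- Congruent to 1 modulo P, as `R-1` requires, and at least c; the factor `suc c` instead of c
  -- also makes it exceed 1.
  new = 1 ℕ.+ suc c ℕ.* P
  instance
    P≢0 : NonZero P
    P≢0 = ℕ.>-nonZero (∏>0 (R>0 ∘ 1<q))

stripPower : ∀ q r → 1 < q → 0 < r → ∃ λ e → ∃ λ r′ → r ≡ q ℕ.^ e ℕ.* r′ × ¬ q ∣ r′ × 0 < r′
stripPower q r 1<q 0<r = go r r ℕ.≤-refl 0<r
  where
  go : ∀ fuel r → r ≤ fuel → 0 < r → ∃ λ e → ∃ λ r′ → r ≡ q ℕ.^ e ℕ.* r′ × ¬ q ∣ r′ × 0 < r′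
  go zero r r≤0 0<r = contradiction (ℕ.≤-trans 0<r r≤0) λ ()
  go (suc fuel) r r≤ 0<r with q ∣? r
  ... | no q∤r = 0 , r , sym (ℕ.*-identityˡ r) , q∤r , 0<r
  ... | yes (divides r₁ refl) with go fuel r₁ (ℕ.≤-pred (ℕ.≤-trans r₁<r r≤)) 0<r₁
    where
    0<r₁ : 0 < r₁
    0<r₁ = ℕ.n≢0⇒n>0 λ { refl → contradiction 0<r λ () }
    r₁<r : r₁ < r₁ ℕ.* q
    r₁<r = ℕ.m<m*n r₁ q {{ℕ.>-nonZero 0<r₁}} 1<q
  ... | e , r′ , eq , q∤r′ , 0<r′ = suc e , r′ ,
    trans (cong (ℕ._* q) eq) (solve 3 (λ a b c → a :* b :* c := c :* a :* b) refl (q ℕ.^ e) r′ q) , q∤r′ , 0<r′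

-- The factors 2, ..., d, prime or not, are stripped in turn. Either one of them occurs to the power
-- E, or what is stripped is at most B, the product of the q^E. A common divisor of the rest with
-- some i ≤ d is itself at most d, and so was stripped or is 1.
largeDivisor : ∀ E d → ∃ λ B → ∀ b → 0 < b →
               (∃ λ q → 1 < q × q ℕ.^ E ∣ b) ⊎
               (∃ λ r → r ∣ b × b ≤ r ℕ.* B × 0 < r × (∀ i → 0 < i → i ≤ d → Coprime r i))
largeDivisor E zero    = 1 , λ b 0<b → inj₂ (b , ∣-refl , ℕ.≤-reflexive (sym (ℕ.*-identityʳ b)) , 0<b , λ i 0<i i≤0 → contradiction (ℕ.≤-trans 0<i i≤0) λ ())
largeDivisor E (suc d) with largeDivisor E d
... | B , IH = suc d ℕ.^ E ℕ.* B , extend′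
  where
  extend′ : ∀ b → 0 < b →
            (∃ λ q → 1 < q × q ℕ.^ E ∣ b) ⊎
            (∃ λ r → r ∣ b × b ≤ r ℕ.* (suc d ℕ.^ E ℕ.* B) × 0 < r × (∀ i → 0 < i → i ≤ suc d → Coprime r i))
  extend′ b 0<b with IH b 0<b
  ... | inj₁ power = inj₁ power
  ... | inj₂ (r , r∣b , b≤ , 0<r , coprime) with 1 ℕ.<? suc d
  ... | no d≡0 = inj₂ (r , r∣b , ℕ.≤-trans b≤ (ℕ.*-monoʳ-≤ r (ℕ.m≤n*m B (suc d ℕ.^ E) {{ℕ.m^n≢0 (suc d) E}})) , 0<r ,
          λ i 0<i i≤ (a∣r , a∣i) → ∣1⇒≡1 (subst (_ ∣_) (ℕ.≤-antisym (ℕ.≤-trans i≤ (ℕ.≮⇒≥ d≡0)) 0<i) a∣i))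
  ... | yes 1<q with stripPower (suc d) r 1<q 0<r
  ... | e , r′ , eq , q∤r′ , 0<r′ with E ℕ.≤? e
  ... | yes E≤e = inj₁ (suc d , 1<q , ∣-trans (∣-trans (m≤n⇒m^∣n^ E≤e) (divides r′ (trans eq (ℕ.*-comm _ r′)))) r∣b)
    where
    m≤n⇒m^∣n^ : ∀ {m n} → m ≤ n → suc d ℕ.^ m ∣ suc d ℕ.^ n
    m≤n⇒m^∣n^ {m} {n} m≤n = divides (suc d ℕ.^ (n ℕ.∸ m)) (trans (cong (suc d ℕ.^_) (sym (ℕ.m∸n+n≡m m≤n))) (ℕ.^-distribˡ-+-* (suc d) (n ℕ.∸ m) m))
  ... | no E≰e = inj₂ (r′ , ∣-trans r′∣r r∣b , bound , 0<r′ , coprime′)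
    where
    r′∣r : r′ ∣ r
    r′∣r = divides (suc d ℕ.^ e) eq
    bound : b ≤ r′ ℕ.* (suc d ℕ.^ E ℕ.* B)
    bound = ℕ.≤-trans b≤ (ℕ.≤-trans (ℕ.≤-reflexive (trans (cong (ℕ._* B) eq) (solve 3 (λ a b c → a :* b :* c := b :* (a :* c)) refl (suc d ℕ.^ e) r′ B)))
      (ℕ.*-monoʳ-≤ r′ (ℕ.*-monoˡ-≤ B (ℕ.^-monoʳ-≤ (suc d) (ℕ.<⇒≤ (ℕ.≰⇒> E≰e))))))
    coprime′ : ∀ i → 0 < i → i ≤ suc d → Coprime r′ i
    coprime′ i 0<i i≤ {zero}  (a∣r′ , a∣i) = contradiction (0∣⇒≡0 a∣i) (ℕ.n>0⇒n≢0 0<i)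
    coprime′ i 0<i i≤ {suc a} (a∣r′ , a∣i) with suc a ℕ.≤? d
    ... | yes a≤d = coprime (suc a) (s≤s z≤n) a≤d (∣-trans a∣r′ r′∣r , ∣-refl)
    ... | no a≰d = ⊥-elim (q∤r′ (subst (_∣ r′) (ℕ.≤-antisym (ℕ.≤-trans (∣⇒≤ {{ℕ.>-nonZero 0<i}} a∣i) i≤) (ℕ.≰⇒> a≰d)) a∣r′))

∣!  : ∀ {d n} → 0 < d → d ≤ n → d ∣ n !
∣! {suc d} _ d≤n = ∣-trans (m∣m*n (d !)) (m≤n⇒m!∣n! d≤n)

module Assembly (t k M s : ℕ) (M>0 : 0 < M) (w : Fin s → ℕ)
                (generate : ∀ Q → ∃ λ is → weigh w is ≡1mod suc Q)
                (unrestricted : ∀ {l} (kind : Fin l → Fin s) b → 0 < b → (∀ d → 0 < d → d < k ℕ.+ t → Coprime b d) →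
                   (N : PointedModule (k ℕ.+ l)) → 1 < FiniteAbelianGroup.order (PointedModule.group N) →
                   Array[ t , k ] (M ℕ.* b ℕ.* FiniteAbelianGroup.order (PointedModule.group N)) (w ∘ kind) (λ _ → t)) where

  typedArray-exists : ∃ λ n₀ → ∀ n → n₀ ≤ n → ∃ λ m → ∃ λ l → ∃ λ (u : Fin l → ℕ) →
                      m ℕ.+ ∑ u ≡ n × Array[ t , k ] m u (λ _ → t)
  typedArray-exists = n₀ , construct
    where
    H = (k ℕ.+ t) !
    -- The labels absorb the residue of n - M modulo M H; the remaining multiple of M H is what
    -- makes b congruent to 1 modulo H.
    Q = M ℕ.* H

    instance
      Q≢0 : NonZero Q
      Q≢0 = ℕ.>-nonZero (ℕ.*-mono-< M>0 (ℕ.>-nonZero⁻¹ H {{(k ℕ.+ t) ℕ.!≢0}}))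
      M≢0 : NonZero M
      M≢0 = ℕ.>-nonZero M>0

    generator = generate (pred Q)
    is = proj₁ generator
    x = proj₁ (proj₂ generator)

    weigh-is : weigh w is ≡ 1 ℕ.+ x ℕ.* Q
    weigh-is = trans (proj₂ (proj₂ generator)) (cong (λ a → 1 ℕ.+ x ℕ.* a) (ℕ.suc-pred Q))

    -- Fewer than Q copies of `is` are used, so this bounds the points needed for columns and labels
    -- independently of n.
    K = k ℕ.+ Q ℕ.* length is
    E = towerExponent K
    Bmax = proj₁ (largeDivisor E K)
    Smax = Q ℕ.* (1 ℕ.+ x ℕ.* Q)
    -- `Smax` bounds the total weight of the labels. With the other two terms, n - M is at least
    -- that weight and b exceeds `Bmax`.
    n₀ = M ℕ.+ Smax ℕ.+ M ℕ.* suc Bmax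

    module _ (n : ℕ) (n₀≤n : n₀ ≤ n) where
      ρ = (n ℕ.∸ M) % Q
      κ = (n ℕ.∸ M) / Q

      ks = repeat ρ is
      ℓ = length ks

      sum-ks : weigh w ks ≡ ρ ℕ.* (1 ℕ.+ x ℕ.* Q)
      sum-ks = trans (weigh-repeat w ρ is) (cong (ρ ℕ.*_) weigh-is)

      sum≤ : ρ ℕ.* (1 ℕ.+ x ℕ.* Q) ≤ Smax
      sum≤ = ℕ.*-monoˡ-≤ (1 ℕ.+ x ℕ.* Q) (ℕ.<⇒≤ (m%n<n (n ℕ.∸ M) Q))

      M+Smax≤n : M ℕ.+ Smax ≤ n
      M+Smax≤n = ℕ.≤-trans (ℕ.m≤m+n (M ℕ.+ Smax) _) n₀≤n

      n∸M≡ : n ℕ.∸ M ≡ ρ ℕ.+ κ ℕ.* Q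
      n∸M≡ = m≡m%n+[m/n]*n (n ℕ.∸ M) Q

      ρx≤κ : ρ ℕ.* x ≤ κ
      ρx≤κ = ℕ.*-cancelʳ-≤ (ρ ℕ.* x) κ Q (ℕ.+-cancelˡ-≤ ρ _ _ (begin
        ρ ℕ.+ ρ ℕ.* x ℕ.* Q          ≡⟨ solve 3 (λ ρ x Q → ρ :+ ρ :* x :* Q := ρ :* (con 1 :+ x :* Q)) refl ρ x Q ⟩
        ρ ℕ.* (1 ℕ.+ x ℕ.* Q)        ≤⟨ sum≤ ⟩
        Smax                         ≡⟨ ℕ.m+n∸m≡n M Smax ⟨
        M ℕ.+ Smax ℕ.∸ M             ≤⟨ ℕ.∸-monoˡ-≤ M M+Smax≤n ⟩
        n ℕ.∸ M                      ≡⟨ n∸M≡ ⟩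
        ρ ℕ.+ κ ℕ.* Q                ∎))
        where open ℕ.≤-Reasoning

      -- The solution of M b + weigh w ks = n: indeed n - M - ρ (1 + x Q) = (κ - ρ x) M H, and
      -- `ρx≤κ` makes the subtraction exact.
      y = κ ℕ.∸ ρ ℕ.* x
      b = 1 ℕ.+ y ℕ.* H

      total : M ℕ.* b ℕ.+ weigh w ks ≡ n
      total = begin
        M ℕ.* b ℕ.+ weigh w ks
          ≡⟨ cong (M ℕ.* b ℕ.+_) sum-ks ⟩
        M ℕ.* (1 ℕ.+ y ℕ.* H) ℕ.+ ρ ℕ.* (1 ℕ.+ x ℕ.* (M ℕ.* H))
          ≡⟨ solve 5 (λ M y H ρ x → M :* (con 1 :+ y :* H) :+ ρ :* (con 1 :+ x :* (M :* H)) := M :+ (ρ :+ (y :+ ρ :* x) :* (M :* H))) refl M y H ρ x ⟩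
        M ℕ.+ (ρ ℕ.+ (y ℕ.+ ρ ℕ.* x) ℕ.* Q)
          ≡⟨ cong (λ a → M ℕ.+ (ρ ℕ.+ a ℕ.* Q)) (ℕ.m∸n+n≡m ρx≤κ) ⟩
        M ℕ.+ (ρ ℕ.+ κ ℕ.* Q)
          ≡⟨ cong (M ℕ.+_) (sym n∸M≡) ⟩
        M ℕ.+ (n ℕ.∸ M)
          ≡⟨ ℕ.m+[n∸m]≡n (ℕ.≤-trans (ℕ.m≤m+n M Smax) M+Smax≤n) ⟩
        n ∎
        where open ≡-Reasoning

      Bmax<b : Bmax < b
      Bmax<b = ℕ.*-cancelˡ-≤ M (ℕ.+-cancelʳ-≤ (weigh w ks) _ _ (begin
        M ℕ.* suc Bmax ℕ.+ weigh w ks        ≤⟨ ℕ.+-monoʳ-≤ (M ℕ.* suc Bmax) (ℕ.≤-trans (ℕ.≤-reflexive sum-ks) sum≤) ⟩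
        M ℕ.* suc Bmax ℕ.+ Smax              ≤⟨ ℕ.+-monoʳ-≤ (M ℕ.* suc Bmax) (ℕ.m≤n+m Smax M) ⟩
        M ℕ.* suc Bmax ℕ.+ (M ℕ.+ Smax)      ≡⟨ ℕ.+-comm (M ℕ.* suc Bmax) _ ⟩
        n₀                                ≤⟨ n₀≤n ⟩
        n                                 ≡⟨ total ⟨
        M ℕ.* b ℕ.+ weigh w ks            ∎))
        where open ℕ.≤-Reasoning

      divisor-coprime : ∀ {b₂} → b₂ ∣ b → ∀ d → 0 < d → d < k ℕ.+ t → Coprime b₂ d
      divisor-coprime b₂∣b d 0<d d<k+t {i} (i∣b₂ , i∣d) = ∣1⇒≡1 (∣m+n∣m⇒∣n (subst (i ∣_) (ℕ.+-comm 1 (y ℕ.* H)) (∣-trans i∣b₂ b₂∣b))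
        (∣-trans i∣d (∣-trans (∣! 0<d (ℕ.<⇒≤ d<k+t)) (n∣m*n y))))

      k+ℓ≤K : k ℕ.+ ℓ ≤ K
      k+ℓ≤K = ℕ.+-monoʳ-≤ k (ℕ.≤-trans (ℕ.≤-reflexive (length-repeat ρ is)) (ℕ.*-monoˡ-≤ (length is) (ℕ.<⇒≤ (m%n<n (n ℕ.∸ M) Q))))

      finish : ∀ {K′} → K ≤ K′ → (N : PointedModule K′) → 1 < FiniteAbelianGroup.order (PointedModule.group N) →
               FiniteAbelianGroup.order (PointedModule.group N) ∣ b →
               ∃ λ m → ∃ λ l → ∃ λ (u : Fin l → ℕ) → m ℕ.+ ∑ u ≡ n × Array[ t , k ] m u (λ _ → t)
      finish K≤K′ N 1<a (divides b₂ eq) = M ℕ.* b₂ ℕ.* a , ℓ , w ∘ List.lookup ks ,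
        trans (cong₂ ℕ._+_ (trans (ℕ.*-assoc M b₂ a) (cong (M ℕ.*_) (sym eq))) (∑-lookup w ks)) total ,
        unrestricted (List.lookup ks) b₂ b₂>0 (divisor-coprime (divides a (trans eq (ℕ.*-comm b₂ a))))
          (restrict N (λ i → inject≤ i k+ℓ≤K′) (λ {i} {j} → Fin.inject≤-injective k+ℓ≤K′ k+ℓ≤K′ i j)) 1<a
        where
        a = FiniteAbelianGroup.order (PointedModule.group N)
        k+ℓ≤K′ = ℕ.≤-trans k+ℓ≤K K≤K′
        b₂>0 : 0 < b₂
        b₂>0 = ℕ.n≢0⇒n>0 λ { refl → contradiction eq λ () }

      conclude : (∃ λ q → 1 < q × q ℕ.^ E ∣ b) ⊎
                 (∃ λ r → r ∣ b × b ≤ r ℕ.* Bmax × 0 < r × (∀ i → 0 < i → i ≤ K → Coprime r i)) →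
                 ∃ λ m → ∃ λ l → ∃ λ (u : Fin l → ℕ) → m ℕ.+ ∑ u ≡ n × Array[ t , k ] m u (λ _ → t)
      conclude (inj₁ (suc p , 1<q , power∣b)) = finish (ℕ.n≤1+n K) (Tower.module′ (tower p K))
        (subst (1 <_) (sym (Tower.order≡ (tower p K))) (1<q⇒1<q^ 1<q (towerExponent>0 K)))
        (subst (_∣ b) (sym (Tower.order≡ (tower p K))) power∣b)
      -- The divisor 1 would force b ≤ `Bmax`; it has to be excluded because the trivial group
      -- contains no γ ≠ 0.
      conclude (inj₂ (suc zero , _ , b≤ , _ , _)) = contradiction (ℕ.≤-trans b≤ (ℕ.≤-reflexive (ℕ.*-identityˡ Bmax))) (ℕ.<⇒≱ Bmax<b)
      conclude (inj₂ (suc (suc r) , r∣b , _ , _ , coprime)) = finish ℕ.≤-refl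
        (cyclic (suc r) K λ d 0<d d<K → coprime d 0<d (ℕ.<⇒≤ d<K)) (s≤s (s≤s z≤n)) r∣b

      construct : ∃ λ m → ∃ λ l → ∃ λ (u : Fin l → ℕ) → m ℕ.+ ∑ u ≡ n × Array[ t , k ] m u (λ _ → t)
      construct = conclude (proj₂ (largeDivisor E K) b (s≤s z≤n))

module Existence (t′ k : ℕ) (t≤k : suc t′ ≤ k) where
  open Ingredients t′ k t≤k

  private
    R-1 : ∀ {q b} → q ≡1mod b → R q ≡1mod b
    R-1 {q} {b} q≡1 = let Y , eq = R-power q in subst (_≡1mod b) (sym eq) (≡1mod-^ X (≡1mod-^ Y q≡1))

    family = chain-exists R R-1 (ℕ.<-trans (s≤s z≤n) ∘ 1<R) (suc k ℕ.* t) (suc t)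

    q : Fin (suc t) → ℕ
    q = proj₁ family

    q-large = proj₁ (proj₂ family)
    1<q = proj₁ (proj₂ (proj₂ family))
    chain = proj₂ (proj₂ (proj₂ family))

    w : Fin (suc t) → ℕ
    w = cofactor (R ∘ q)

    M : ℕ
    M = ∏ (λ i → V (q i) ℕ.* R (q i))

    M>0 : 0 < M
    M>0 = ∏>0 λ i → ℕ.*-mono-< (0<q⇒0<q^ X (ℕ.<-trans (s≤s z≤n) (1<q i))) (ℕ.<-trans (s≤s z≤n) (1<R (1<q i)))

  module _ (kind : Fin l → Fin (suc t)) where

    small : ∀ e → ∑ e ≤ t → Array[ t , k ] M (w ∘ kind) e
    small e ∑e≤t = let j , absent = unusedKind e kind ∑e≤t in
      missing q q-large 1<q kind j e (∑e≤t , absent)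

    -- Types with ∑ e ≤ t have at most t live labels, so k + t points suffice here. Hence b only has
    -- to be coprime to the numbers below k + t, a condition independent of the number of labels.
    scaled : ∀ b → 0 < b → (∀ d → 0 < d → d < k ℕ.+ t → Coprime b d) →
             ∀ e → ∑ e ≤ t → Array[ t , k ] (M ℕ.* b) (w ∘ kind) e
    -- A group of order 1 has no γ ≠ 0, so no extension is made for b = 1.
    scaled (suc zero)    _ _  e ∑e≤t = resize M>0 (ℕ.*-mono-< M>0 (s≤s z≤n)) (sym (ℕ.*-identityʳ M)) (λ _ _ → refl) (small e ∑e≤t)
    scaled (suc (suc b)) _ cp e ∑e≤t = extend (hasModule (cyclic (suc b) (k ℕ.+ t) cp) refl) (s≤s (s≤s z≤n)) (λ _ → true) ∑e≤t
      λ e′ e′≤e → small e′ (ℕ.≤-trans (∑-mono e′≤e) ∑e≤t)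

    -- With a point of its own for each label, every capacity can be t; the arrays required over the
    -- polynomials still have ∑ e′ ≤ t, because all labels are free and D has at most t zeros.
    unrestricted : ∀ b → 0 < b → (∀ d → 0 < d → d < k ℕ.+ t → Coprime b d) →
                   (N : PointedModule (k ℕ.+ l)) → 1 < FiniteAbelianGroup.order (PointedModule.group N) →
                   Array[ t , k ] (M ℕ.* b ℕ.* FiniteAbelianGroup.order (PointedModule.group N)) (w ∘ kind) (λ _ → t)
    unrestricted b 0<b cp N 1<a = let γ , γ≢0 = FiniteAbelianGroup.nonzero (PointedModule.group N) 1<a in
      multiply N γ γ≢0 (λ _ → true) id (λ _ _ eq → eq) λ e′ _ ∑e′≤t → scaled b 0<b cp e′ ∑e′≤t

  typedArray-exists : ∃ λ n₀ → ∀ n → n₀ ≤ n → ∃ λ m → ∃ λ l → ∃ λ (u : Fin l → ℕ) →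
                      m ℕ.+ ∑ u ≡ n × Array[ t , k ] m u (λ _ → t)
  typedArray-exists = Assembly.typedArray-exists t k M (suc t) M>0 w (cofactors-generate t (R ∘ q) chain) unrestricted

open import Data.Nat using (_+_; _∸_; _^_)

-- Orthogonal arrays

labelCount≤card : (S : Vec Bool k) (κ : Fin k → Maybe (Fin l)) → ∀ c → labelCount S κ c ≤ card S
labelCount≤card []          κ c = z≤n
labelCount≤card (false ∷ S) κ c = labelCount≤card S (κ ∘ suc) c
labelCount≤card (true  ∷ S) κ c with κ zero
... | nothing = ℕ.≤-trans (labelCount≤card S (κ ∘ suc) c) (ℕ.n≤1+n _)
... | just c′ with c Fin.≟ c′
... | yes _ = s≤s (labelCount≤card S (κ ∘ suc) c)
... | no _  = ℕ.≤-trans (labelCount≤card S (κ ∘ suc) c) (ℕ.n≤1+n _)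

position : (w : Fin n → ℕ) → Σ (Fin n) (Fin ∘ w) → Fin (∑ w)
position w (zero  , j) = j ↑ˡ ∑ (w ∘ suc)
position w (suc c , j) = w zero ↑ʳ position (w ∘ suc) (c , j)

shift : (w : Fin (suc n) → ℕ) → Fin (w zero) ⊎ Σ (Fin n) (Fin ∘ w ∘ suc) → Σ (Fin (suc n)) (Fin ∘ w)
shift w (inj₁ j)       = zero , j
shift w (inj₂ (c , j)) = suc c , j

locate : (w : Fin n → ℕ) → Fin (∑ w) → Σ (Fin n) (Fin ∘ w)
locate {suc n} w i = shift w (Sum.map₂ (locate (w ∘ suc)) (splitAt (w zero) i))

locate-position : (w : Fin n → ℕ) → ∀ s → locate w (position w s) ≡ s
locate-position w (zero  , j) = cong (shift w ∘ Sum.map₂ (locate (w ∘ suc))) (Fin.splitAt-↑ˡ (w zero) j _)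
locate-position w (suc c , j) = trans
  (cong (shift w ∘ Sum.map₂ (locate (w ∘ suc))) (Fin.splitAt-↑ʳ (w zero) _ (position (w ∘ suc) (c , j))))
  (cong (shift w ∘ inj₂) (locate-position (w ∘ suc) (c , j)))

position-locate : (w : Fin n → ℕ) → ∀ i → position w (locate w i) ≡ i
position-locate {suc n} w i = trans (go (splitAt (w zero) i)) (Fin.join-splitAt (w zero) _ i)
  where
  go : ∀ s → position w (shift w (Sum.map₂ (locate (w ∘ suc)) s)) ≡ join (w zero) _ s
  go (inj₁ j) = refl
  go (inj₂ i) = cong (w zero ↑ʳ_) (position-locate (w ∘ suc) i)

encode : (w : Fin l → ℕ) → Symbols m w → Fin (m + ∑ w)
encode {m = m} w = join m (∑ w) ∘ Sum.map₂ (position w)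

decode : (w : Fin l → ℕ) → Fin (m + ∑ w) → Symbols m w
decode {m = m} w = Sum.map₂ (locate w) ∘ splitAt m

decode-encode : (w : Fin l → ℕ) → ∀ s → decode {m = m} w (encode w s) ≡ s
decode-encode {m = m} w s = trans (cong (Sum.map₂ (locate w)) (Fin.splitAt-join m (∑ w) (Sum.map₂ (position w) s))) (go s)
  where
  go : ∀ s → Sum.map₂ (locate w) (Sum.map₂ (position w) s) ≡ s
  go (inj₁ _) = refl
  go (inj₂ s) = cong inj₂ (locate-position w s)

encode-decode : (w : Fin l → ℕ) → ∀ i → encode {m = m} w (decode w i) ≡ i
encode-decode {m = m} w i = trans (go (splitAt m i)) (Fin.join-splitAt m (∑ w) i)
  where
  go : ∀ s → join m (∑ w) (Sum.map₂ (position w) (Sum.map₂ (locate w) s)) ≡ join m (∑ w) s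
  go (inj₁ _) = refl
  go (inj₂ i) = cong (join m (∑ w) ∘ inj₂) (position-locate w i)

image : (Fin strength → Fin k) → Vec Bool k
image {zero}  c = replicate _ false
image {suc t} c = image (c ∘ suc) [ c zero ]≔ true

∈-image⁻ : (c : Fin strength → Fin k) → ∀ i → lookup (image c) i ≡ true → ∃ λ j → c j ≡ i
∈-image⁻ {zero}  c i i∈ = contradiction (trans (sym (lookup-replicate i false)) i∈) λ ()
∈-image⁻ {suc t} c i i∈ with c zero Fin.≟ i
... | yes eq = zero , eq
... | no neq = let j , eq = ∈-image⁻ (c ∘ suc) i (trans (sym (lookup∘update′ (neq ∘ sym) (image (c ∘ suc)) true)) i∈) in suc j , eq

∈-image⁺ : (c : Fin strength → Fin k) → ∀ j → lookup (image c) (c j) ≡ true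
∈-image⁺ c zero = lookup∘update (c zero) (image (c ∘ suc)) true
∈-image⁺ c (suc j) with c (suc j) Fin.≟ c zero
... | yes eq = trans (cong (lookup (image c)) eq) (lookup∘update (c zero) (image (c ∘ suc)) true)
... | no neq = trans (lookup∘update′ neq (image (c ∘ suc)) true) (∈-image⁺ (c ∘ suc) j)

card-update : (S : Vec Bool k) → ∀ i → lookup S i ≡ false → card (S [ i ]≔ true) ≡ suc (card S)
card-update (false ∷ S) zero    _  = refl
card-update (true  ∷ S) (suc i) eq = cong suc (card-update S i eq)
card-update (false ∷ S) (suc i) eq = card-update S i eq

card-replicate : ∀ k → card (replicate k false) ≡ 0
card-replicate zero    = refl
card-replicate (suc k) = card-replicate k

card-image : (c : Fin strength → Fin k) → Injective _≡_ _≡_ c → card (image c) ≡ strength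
card-image {zero}  {k} c inj = card-replicate k
card-image {suc t} c inj = trans (card-update (image (c ∘ suc)) (c zero) c₀∉)
  (cong suc (card-image (c ∘ suc) (Fin.suc-injective ∘ inj)))
  where
  c₀∉ : lookup (image (c ∘ suc)) (c zero) ≡ false
  c₀∉ with lookup (image (c ∘ suc)) (c zero) in eq
  ... | false = refl
  ... | true  = let j , cj≡c0 = ∈-image⁻ (c ∘ suc) (c zero) eq in contradiction (inj cj≡c0) λ ()

funToFin-cong : {f g : Fin m → Fin n} → (∀ i → f i ≡ g i) → funToFin f ≡ funToFin g
funToFin-cong {zero}  eq = refl
funToFin-cong {suc m} eq = cong₂ Fin.combine (eq zero) (funToFin-cong (eq ∘ suc))

-- The rows are numbered by their entries in the first t columns.
orthogonalArray : {w : Fin l → ℕ} → 0 < strength → strength ≤ k → Array[ strength , k ] m w (λ _ → strength) →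
                  Σ (Array ((m + ∑ w) ^ strength) k (m + ∑ w)) (IsOA strength k (m + ∑ w))
orthogonalArray {strength = suc t′} {k = k} {m = m} {w = w} _ t≤k A = array , isOA
  where
  open TypedArray A
  t = suc t′
  v = m + ∑ w

  entry : Row → Fin k → Fin v
  entry r = encode w ∘ row r

  extension : (Fin t → Fin k) → (Fin t → Fin v) → Fin k → Symbols m w
  extension c x i with Fin.any? (λ j → c j Fin.≟ i)
  ... | yes (j , _) = decode w (x j)
  -- Only the columns in the image of c are compared; elsewhere any symbol will do, and t > 0
  -- provides `x zero`.
  ... | no _        = decode w (x zero)

  extension-image : ∀ c x → Injective _≡_ _≡_ c → ∀ j → extension c x (c j) ≡ decode w (x j)
  extension-image c x inj j with Fin.any? (λ j′ → c j′ Fin.≟ c j)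
  ... | yes (j′ , eq) = cong (decode w ∘ x) (inj eq)
  ... | no none       = ⊥-elim (none (j , refl))

  exists : ∀ c → Injective _≡_ _≡_ c → ∀ x → ∃ λ r → ∀ i → entry r (c i) ≡ x i
  exists c inj x = let r , agree = covers (image c) (card-image c inj) (extension c x)
                         -- On t columns no label occurs more than t times, so with capacities t
                         -- every tuple is admissible.
                         (λ a → ℕ.≤-trans (labelCount≤card (image c) _ a) (ℕ.≤-reflexive (card-image c inj)))
    in r , λ i → trans (cong (encode w) (trans (agree (c i) (∈-image⁺ c i)) (extension-image c x inj i))) (encode-decode w (x i))

  only : ∀ c → Injective _≡_ _≡_ c → ∀ {r r′} → (∀ i → entry r (c i) ≡ entry r′ (c i)) → r ≡ r′
  only c inj {r} {r′} eq = unique (image c) (card-image c inj) λ i i∈ →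
    let j , cj≡i = ∈-image⁻ c i i∈ in
    trans (sym (decode-encode w (row r i))) (trans (cong (decode w) (subst (λ i → entry r i ≡ entry r′ i) cj≡i (eq j))) (decode-encode w (row r′ i)))

  first : Fin t → Fin k
  first i = inject≤ i t≤k

  first-injective : Injective _≡_ _≡_ first
  first-injective = Fin.inject≤-injective t≤k t≤k _ _

  numbered : Fin (v ^ t) → Row
  numbered i = proj₁ (exists first first-injective (finToFun i))

  numbered-first : ∀ i j → entry (numbered i) (first j) ≡ finToFun i j
  numbered-first i = proj₂ (exists first first-injective (finToFun i))

  array : Array (v ^ t) k v
  array = entry ∘ numbered

  number : Row → Fin (v ^ t)
  number r = funToFin (entry r ∘ first)

  numbered-number : ∀ r → numbered (number r) ≡ r
  numbered-number r = only first first-injective λ i →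
    trans (numbered-first (number r) i) (Fin.finToFun-funToFin (entry r ∘ first) i)

  number-numbered : ∀ i → number (numbered i) ≡ i
  number-numbered i = trans (funToFin-cong (numbered-first i)) (Fin.funToFin-finToFin {t} {v} i)

  isOA : IsOA t k v array
  isOA c inj x = let r , r-covers = exists c inj x in
    number r ,
    (λ i → trans (cong (λ r → entry r (c i)) (numbered-number r)) (r-covers i)) ,
    λ {i} i-covers → trans (cong number (only c inj λ j → trans (r-covers j) (sym (i-covers j)))) (number-numbered i)

oa-exists : ∀ t k → 0 < t → t ≤ k → ∃ λ n₀ → ∀ n → n₀ ≤ n → Σ (Array (n ^ t) k n) (IsOA t k n)
oa-exists (suc t′) k 0<t t≤k = let n₀ , construct = Existence.typedArray-exists t′ k t≤k in n₀ , λ n n₀≤n →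
  let m , l , u , total , A = construct n n₀≤n in
  subst (λ n → Σ (Array (n ^ suc t′) k n) (IsOA (suc t′) k n)) total (orthogonalArray 0<t t≤k A)

-- Merging columns, and the threshold.

module _ (s t k : ℕ) (s<t : s < t) where
  private
    rest = t ∸ s

    t≡ : t ≡ s + rest
    t≡ = sym (ℕ.m+[n∸m]≡n (ℕ.<⇒≤ s<t))

    split : Fin t → Fin s ⊎ Fin rest
    split i = splitAt s (cast t≡ i)

    unsplit : Fin s ⊎ Fin rest → Fin t
    unsplit s⊎rest = cast (sym t≡) (join s rest s⊎rest)

    split-unsplit : ∀ a → split (unsplit a) ≡ a
    split-unsplit a = trans (cong (splitAt s) (Fin.toℕ-injective (trans (Fin.toℕ-cast t≡ (unsplit a)) (Fin.toℕ-cast (sym t≡) (join s rest a))))) (Fin.splitAt-join s rest a)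

    split-injective : ∀ {i j} → split i ≡ split j → i ≡ j
    split-injective {i} {j} eq = Fin.toℕ-injective (trans (sym (Fin.toℕ-cast t≡ i)) (trans (cong toℕ
      (trans (sym (Fin.join-splitAt s rest (cast t≡ i))) (trans (cong (join s rest) eq) (Fin.join-splitAt s rest (cast t≡ j))))) (Fin.toℕ-cast t≡ j)))

  -- The last t - s columns of an orthogonal array are merged into one.
  augment : {v : ℕ} → Σ (Array (v ^ t) (k + rest) v) (IsOA t (k + rest) v) → AOA s t k v
  augment {v} (B , isOA) = record
    { A     = λ r i → B r (i ↑ˡ rest)
    ; L     = λ r → funToFin (λ j → B r (k ↑ʳ j))
    ; isOA  = λ c inj → isOA (λ i → c i ↑ˡ rest) (inj ∘ Fin.↑ˡ-injective rest _ _)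
    ; isAug = λ c inj x y → transfer c x y (isOA (columns c ∘ split) (split-injective ∘ columns-injective c inj) ([ x , finToFun y ]′ ∘ split)) }
    where
    columns : (Fin s → Fin k) → Fin s ⊎ Fin rest → Fin (k + rest)
    columns c (inj₁ i) = c i ↑ˡ rest
    columns c (inj₂ j) = k ↑ʳ j

    columns-injective : ∀ c → Injective _≡_ _≡_ c → ∀ {a b} → columns c a ≡ columns c b → a ≡ b
    columns-injective c inj {inj₁ i} {inj₁ j} eq = cong inj₁ (inj (Fin.↑ˡ-injective rest _ _ eq))
    columns-injective c inj {inj₁ i} {inj₂ j} eq = contradiction (trans (sym (Fin.splitAt-↑ˡ k (c i) rest)) (trans (cong (splitAt k) eq) (Fin.splitAt-↑ʳ k rest j))) λ ()
    columns-injective c inj {inj₂ i} {inj₁ j} eq = contradiction (trans (sym (Fin.splitAt-↑ʳ k rest i)) (trans (cong (splitAt k) eq) (Fin.splitAt-↑ˡ k (c j) rest))) λ ()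
    columns-injective c inj {inj₂ i} {inj₂ j} eq = cong inj₂ (Fin.↑ʳ-injective k _ _ eq)

    transfer : ∀ c x y → ∃! _≡_ (λ r → ∀ i → B r (columns c (split i)) ≡ [ x , finToFun y ]′ (split i)) →
               ∃! _≡_ (λ r → (∀ i → B r (c i ↑ˡ rest) ≡ x i) × funToFin (λ j → B r (k ↑ʳ j)) ≡ y)
    transfer c x y (r , r-covers , r-unique) = r ,
      ((λ i → at (inj₁ i)) , trans (funToFin-cong λ j → at (inj₂ j)) (Fin.funToFin-finToFin {rest} {v} y)) ,
      λ {r′} (xs , ys) → r-unique λ i → covers′ r′ xs ys (split i)
      where
      at : ∀ a → B r (columns c a) ≡ [ x , finToFun y ]′ a
      at a = subst (λ a → B r (columns c a) ≡ [ x , finToFun y ]′ a) (split-unsplit a) (r-covers (unsplit a))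
      covers′ : ∀ r′ → (∀ i → B r′ (c i ↑ˡ rest) ≡ x i) → funToFin (λ j → B r′ (k ↑ʳ j)) ≡ y → ∀ a → B r′ (columns c a) ≡ [ x , finToFun y ]′ a
      covers′ r′ xs ys (inj₁ i) = xs i
      covers′ r′ xs ys (inj₂ j) = trans (sym (Fin.finToFun-funToFin (λ j → B r′ (k ↑ʳ j)) j)) (cong (λ y → finToFun y j) ys)

-- The threshold has to be computed from the two numbers alone, so 0 < t ≤ k is decided here;
-- outside that range the value 0 is a placeholder.
bound : ℕ → ℕ → ℕ
bound t k with 1 ℕ.≤? t | t ℕ.≤? k
... | yes 0<t | yes t≤k = proj₁ (oa-exists t k 0<t t≤k)
... | yes _   | no _    = 0
... | no _    | _       = 0

oa-above-bound : ∀ t k → 0 < t → t ≤ k → ∀ v → bound t k ≤ v → Σ (Array (v ^ t) k v) (IsOA t k v)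
oa-above-bound t k 0<t t≤k v ≤v with 1 ℕ.≤? t | t ℕ.≤? k
... | yes p  | yes q  = proj₂ (oa-exists t k p q) v ≤v
... | yes _  | no t≰k = contradiction t≤k t≰k
... | no t≰0 | _      = contradiction 0<t t≰0

theorem2p12 : Σ (ℕ → ℕ → ℕ) (λ vstar →
    (s t k : ℕ) → 0 < s → s < t → t ≤ k →
    (v : ℕ) → vstar t (k + t ∸ s) ≤ v → AOA s t k v)
theorem2p12 = bound , λ s t k 0<s s<t t≤k v ≤v → augment s t k s<t
  (oa-above-bound t (k + (t ∸ s)) (ℕ.<-trans 0<s s<t) (ℕ.≤-trans t≤k (ℕ.m≤m+n k (t ∸ s))) v
    (subst (λ k′ → bound t k′ ≤ v) (ℕ.+-∸-assoc k (ℕ.<⇒≤ s<t)) ≤v))
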